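{- Let $\mathcal{U}$ be a totally ordered universe with $n$ elements. There is a data structure (the Mergeable Dictionary) which maintains a partition of $\mathcal{U}$ into disjoint sets, starting from the partition into $n$ singletons, under the operations Find, Search, Split and Merge (where Merge may be applied to any two distinct sets of the current partition, arbitrarily interleaved in the order of $\mathcal{U}$), and which executes every sequence of $m$ Find, Search, Split and Merge operations in worst-case total time $O(m\log n)$.
   Context: The data structure maintains a dynamic collection $\mathcal{S}=\{S_1,S_2,\ldots\}$ of disjoint sets which partition a fixed totally ordered universe $\mathcal{U}$ with $|\mathcal{U}|=n$. The operations are: - Find$(x)$: returns (a handle to) the set $S\in\mathcal{S}$ that contains $x$. - Search$(S,x)$: returns the largest element of $S$ that is at most $x$. - Split$(S,x)$: splits $S\in\mathcal{S}$ into $A=\{y\in S : y\le x\}$ and $B=\{y\in S: y>x\}$; $S$ is removed from $\mathcal{S}$ while $A$ and $B$ are inserted. - Merge$(A,B)$: for $A,B\in\mathcal{S}$, creates $C=A\cup B$; $C$ is inserted into $\mathcal{S}$ while $A$ and $B$ are removed. The sets $A$ and $B$ need not occupy disjoint intervals of $\mathcal{U}$. The initial collection consists of the $n$ singleton sets, and the position of each element in the order of $\mathcal{U}$ is precomputed (this initialization is not counted). Elements are accessed by pointers, and time is counted in the standard unit-cost RAM model. -}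

module Defs where

open import Data.Bool.Base using (if_then_else_)
import Data.Bool.Properties as Bool
open import Data.Fin.Base using (Fin; toℕ; fromℕ<)
open import Data.Fin.Subset using (Subset; ⁅_⁆; Nonempty; ∣_∣; _∈_; _∩_; _∪_; _─_)
open import Data.List.Base using (List; []; _∷_)
open import Data.Nat.Base using (ℕ; zero; suc; _+_; _*_; _∸_; _/_; _^_; _<_)
open import Data.Nat.Logarithm using (⌈log₂_⌉)
open import Data.Nat.Properties using (_≟_; _<?_)
open import Data.Product.Base using (∃; _×_)
open import Data.Sum.Base using (_⊎_)
open import Data.Unit.Base using (⊤)
open import Data.Vec.Base using (tabulate)
open import Data.Vec.Properties using (≡-dec)
open import Level using (0ℓ)
open import Relation.Binary.Core using (Rel)
open import Relation.Binary.Definitions using (DecidableEquality)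
open import Relation.Binary.PropositionalEquality.Core using (_≡_; _≢_)
open import Relation.Binary.Structures using (IsDecTotalOrder)
open import Relation.Nullary using (¬_; does; yes; no)
open import Relation.Unary using (Pred; ｛_｝; _∖_)
  renaming (_∈_ to _∈ᴾ_; _∪_ to _∪ᴾ_; _∩_ to _∩ᴾ_)

update : {A B : Set} → DecidableEquality A → (A → B) → A → B → A → B
update _≟ᴬ_ f a b x = if does (x ≟ᴬ a) then b else f x

------------------------------------------------------------------------
-- Unit-cost RAM

Reg Addr Label : Set
Reg   = ℕ
Addr  = ℕ
Label = ℕ

data ArithOp : Set where
  add sub mul quo : ArithOp

-- Subtraction is truncated, and division by zero yields zero.
⟦_⟧ : ArithOp → ℕ → ℕ → ℕ
⟦ add ⟧ a b       = a + b
⟦ sub ⟧ a b       = a ∸ b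
⟦ mul ⟧ a b       = a * b
⟦ quo ⟧ a zero    = 0
⟦ quo ⟧ a (suc b) = a / suc b

data Instr : Set where
  const : Reg → ℕ → Instr
  copy  : Reg → Reg → Instr
  arith : ArithOp → Reg → Reg → Reg → Instr
  load  : Reg → Reg → Instr             -- load i j:  rᵢ := M[rⱼ]
  store : Reg → Reg → Instr             -- store i j:  M[rᵢ] := rⱼ
  jump  : Label → Instr
  jeq   : Reg → Reg → Label → Instr
  jlt   : Reg → Reg → Label → Instr
  halt  : Instr

Program : Set
Program = List Instr

-- Leaving the program text counts as halting.
fetch : Program → Label → Instr
fetch []      _       = halt
fetch (i ∷ _) zero    = i
fetch (_ ∷ p) (suc l) = fetch p l

record Store : Set where
  constructor ⟨_,_⟩
  field
    reg : Reg → ℕ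
    mem : Addr → ℕ

open Store public

setReg : Store → Reg → ℕ → Store
setReg σ i v = ⟨ update _≟_ (reg σ) i v , mem σ ⟩

setMem : Store → Addr → ℕ → Store
setMem σ a v = ⟨ reg σ , update _≟_ (mem σ) a v ⟩

-- One step of a machine with w-bit words.  An instruction whose result does
-- not fit into a word has no step: the machine is stuck.  Only `const` and
-- `arith` can create new values, hence only they carry the condition.
data Step (w : ℕ) (σ : Store) (pc : Label) : Instr → Label → Store → Set where
  const : ∀ {i v} → v < 2 ^ w →
          Step w σ pc (const i v) (suc pc) (setReg σ i v)
  copy  : ∀ {i j} →
          Step w σ pc (copy i j) (suc pc) (setReg σ i (reg σ j))
  arith : ∀ {o i j k} → ⟦ o ⟧ (reg σ j) (reg σ k) < 2 ^ w →
          Step w σ pc (arith o i j k) (suc pc)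
               (setReg σ i (⟦ o ⟧ (reg σ j) (reg σ k)))
  load  : ∀ {i j} →
          Step w σ pc (load i j) (suc pc) (setReg σ i (mem σ (reg σ j)))
  store : ∀ {i j} →
          Step w σ pc (store i j) (suc pc) (setMem σ (reg σ i) (reg σ j))
  jump  : ∀ {l} → Step w σ pc (jump l) l σ
  jeq-t : ∀ {i j l} → reg σ i ≡ reg σ j → Step w σ pc (jeq i j l) l σ
  jeq-f : ∀ {i j l} → reg σ i ≢ reg σ j → Step w σ pc (jeq i j l) (suc pc) σ
  jlt-t : ∀ {i j l} → reg σ i < reg σ j → Step w σ pc (jlt i j l) l σ
  jlt-f : ∀ {i j l} → ¬ (reg σ i < reg σ j) → Step w σ pc (jlt i j l) (suc pc) σ

-- RunFrom w p l σ t σ′: started at label l in store σ, the program p halts in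
-- store σ′ after executing t instructions (the final halt included).
data RunFrom (w : ℕ) (p : Program) : Label → Store → ℕ → Store → Set where
  stop : ∀ {l σ} → fetch p l ≡ halt → RunFrom w p l σ 1 σ
  step : ∀ {l l′ σ σ′ σ″ t} → Step w σ l (fetch p l) l′ σ′ →
         RunFrom w p l′ σ′ t σ″ → RunFrom w p l σ (suc t) σ″

Run : ℕ → Program → Store → ℕ → Store → Set
Run w p = RunFrom w p 0

-- Words of O(log (n + m)) bits, for n elements and m operations.
wordSize : (c n m : ℕ) → ℕ
wordSize c n m = c * (1 + ⌈log₂ (n + m) ⌉)

------------------------------------------------------------------------
-- Operations

data Op (n : ℕ) : Set where
  find   : (x : Fin n) → Op n
  search : (S : Subset n) (x : Fin n) → Op n
  split  : (S : Subset n) (x : Fin n) → Op n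
  merge  : (A B : Subset n) → Op n

-- The code is uniform: it does not depend on the universe.
record Implementation : Set where
  field
    initCode findCode searchCode splitCode mergeCode : Program

-- A collection of subsets of the universe.
Collection : ℕ → Set₁
Collection n = Pred (Subset n) 0ℓ

singletons : ∀ {n} → Collection n
singletons S = ∃ λ x → S ≡ ⁅ x ⁆

-- The handles of the sets in the current collection; the values at other
-- sets are irrelevant.
Handles : ℕ → Set
Handles n = Subset n → ℕ

_[_↦_] : ∀ {n} → Handles n → Subset n → ℕ → Handles n
h [ S ↦ v ] = update (≡-dec Bool._≟_) h S v

-- An element is accessed by its pointer, the address of the memory cell that
-- initially holds its position.  Address 0 serves as the null pointer.
pointer : ∀ {n} → Fin n → Addr
pointer x = suc (toℕ x)

null : Addr
null = 0

-- The names in Fin n need not be sorted: _≼_ is any total order.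
module Universe {n : ℕ} {_≼_ : Rel (Fin n) 0ℓ} (O : IsDecTotalOrder _≡_ _≼_) where

  open IsDecTotalOrder O using (_≤?_)

  ↓_ : Fin n → Subset n
  ↓ x = tabulate λ y → does (y ≤? x)

  lower upper : Subset n → Fin n → Subset n
  lower S x = S ∩ (↓ x)
  upper S x = S ─ (↓ x)

  -- Positions are counted from 1.
  position : Fin n → ℕ
  position x = ∣ ↓ x ∣

  inputMem : Addr → ℕ
  inputMem zero    = n
  inputMem (suc a) with a <? n
  ... | yes a<n = position (fromℕ< a<n)
  ... | no  _   = 0

  input : Store
  input = ⟨ (λ _ → 0) , inputMem ⟩

  -- Empty parts of a split are not members of a partition, so they are not
  -- inserted.  The element x of a split need not belong to S.
  after : Collection n → Op n → Collection n
  after 𝒮 (find x)     = 𝒮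
  after 𝒮 (search S x) = 𝒮
  after 𝒮 (split S x)  = (𝒮 ∖ ｛ S ｝) ∪ᴾ ((｛ lower S x ｝ ∪ᴾ ｛ upper S x ｝) ∩ᴾ Nonempty)
  after 𝒮 (merge A B)  = (𝒮 ∖ (｛ A ｝ ∪ᴾ ｛ B ｝)) ∪ᴾ ｛ A ∪ B ｝

  Valid : Collection n → Op n → Set
  Valid 𝒮 (find x)     = ⊤
  Valid 𝒮 (search S x) = S ∈ᴾ 𝒮
  Valid 𝒮 (split S x)  = S ∈ᴾ 𝒮
  Valid 𝒮 (merge A B)  = A ∈ᴾ 𝒮 × B ∈ᴾ 𝒮 × A ≢ B

  ValidSequence : Collection n → List (Op n) → Set
  ValidSequence 𝒮 []         = ⊤
  ValidSequence 𝒮 (op ∷ ops) = Valid 𝒮 op × ValidSequence (after 𝒮 op) ops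

  -- Arguments are passed in registers 0 and 1; everything else persists from
  -- one operation to the next.
  passArgs : Handles n → Op n → Store → Store
  passArgs h (find x)     σ = setReg σ 0 (pointer x)
  passArgs h (search S x) σ = setReg (setReg σ 0 (h S)) 1 (pointer x)
  passArgs h (split S x)  σ = setReg (setReg σ 0 (h S)) 1 (pointer x)
  passArgs h (merge A B)  σ = setReg (setReg σ 0 (h A)) 1 (h B)

  code : Implementation → Op n → Program
  code D (find x)     = Implementation.findCode D
  code D (search S x) = Implementation.searchCode D
  code D (split S x)  = Implementation.splitCode D
  code D (merge A B)  = Implementation.mergeCode D

  -- The handles of newly created sets are those that split and merge return,
  -- in register 0 and, for the upper part of a split, in register 1.  All
  -- other handles remain valid.
  newHandles : Handles n → Op n → Store → Handles n
  newHandles h (find x)     σ = h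
  newHandles h (search S x) σ = h
  newHandles h (split S x)  σ = (h [ lower S x ↦ reg σ 0 ]) [ upper S x ↦ reg σ 1 ]
  newHandles h (merge A B)  σ = h [ A ∪ B ↦ reg σ 0 ]

  IsLargestBelow : Subset n → Fin n → Fin n → Set
  IsLargestBelow S x y = y ∈ S × y ≼ x × (∀ z → z ∈ S → z ≼ x → z ≼ y)

  -- The answer of an operation, returned in register 0, is right.
  Correct : Collection n → Handles n → Op n → Store → Set
  Correct 𝒮 h (find x)     σ = ∃ λ S → S ∈ᴾ 𝒮 × x ∈ S × reg σ 0 ≡ h S
  Correct 𝒮 h (search S x) σ =
    (∃ λ y → IsLargestBelow S x y × reg σ 0 ≡ pointer y) ⊎
    ((∀ z → z ∈ S → ¬ (z ≼ x)) × reg σ 0 ≡ null)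
  Correct 𝒮 h (split S x)  σ = ⊤
  Correct 𝒮 h (merge A B)  σ = ⊤

  -- The implementation executes the operations in total time T, every answer
  -- being right.
  Executes : Implementation → (w : ℕ) → Collection n → Handles n → Store →
             List (Op n) → (T : ℕ) → Set
  Executes D w 𝒮 h σ []         T = T ≡ 0
  Executes D w 𝒮 h σ (op ∷ ops) T =
    ∃ λ t → ∃ λ T′ → ∃ λ σ′ →
      Run w (code D op) (passArgs h op σ) t σ′ ×
      Correct 𝒮 h op σ′ ×
      Executes D w (after 𝒮 op) (newHandles h op σ′) σ′ ops T′ ×
      T ≡ t + T′

  -- The time of the initialization is not counted.
  Initializes : Implementation → (w : ℕ) → Store → Set
  Initializes D w σ = ∃ λ t → Run w (Implementation.initCode D) input t σ

  -- The initialization leaves in register 0 the address of a table that holds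
  -- the handles of the singletons.
  InitialHandles : Store → Handles n → Set
  InitialHandles σ h = ∀ x → h ⁅ x ⁆ ≡ mem σ (reg σ 0 + toℕ x)

{-# OPTIONS --safe #-}
module Submission where

-- A set is stored as a binary trie over the positions 0, …, 2 ^ L - 1, where
-- L = O(log n), with parent pointers and without empty subtries.  Find climbs to
-- the root and Search follows one root-to-leaf path and then descends to a
-- maximum.  Split creates at most one node per level on the way back from the
-- leaf.  Merge overlays the two tries: it stops wherever one of them has an
-- empty subtrie, so its time is proportional to the number of nodes of the
-- second trie that coincide with a node of the first one and disappear.  Hence
-- the number of nodes pays for all merges; since the L + 1 nodes of a
-- singleton are not charged, the potential of the initial partition is zero.

open import Defs
open import Data.Bool.Base using (true; false)
import Data.Bool.Properties as Bool
open import Data.Fin.Base using (Fin; zero; suc; toℕ; fromℕ<)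
import Data.Fin.Properties as Fin
open import Data.Fin.Subset using (Subset; Nonempty; _∈_; _∉_; _∪_; _─_; ⁅_⁆; ∣_∣)
open import Data.Fin.Subset.Properties
  using (∣p∣≤n; p⊂q⇒∣p∣<∣q∣; ⊆-antisym; x∈p∩q⁺; x∈p∩q⁻; x∈p∪q⁺; x∈p∪q⁻; x∈p∧x∉q⇒x∈p─q; p─q⊆p; x∈⁅x⁆; x∈⁅y⁆⇒x≡y)
open import Data.List.Base using (List; []; _∷_; _++_; map; length)
import Data.List.Membership.Propositional as List
open import Data.List.Relation.Unary.All as All using (All; []; _∷_)
open import Data.List.Relation.Unary.AllPairs using (AllPairs; []; _∷_)
open import Data.List.Relation.Unary.Any using (here; there)
open import Data.Nat.Base
open import Data.Nat.DivMod using ([m+kn]%n≡m%n; m<n⇒m%n≡m; m*n/n≡m)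
open import Data.Nat.Induction using (<-rec)
open import Data.Nat.ListAction using (sum)
open import Data.Nat.Logarithm
open import Data.Nat.Properties
open import Data.Nat.Tactic.RingSolver using (solve-∀)
open import Data.Product.Base using (∃; ∃₂; _×_; _,_; proj₁; proj₂)
open import Data.Sum.Base using (_⊎_; inj₁; inj₂; [_,_]′)
open import Data.Unit.Base using (tt)
open import Data.Vec.Base using (Vec; []; _∷_; _∷ʳ_; here; there; lookup; _[_]≔_)
open import Data.Vec.Properties using (lookup∘tabulate; lookup⇒[]=; []=⇒lookup; lookup∘updateAt; lookup∘updateAt′; ≡-dec)
open import Function.Base using (_∘_)
open import Level using (0ℓ)
open import Relation.Binary.Core using (Rel)
open import Relation.Binary.Definitions using (DecidableEquality; Symmetric)
open import Relation.Binary.PropositionalEquality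
open import Relation.Binary.Structures using (IsDecTotalOrder)
open import Relation.Nullary using (¬_; Dec; does; yes; no; contradiction)
open import Relation.Nullary.Decidable using (dec-true; dec-false)
open import Relation.Unary using () renaming (_∈_ to _∈ᴾ_)

-- The macro machine

-- The RAM has no call stack, so the recursions on tries keep theirs inside the tries: Split climbs
-- back along parent pointers, and Merge threads its pending work through the nodes that it
-- dissolves. Each recursive fragment of code is proved correct like a procedure, leading from one
-- label to another and restoring the register that stands for the stack; recursion on the trie then
-- accounts for the loop. This works because the tries of the forest have disjoint identifiers and
-- the lemmas about code that writes also state that the cells of other identifiers in use keep
-- their contents. Identifier 0 belongs to no trie, so a write through a null pointer is harmless
-- and needs no test. The potential is the sum of size - (L + 1) over all tries, truncated at 0
-- because Split can leave empty tries behind. A merge loses one node per collision but also one of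
-- two deductions, and the operation itself pays these L + 1. Identifiers are never reused; the n L
-- inner nodes of the singletons and L new identifiers per operation determine the word size.

module _ {A B : Set} (_≟ᴬ_ : DecidableEquality A) (f : A → B) where

  update-same : ∀ a b → update _≟ᴬ_ f a b a ≡ b
  update-same a b rewrite dec-true (a ≟ᴬ a) refl = refl

  update-other : ∀ {a x} b → x ≢ a → update _≟ᴬ_ f a b x ≡ f x
  update-other {a} {x} b x≢a rewrite dec-false (x ≟ᴬ a) x≢a = refl

Mem : Set
Mem = Addr → ℕ

Regs : Set
Regs = Vec ℕ 12

Field : Set
Field = Fin 4

-- Sealed so that memories and addresses stay symbolic during type checking instead of unfolding
-- into conditionals and sums; outside this block only `simulateStep` unfolds them.
opaque

  _⟨_≔_⟩ : Mem → Addr → ℕ → Mem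
  M ⟨ a ≔ v ⟩ = update _≟_ M a v

  ≔-same : ∀ M {a v} → (M ⟨ a ≔ v ⟩) a ≡ v
  ≔-same M = update-same _≟_ M _ _

  ≔-other : ∀ M {a b v} → b ≢ a → (M ⟨ a ≔ v ⟩) b ≡ M b
  ≔-other M = update-other _≟_ M _

  -- A node is an identifier k, occupying the four cells from address 4 * k on.
  cell : Field → ℕ → Addr
  cell f k = toℕ f + 4 * k

  cell-def : ∀ f k → cell f k ≡ toℕ f + 4 * k
  cell-def f k = refl

  -- A field is less than 4, so it is the remainder of the address modulo 4, and the identifier is
  -- the quotient.
  cell-injective : ∀ {f g k l} → cell f k ≡ cell g l → f ≡ g × k ≡ l
  cell-injective {f} {g} {k} {l} eq = f≡g , k≡l
    where
    remainder : ∀ (f : Field) k → cell f k % 4 ≡ toℕ f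
    remainder f k = trans (cong (λ m → (toℕ f + m) % 4) (*-comm 4 k))
                   (trans ([m+kn]%n≡m%n (toℕ f) k 4) (m<n⇒m%n≡m (Fin.toℕ<n f)))
    f≡g : f ≡ g
    f≡g = Fin.toℕ-injective (trans (sym (remainder f k)) (trans (cong (_% 4) eq) (remainder g l)))
    k≡l : k ≡ l
    k≡l = *-cancelˡ-≡ k l 4 (+-cancelˡ-≡ (toℕ f) _ _ (trans eq (cong (λ h → cell h l) (sym f≡g))))

module _ (M : Mem) where

  other-node : ∀ {f g k l v} → k ≢ l → (M ⟨ cell f l ≔ v ⟩) (cell g k) ≡ M (cell g k)
  other-node k≢l = ≔-other M (λ eq → k≢l (proj₂ (cell-injective eq)))

  other-field : ∀ {f g k l v} → g ≢ f → (M ⟨ cell f l ≔ v ⟩) (cell g k) ≡ M (cell g k)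
  other-field g≢f = ≔-other M (λ eq → g≢f (proj₁ (cell-injective eq)))

-- A macro machine with twelve registers and node-wise memory access.  Every
-- macro instruction is compiled to a block of five instructions, so that
-- labels are translated by l ↦ 5 l; registers 12 and 13 are scratch.

data Macro : Set where
  con         : Fin 12 → ℕ → Macro
  mov         : Fin 12 → Fin 12 → Macro
  ari         : ArithOp → Fin 12 → Fin 12 → Fin 12 → Macro
  get put adr : Field → Fin 12 → Fin 12 → Macro
  ld st       : Fin 12 → Fin 12 → Macro
  jmp         : Label → Macro
  jeq jlt     : Fin 12 → Fin 12 → Label → Macro
  hlt         : Macro

MacroProgram : Set
MacroProgram = List Macro

fetchMacro : MacroProgram → Label → Macro
fetchMacro []      _       = hlt
fetchMacro (i ∷ _) zero    = i
fetchMacro (_ ∷ p) (suc l) = fetchMacro p l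

nop : Instr
nop = copy 12 12

block : Macro → Vec Instr 5
block (con i v)     = const (toℕ i) v ∷ nop ∷ nop ∷ nop ∷ nop ∷ []
block (mov i j)     = copy (toℕ i) (toℕ j) ∷ nop ∷ nop ∷ nop ∷ nop ∷ []
block (ari o i j k) = arith o (toℕ i) (toℕ j) (toℕ k) ∷ nop ∷ nop ∷ nop ∷ nop ∷ []
block (get f i j)   = const 12 4 ∷ arith mul 12 12 (toℕ j) ∷ const 13 (toℕ f) ∷
                      arith add 12 13 12 ∷ load (toℕ i) 12 ∷ []
block (put f i j)   = const 12 4 ∷ arith mul 12 12 (toℕ i) ∷ const 13 (toℕ f) ∷
                      arith add 12 13 12 ∷ store 12 (toℕ j) ∷ []
block (adr f i j)   = const 12 4 ∷ arith mul 12 12 (toℕ j) ∷ const 13 (toℕ f) ∷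
                      arith add (toℕ i) 13 12 ∷ nop ∷ []
block (ld i j)      = load (toℕ i) (toℕ j) ∷ nop ∷ nop ∷ nop ∷ nop ∷ []
block (st i j)      = store (toℕ i) (toℕ j) ∷ nop ∷ nop ∷ nop ∷ nop ∷ []
block (jmp l)       = jump (l * 5) ∷ nop ∷ nop ∷ nop ∷ nop ∷ []
block (jeq i j l)   = jeq (toℕ i) (toℕ j) (l * 5) ∷ nop ∷ nop ∷ nop ∷ nop ∷ []
block (jlt i j l)   = jlt (toℕ i) (toℕ j) (l * 5) ∷ nop ∷ nop ∷ nop ∷ nop ∷ []
block hlt           = halt ∷ halt ∷ halt ∷ halt ∷ halt ∷ []

pattern #0 = zero
pattern #1 = suc #0
pattern #2 = suc #1
pattern #3 = suc #2
pattern #4 = suc #3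
pattern #5 = suc #4
pattern #6 = suc #5
pattern #7 = suc #6
pattern #8 = suc #7
pattern #9 = suc #8
pattern #10 = suc #9
pattern #11 = suc #10

compile : MacroProgram → Program
compile []      = []
compile (i ∷ p) = at #0 ∷ at #1 ∷ at #2 ∷ at #3 ∷ at #4 ∷ compile p
  where at = lookup (block i)

fetch-compile : ∀ p l (j : Fin 5) →
                fetch (compile p) (toℕ j + l * 5) ≡ lookup (block (fetchMacro p l)) j
fetch-compile [] _ #0 = refl
fetch-compile [] _ #1 = refl
fetch-compile [] _ #2 = refl
fetch-compile [] _ #3 = refl
fetch-compile [] _ #4 = refl
fetch-compile (_ ∷ _) zero #0 = refl
fetch-compile (_ ∷ _) zero #1 = refl
fetch-compile (_ ∷ _) zero #2 = refl
fetch-compile (_ ∷ _) zero #3 = refl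
fetch-compile (_ ∷ _) zero #4 = refl
fetch-compile (_ ∷ p) (suc l) #0 = fetch-compile p l #0
fetch-compile (_ ∷ p) (suc l) #1 = fetch-compile p l #1
fetch-compile (_ ∷ p) (suc l) #2 = fetch-compile p l #2
fetch-compile (_ ∷ p) (suc l) #3 = fetch-compile p l #3
fetch-compile (_ ∷ p) (suc l) #4 = fetch-compile p l #4

-- The values that an instruction reads or computes are explicit arguments, so
-- that the states along a run are given by values rather than by nested lookups.
data MacroStep (W B : ℕ) (R : Regs) (M : Mem) (l : Label) :
               Macro → Label → Regs → Mem → Set where
  con   : ∀ {i v} → v < W → MacroStep W B R M l (con i v) (suc l) (R [ i ]≔ v) M
  mov   : ∀ {i j} v → lookup R j ≡ v → MacroStep W B R M l (mov i j) (suc l) (R [ i ]≔ v) M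
  ari   : ∀ {o i j k} v → ⟦ o ⟧ (lookup R j) (lookup R k) ≡ v → v < W →
          MacroStep W B R M l (ari o i j k) (suc l) (R [ i ]≔ v) M
  get   : ∀ {f i j} k v → lookup R j ≡ k → k < B → M (cell f k) ≡ v →
          MacroStep W B R M l (get f i j) (suc l) (R [ i ]≔ v) M
  put   : ∀ {f i j} k v → lookup R i ≡ k → k < B → lookup R j ≡ v →
          MacroStep W B R M l (put f i j) (suc l) R (M ⟨ cell f k ≔ v ⟩)
  adr   : ∀ {f i j} k → lookup R j ≡ k → k < B →
          MacroStep W B R M l (adr f i j) (suc l) (R [ i ]≔ cell f k) M
  ld    : ∀ {i j} a v → lookup R j ≡ a → M a ≡ v →
          MacroStep W B R M l (ld i j) (suc l) (R [ i ]≔ v) M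
  st    : ∀ {i j} a v → lookup R i ≡ a → lookup R j ≡ v →
          MacroStep W B R M l (st i j) (suc l) R (M ⟨ a ≔ v ⟩)
  jmp   : ∀ {l′} → MacroStep W B R M l (jmp l′) l′ R M
  jeq-t : ∀ {i j l′} → lookup R i ≡ lookup R j → MacroStep W B R M l (jeq i j l′) l′ R M
  jeq-f : ∀ {i j l′} → lookup R i ≢ lookup R j → MacroStep W B R M l (jeq i j l′) (suc l) R M
  jlt-t : ∀ {i j l′} → lookup R i < lookup R j → MacroStep W B R M l (jlt i j l′) l′ R M
  jlt-f : ∀ {i j l′} → ¬ (lookup R i < lookup R j) →
          MacroStep W B R M l (jlt i j l′) (suc l) R M

infixr 5 _▸_ _▸▸_

-- Unlike `RunFrom`, such a run may end at any label, so that fragments compose by `_▸▸_`. A final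
-- `hlt` is not counted.
data Steps (W B : ℕ) (p : MacroProgram) :
           ℕ → Label → Regs → Mem → Label → Regs → Mem → Set where
  done : ∀ {l R M} → Steps W B p 0 l R M l R M
  _▸_  : ∀ {k l l′ l″ R R′ R″ M M′ M″} → MacroStep W B R M l (fetchMacro p l) l′ R′ M′ →
         Steps W B p k l′ R′ M′ l″ R″ M″ → Steps W B p (suc k) l R M l″ R″ M″

_▸▸_ : ∀ {W B p k k′ l l′ l″ R R′ R″ M M′ M″} → Steps W B p k l R M l′ R′ M′ →
       Steps W B p k′ l′ R′ M′ l″ R″ M″ → Steps W B p (k + k′) l R M l″ R″ M″
done     ▸▸ t = t
(s ▸ ss) ▸▸ t = s ▸ (ss ▸▸ t)

-- Simulation of macro runs by RAM runs

record Agree (R : Regs) (ρ : Reg → ℕ) : Set where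
  constructor agreeing
  field
    agrees : ∀ i → ρ (toℕ i) ≡ lookup R i

open Agree

agree-set : ∀ {R ρ u v} i → Agree R ρ → u ≡ v → Agree (R [ i ]≔ v) (update _≟_ ρ (toℕ i) u)
agree-set {R} {ρ} {u} i agree refl .agrees j with j Fin.≟ i
... | yes refl = trans (update-same _≟_ ρ (toℕ i) u) (sym (lookup∘updateAt i R))
... | no  j≢i  = trans (update-other _≟_ ρ u (λ eq → j≢i (Fin.toℕ-injective eq)))
                       (trans (agrees agree j) (sym (lookup∘updateAt′ j i j≢i R)))

scratch-other : ∀ (ρ : Reg → ℕ) {s} u (i : Fin 12) → 12 ≤ s → update _≟_ ρ s u (toℕ i) ≡ ρ (toℕ i)
scratch-other ρ u i 12≤s = update-other _≟_ ρ u (λ eq → <⇒≱ (Fin.toℕ<n i) (≤-trans 12≤s (≤-reflexive (sym eq))))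

agree-scratch : ∀ {R ρ u s} → 12 ≤ s → Agree R ρ → Agree R (update _≟_ ρ s u)
agree-scratch {ρ = ρ} {u} 12≤s agree .agrees i = trans (scratch-other ρ u i 12≤s) (agrees agree i)

-- `B` exceeds every identifier that is accessed. By `4 * B ≤ 2 ^ w` the addresses of their cells
-- fit into a word, and by `4 < 2 ^ w` so do the constants of the address computation.
module Simulation (w B : ℕ) (4B≤W : 4 * B ≤ 2 ^ w) (4<W : 4 < 2 ^ w) (p : MacroProgram) where

  step′ : ∀ {i l l′ σ σ′ σ″ t} → fetch (compile p) l ≡ i → Step w σ l i l′ σ′ →
          RunFrom w (compile p) l′ σ′ t σ″ → RunFrom w (compile p) l σ (suc t) σ″
  step′ refl s r = step s r

  cell<W : ∀ (f : Field) {k} → k < B → cell f k < 2 ^ w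
  cell<W f {k} k<B = begin-strict
    cell f k      ≡⟨ cell-def f k ⟩
    toℕ f + 4 * k <⟨ +-monoˡ-< (4 * k) (Fin.toℕ<n f) ⟩
    4 + 4 * k     ≡⟨ *-suc 4 k ⟨
    4 * suc k     ≤⟨ *-monoʳ-≤ 4 k<B ⟩
    4 * B         ≤⟨ 4B≤W ⟩
    2 ^ w         ∎
    where open ≤-Reasoning

  -- A `RunFrom` always extends to a halt, so a single block is described by what it prepends to an
  -- arbitrary later run. The number of instructions varies because a taken jump leaves its block
  -- after one.
  Simulated : Label → (Reg → ℕ) → Mem → Label → Regs → Mem → Set
  Simulated l ρ M l′ R′ M′ = ∃₂ λ ρ′ k → Agree R′ ρ′ × k ≤ 5 ×
    (∀ {t σ″} → RunFrom w (compile p) (l′ * 5) ⟨ ρ′ , M′ ⟩ t σ″ →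
                RunFrom w (compile p) (l * 5) ⟨ ρ , M ⟩ (k + t) σ″)

  opaque
    unfolding cell _⟨_≔_⟩

    simulateStep : ∀ {i l l′ R R′ ρ M M′} → fetchMacro p l ≡ i → Agree R ρ →
                   MacroStep (2 ^ w) B R M l i l′ R′ M′ → Simulated l ρ M l′ R′ M′
    simulateStep {i} {l} {R = R} {ρ = ρ} {M} refl agree s = go i (λ j → fetch-compile p l j) s
      where
      4k<W : ∀ {k} → k < B → 4 * k < 2 ^ w
      4k<W = cell<W #0

      12≤12 : 12 ≤ 12
      12≤12 = ≤-refl

      12≤13 : 12 ≤ 13
      12≤13 = n≤1+n 12

      module _ (i : Macro)
               (at : ∀ j → fetch (compile p) (toℕ j + l * 5) ≡ lookup (block i) j) where

        simple : ∀ {R′ ρ′ M′} → lookup (block i) #1 ≡ nop → lookup (block i) #2 ≡ nop →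
                 lookup (block i) #3 ≡ nop → lookup (block i) #4 ≡ nop →
                 Step w ⟨ ρ , M ⟩ (l * 5) (lookup (block i) #0) (suc (l * 5)) ⟨ ρ′ , M′ ⟩ →
                 Agree R′ ρ′ → Simulated l ρ M (suc l) R′ M′
        simple {ρ′ = ρ′} e₁ e₂ e₃ e₄ s agree′ =
          _ , 5 , agree-scratch 12≤12 (agree-scratch 12≤12 (agree-scratch 12≤12 (agree-scratch 12≤12 agree′))) , ≤-refl ,
          λ r → step′ (at #0) s (step′ (trans (at #1) e₁) copy (step′ (trans (at #2) e₂) copy
                  (step′ (trans (at #3) e₃) copy (step′ (trans (at #4) e₄) copy r))))

        -- The three instructions that put 4 k into register 12 and the field into 13.
        ρ₃ : Field → Fin 12 → Reg → ℕ
        ρ₃ f j = reg (setReg (setReg (setReg ⟨ ρ , M ⟩ 12 4) 12 (4 * update _≟_ ρ 12 4 (toℕ j))) 13 (toℕ f))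

        k≡ : ∀ {k} j → lookup R j ≡ k → update _≟_ ρ 12 4 (toℕ j) ≡ k
        k≡ j eq = trans (scratch-other ρ 4 j 12≤12) (trans (agrees agree j) eq)

        agree₃ : ∀ f j → Agree R (ρ₃ f j)
        agree₃ f j = agree-scratch 12≤13 (agree-scratch 12≤12 (agree-scratch 12≤12 agree))

        address : ∀ f j {k t σ″} → lookup R j ≡ k → k < B →
                  lookup (block i) #0 ≡ const 12 4 → lookup (block i) #1 ≡ arith mul 12 12 (toℕ j) →
                  lookup (block i) #2 ≡ const 13 (toℕ f) →
                  RunFrom w (compile p) (3 + l * 5) ⟨ ρ₃ f j , M ⟩ t σ″ →
                  RunFrom w (compile p) (l * 5) ⟨ ρ , M ⟩ (3 + t) σ″
        address f j {k} eq k<B e₀ e₁ e₂ r =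
          step′ (trans (at #0) e₀) (const 4<W)
            (step′ (trans (at #1) e₁) (arith (subst (λ m → 4 * m < 2 ^ w) (sym (k≡ j eq)) (4k<W k<B)))
              (step′ (trans (at #2) e₂) (const (<-trans (Fin.toℕ<n f) 4<W)) r))

        cell≡ : ∀ {k} f j → lookup R j ≡ k → toℕ f + 4 * update _≟_ ρ 12 4 (toℕ j) ≡ cell f k
        cell≡ f j eq = cong (cell f) (k≡ j eq)

      go : ∀ {l′ R′ M′} i (at : ∀ j → fetch (compile p) (toℕ j + l * 5) ≡ lookup (block i) j) →
           MacroStep (2 ^ w) B R M l i l′ R′ M′ → Simulated l ρ M l′ R′ M′
      go i@(con r v) at (con v<W) =
        simple i at refl refl refl refl (const v<W) (agree-set r agree refl)
      go i@(mov r j) at (mov v eq) =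
        simple i at refl refl refl refl copy (agree-set r agree (trans (agrees agree j) eq))
      go i@(ari o r j k) at (ari v eq v<W) =
        simple i at refl refl refl refl (arith (subst (_< 2 ^ w) (sym val) v<W)) (agree-set r agree val)
        where
        val : ⟦ o ⟧ (ρ (toℕ j)) (ρ (toℕ k)) ≡ v
        val = trans (cong₂ ⟦ o ⟧ (agrees agree j) (agrees agree k)) eq
      go i@(ld r j) at (ld a v eq M≡) =
        simple i at refl refl refl refl load (agree-set r agree (trans (cong M (trans (agrees agree j) eq)) M≡))
      go i@(st r j) at (st a v refl refl)
        rewrite sym (agrees agree r) | sym (agrees agree j) = simple i at refl refl refl refl store agree
      go i@(get f r j) at (get k v eq k<B M≡) =
        _ , 5 , agree-set r (agree-scratch 12≤12 (agree₃ i at f j)) (trans (cong M (cell≡ i at f j eq)) M≡) , ≤-refl ,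
        λ run → address i at f j eq k<B refl refl refl
          (step′ (at #3) (arith (subst (_< 2 ^ w) (sym (cell≡ i at f j eq)) (cell<W f k<B))) (step′ (at #4) load run))
      go i@(adr f r j) at (adr k eq k<B) =
        _ , 5 , agree-scratch 12≤12 (agree-set r (agree₃ i at f j) (cell≡ i at f j eq)) , ≤-refl ,
        λ run → address i at f j eq k<B refl refl refl
          (step′ (at #3) (arith (subst (_< 2 ^ w) (sym (cell≡ i at f j eq)) (cell<W f k<B))) (step′ (at #4) copy run))
      go i@(put f r j) at (put k v eq k<B eq′) =
        ρ₄ , 5 , agree₄ , ≤-refl ,
        λ {t} {σ″} run → address i at f r eq k<B refl refl refl
          (step′ (at #3) (arith (subst (_< 2 ^ w) (sym c≡) (cell<W f k<B)))
            (step′ (at #4) store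
              -- The machine stores with the address and the value found in its own registers; the
              -- macro step names the equal values of the specification.
              (subst₂ (λ a b → RunFrom w (compile p) (suc l * 5) ⟨ ρ₄ , M ⟨ a ≔ b ⟩ ⟩ t σ″)
                      (sym c≡) (sym (trans (agrees agree₄ j) eq′)) run)))
        where
        c≡ : toℕ f + 4 * update _≟_ ρ 12 4 (toℕ r) ≡ cell f k
        c≡ = cell≡ i at f r eq
        ρ₄ : Reg → ℕ
        ρ₄ = update _≟_ (ρ₃ i at f r) 12 (toℕ f + 4 * update _≟_ ρ 12 4 (toℕ r))
        agree₄ : Agree R ρ₄
        agree₄ = agree-scratch 12≤12 (agree₃ i at f r)
      go (jmp _)     at jmp        = ρ , 1 , agree , s≤s z≤n , λ r → step′ (at #0) jump r
      go (jeq i j _) at (jeq-t eq) =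
        ρ , 1 , agree , s≤s z≤n , λ r → step′ (at #0) (jeq-t (trans (agrees agree i) (trans eq (sym (agrees agree j))))) r
      go i₀@(jeq i j _) at (jeq-f neq) =
        simple i₀ at refl refl refl refl
          (jeq-f (λ eq → neq (trans (sym (agrees agree i)) (trans eq (agrees agree j))))) agree
      go (jlt i j _) at (jlt-t lt) =
        ρ , 1 , agree , s≤s z≤n , λ r → step′ (at #0) (jlt-t (subst₂ _<_ (sym (agrees agree i)) (sym (agrees agree j)) lt)) r
      go i₀@(jlt i j _) at (jlt-f nlt) =
        simple i₀ at refl refl refl refl (jlt-f (λ lt → nlt (subst₂ _<_ (agrees agree i) (agrees agree j) lt))) agree

  -- Five instructions per block; the additional one is the final `halt`, which `RunFrom` counts and
  -- `Steps` does not.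
  simulate : ∀ {k l l′ R R′ ρ M M′} → Steps (2 ^ w) B p k l R M l′ R′ M′ →
             fetchMacro p l′ ≡ hlt → Agree R ρ →
             ∃₂ λ t ρ′ → RunFrom w (compile p) (l * 5) ⟨ ρ , M ⟩ t ⟨ ρ′ , M′ ⟩ ×
                         Agree R′ ρ′ × t ≤ 5 * k + 1
  simulate {l = l} {ρ = ρ} done halts agree =
    1 , ρ , stop (trans (fetch-compile p l #0) (cong (λ i → lookup (block i) #0) halts)) , agree , ≤-refl
  simulate {suc k} (s ▸ ss) halts agree
    with ρ₁ , k₁ , agree₁ , k₁≤5 , prepend ← simulateStep refl agree s
    with t , ρ′ , run , agree′ , t≤ ← simulate ss halts agree₁ =
    k₁ + t , ρ′ , prepend run , agree′ ,
    ≤-trans (+-mono-≤ k₁≤5 t≤) (≤-reflexive (trans (sym (+-assoc 5 (5 * k) 1)) (cong (_+ 1) (sym (*-suc 5 k)))))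

-- Tries

module Tries {n : ℕ} (pos : Fin n → ℕ) (pos-injective : ∀ {x y} → pos x ≡ pos y → x ≡ y) where

  -- Trie d b stores elements with positions in [ b , b + 2 ^ d [.  A node
  -- carries the predecessor of its identifier, since 0 is the null pointer.
  data Trie : ℕ → ℕ → Set where
    nil  : ∀ {d b} → Trie d b
    leaf : ∀ {b} (x : Fin n) → pos x ≡ b → Trie 0 b
    node : ∀ {d b} → ℕ → Trie d b → Trie d (b + 2 ^ d) → Trie (suc d) b

  root : ∀ {d b} → Trie d b → ℕ
  root nil          = 0
  root (leaf x _)   = pointer x
  root (node a _ _) = suc a

  data _∈ₜ_ (x : Fin n) : ∀ {d b} → Trie d b → Set where
    leaf  : ∀ {b} {e : pos x ≡ b} → x ∈ₜ leaf x e
    left  : ∀ {d b a l r} → x ∈ₜ l → x ∈ₜ node {d} {b} a l r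
    right : ∀ {d b a l r} → x ∈ₜ r → x ∈ₜ node {d} {b} a l r

  data _∈ᵢ_ : ∀ {d b} → ℕ → Trie d b → Set where
    leaf  : ∀ {b x} {e : pos x ≡ b} → pointer x ∈ᵢ leaf x e
    here  : ∀ {d b a l r} → suc a ∈ᵢ node {d} {b} a l r
    left  : ∀ {d b a l r k} → k ∈ᵢ l → k ∈ᵢ node {d} {b} a l r
    right : ∀ {d b a l r k} → k ∈ᵢ r → k ∈ᵢ node {d} {b} a l r

  Disjoint : ∀ {d b d′ b′} → Trie d b → Trie d′ b′ → Set
  Disjoint t u = ∀ {k} → k ∈ᵢ t → ¬ k ∈ᵢ u

  Below : ∀ {d b} → ℕ → Trie d b → Set
  Below B t = ∀ {k} → k ∈ᵢ t → k < B

  -- Distinct identifiers make a write local to one node. A nonempty child below each node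
  -- guarantees that every nonempty subtrie contains a leaf, which the search for a maximum and
  -- `depth<size` rely on.
  data Proper : ∀ {d b} → Trie d b → Set where
    nil  : ∀ {d b} → Proper (nil {d} {b})
    leaf : ∀ {b x} {e : pos x ≡ b} → Proper (leaf x e)
    node : ∀ {d b a l r} → ¬ suc a ∈ᵢ l → ¬ suc a ∈ᵢ r → Disjoint l r →
           root l ≢ 0 ⊎ root r ≢ 0 → Proper l → Proper r → Proper (node {d} {b} a l r)

  -- Fields 0 and 1 of a node are its children, field 2 is its parent and field 3
  -- the least position of the right half.  A leaf is identified by the pointer
  -- of its element; field 0 is the position, and field 3 is 0 only at leaves.
  data Rep (M : Mem) : ∀ {d b} → ℕ → Trie d b → Set where
    nil  : ∀ {d b p} → Rep M p (nil {d} {b})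
    leaf : ∀ {b p x} {e : pos x ≡ b} → M (cell #0 (pointer x)) ≡ b →
           M (cell #2 (pointer x)) ≡ p → M (cell #3 (pointer x)) ≡ 0 → Rep M p (leaf x e)
    node : ∀ {d b p a l r} → M (cell #0 (suc a)) ≡ root l → M (cell #1 (suc a)) ≡ root r →
           M (cell #2 (suc a)) ≡ p → M (cell #3 (suc a)) ≡ b + 2 ^ d →
           Rep M (suc a) l → Rep M (suc a) r → Rep M p (node {d} {b} a l r)

  Same : Mem → Mem → ℕ → Set
  Same M M′ k = ∀ f → M′ (cell f k) ≡ M (cell f k)

  rep-frame : ∀ {M M′ d b p} {t : Trie d b} → (∀ {k} → k ∈ᵢ t → Same M M′ k) →
              Rep M p t → Rep M′ p t
  rep-frame same nil            = nil
  rep-frame same (leaf e₀ e₂ e₃) =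
    leaf (trans (same leaf #0) e₀) (trans (same leaf #2) e₂) (trans (same leaf #3) e₃)
  rep-frame same (node e₀ e₁ e₂ e₃ rl rr) =
    node (trans (same here #0) e₀) (trans (same here #1) e₁)
         (trans (same here #2) e₂) (trans (same here #3) e₃)
         (rep-frame (same ∘ left) rl) (rep-frame (same ∘ right) rr)

  root-∈ᵢ : ∀ {d b} (t : Trie d b) → root t ≢ 0 → root t ∈ᵢ t
  root-∈ᵢ nil          ≢0 = contradiction refl ≢0
  root-∈ᵢ (leaf _ _)   _  = leaf
  root-∈ᵢ (node _ _ _) _  = here

  ∈ᵢ⇒≢0 : ∀ {d b k} {t : Trie d b} → k ∈ᵢ t → k ≢ 0
  ∈ᵢ⇒≢0 leaf      = λ ()
  ∈ᵢ⇒≢0 here      = λ ()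
  ∈ᵢ⇒≢0 (left i)  = ∈ᵢ⇒≢0 i
  ∈ᵢ⇒≢0 (right i) = ∈ᵢ⇒≢0 i

  ∈⇒∈ᵢ : ∀ {d b x} {t : Trie d b} → x ∈ₜ t → pointer x ∈ᵢ t
  ∈⇒∈ᵢ leaf      = leaf
  ∈⇒∈ᵢ (left i)  = left (∈⇒∈ᵢ i)
  ∈⇒∈ᵢ (right i) = right (∈⇒∈ᵢ i)

  ∈⇒root≢0 : ∀ {d b x} {t : Trie d b} → x ∈ₜ t → root t ≢ 0
  ∈⇒root≢0 leaf      ()
  ∈⇒root≢0 (left _)  ()
  ∈⇒root≢0 (right _) ()

  rep-parent : ∀ {M d b p} {t : Trie d b} → root t ≢ 0 → Rep M p t → M (cell #2 (root t)) ≡ p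
  rep-parent ≢0 nil                   = contradiction refl ≢0
  rep-parent _  (leaf _ e₂ _)         = e₂
  rep-parent _  (node _ _ e₂ _ _ _)   = e₂

  rep-position : ∀ {M d b p x} {t : Trie d b} → x ∈ₜ t → Rep M p t → M (cell #0 (pointer x)) ≡ pos x
  rep-position (leaf {e = e}) (leaf e₀ _ _)           = trans e₀ (sym e)
  rep-position (left i)       (node _ _ _ _ rl _)     = rep-position i rl
  rep-position (right i)      (node _ _ _ _ _ rr)     = rep-position i rr

  -- For the empty trie the write goes to identifier 0, whose cells represent nothing.
  rep-reparent : ∀ {M d b p q} {t : Trie d b} → Proper t → Rep M p t →
                 Rep (M ⟨ cell #2 (root t) ≔ q ⟩) q t
  rep-reparent _ nil = nil
  rep-reparent {M} _ (leaf e₀ _ e₃) =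
    leaf (trans (other-field M (λ ())) e₀) (≔-same M) (trans (other-field M (λ ())) e₃)
  rep-reparent {M} (node ∉l ∉r _ _ _ _) (node e₀ e₁ _ e₃ rl rr) =
    node (trans (other-field M (λ ())) e₀) (trans (other-field M (λ ())) e₁)
         (≔-same M) (trans (other-field M (λ ())) e₃)
         (rep-frame (λ i _ → other-node M (λ { refl → ∉l i })) rl)
         (rep-frame (λ i _ → other-node M (λ { refl → ∉r i })) rr)

  double-2^ : ∀ b d → b + 2 ^ d + 2 ^ d ≡ b + 2 ^ suc d
  double-2^ b d = identity b (2 ^ d)
    where
    identity : ∀ b x → b + x + x ≡ b + 2 * x
    identity = solve-∀

  mid≢0 : ∀ b d → b + 2 ^ d ≢ 0
  mid≢0 b d eq = <⇒≢ (≤-trans (m^n>0 2 d) (m≤n+m _ b)) (sym eq)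

  ∈-range : ∀ {d b x} {t : Trie d b} → x ∈ₜ t → b ≤ pos x × pos x < b + 2 ^ d
  ∈-range (leaf {e = refl}) = ≤-refl , ≤-reflexive (+-comm 1 _)
  ∈-range {suc d} {b} (left i) with b≤ , <c ← ∈-range i =
    b≤ , <-≤-trans <c (+-monoʳ-≤ b (m≤m+n (2 ^ d) _))
  ∈-range {suc d} {b} (right i) with b≤ , <c ← ∈-range i =
    m+n≤o⇒m≤o b b≤ , <-≤-trans <c (≤-reflexive (double-2^ b d))

  size : ∀ {d b} → Trie d b → ℕ
  size nil          = 0
  size (leaf _ _)   = 1
  size (node _ l r) = suc (size l + size r)

  -- A nonempty proper trie contains a whole path from its root to a leaf. This makes the deduction
  -- of `suc L` in the potential exact for such tries.
  depth<size : ∀ {d b} {t : Trie d b} → Proper t → root t ≢ 0 → d < size t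
  depth<size nil  ≢0 = contradiction refl ≢0
  depth<size leaf _  = s≤s z≤n
  depth<size (node {r = r} _ _ _ (inj₁ l≢0) pl _) _ = s≤s (≤-trans (depth<size pl l≢0) (m≤m+n _ (size r)))
  depth<size (node {l = l} _ _ _ (inj₂ r≢0) _ pr) _ = s≤s (≤-trans (depth<size pr r≢0) (m≤n+m _ (size l)))

  -- The first trie keeps its identifiers wherever both have a node. The value on two leaves is
  -- arbitrary, because disjoint tries never have leaves at the same position.
  meld : ∀ {d b} → Trie d b → Trie d b → Trie d b
  meld nil            u            = u
  meld t@(leaf _ _)   _            = t
  meld t@(node _ _ _) nil          = t
  meld (node a l r) (node _ l′ r′) = node a (meld l l′) (meld r r′)

  collisions : ∀ {d b} → Trie d b → Trie d b → ℕ
  collisions nil          _              = 0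
  collisions (leaf _ _)   _              = 0
  collisions (node _ _ _) nil            = 0
  collisions (node _ l r) (node _ l′ r′) = suc (collisions l l′ + collisions r r′)

  -- Equal positions force equal elements, and the pointer of the element is the identifier of both
  -- leaves.
  leaves-not-disjoint : ∀ {b x y} {e : pos x ≡ b} {e′ : pos y ≡ b} → ¬ Disjoint (leaf x e) (leaf y e′)
  leaves-not-disjoint {e = e} {e′} disj with refl ← pos-injective (trans e (sym e′)) = disj leaf leaf

  disjoint-left : ∀ {d b a l r a′ l′ r′} → Disjoint (node {d} {b} a l r) (node {d} {b} a′ l′ r′) → Disjoint l l′
  disjoint-left disj i j = disj (left i) (left j)

  disjoint-right : ∀ {d b a l r a′ l′ r′} → Disjoint (node {d} {b} a l r) (node {d} {b} a′ l′ r′) → Disjoint r r′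
  disjoint-right disj i j = disj (right i) (right j)

  -- At each collision two nodes become one. This is the equation by which the number of nodes pays
  -- for the running time of Merge.
  size-meld : ∀ {d b} (t u : Trie d b) → Disjoint t u →
               size (meld t u) + collisions t u ≡ size t + size u
  size-meld nil          u          _    = +-identityʳ _
  size-meld (leaf _ _)   nil        _    = refl
  size-meld (leaf _ _)   (leaf _ _) disj = contradiction (λ {k} → disj {k}) leaves-not-disjoint
  size-meld (node _ l r) nil        _    = refl
  size-meld (node _ l r) (node _ l′ r′) disj = begin
    suc (m + m′) + suc (c + c′)                  ≡⟨ shuffle m m′ c c′ ⟩
    2 + ((m + c) + (m′ + c′))                    ≡⟨ cong₂ (λ x y → 2 + (x + y))
                                                     (size-meld l l′ (disjoint-left disj))
                                                     (size-meld r r′ (disjoint-right disj)) ⟩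
    2 + ((size l + size l′) + (size r + size r′)) ≡⟨ shuffle (size l) (size r) (size l′) (size r′) ⟨
    suc (size l + size r) + suc (size l′ + size r′) ∎
    where
    open ≡-Reasoning
    m = size (meld l l′)
    m′ = size (meld r r′)
    c = collisions l l′
    c′ = collisions r r′
    shuffle : ∀ m m′ c c′ → suc (m + m′) + suc (c + c′) ≡ 2 + ((m + c) + (m′ + c′))
    shuffle = solve-∀

  ∈-meld⁻ : ∀ {d b x} (t u : Trie d b) → x ∈ₜ meld t u → x ∈ₜ t ⊎ x ∈ₜ u
  ∈-meld⁻ nil          _              i = inj₂ i
  ∈-meld⁻ (leaf _ _)   _              i = inj₁ i
  ∈-meld⁻ (node _ _ _) nil            i = inj₁ i
  ∈-meld⁻ (node _ l r) (node _ l′ r′) (left i) with ∈-meld⁻ l l′ i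
  ... | inj₁ j = inj₁ (left j)
  ... | inj₂ j = inj₂ (left j)
  ∈-meld⁻ (node _ l r) (node _ l′ r′) (right i) with ∈-meld⁻ r r′ i
  ... | inj₁ j = inj₁ (right j)
  ... | inj₂ j = inj₂ (right j)

  ∈-meld⁺ˡ : ∀ {d b x} (t u : Trie d b) → x ∈ₜ t → x ∈ₜ meld t u
  ∈-meld⁺ˡ (leaf _ _)   _              i         = i
  ∈-meld⁺ˡ (node _ _ _) nil            i         = i
  ∈-meld⁺ˡ (node _ l r) (node _ l′ r′) (left i)  = left (∈-meld⁺ˡ l l′ i)
  ∈-meld⁺ˡ (node _ l r) (node _ l′ r′) (right i) = right (∈-meld⁺ˡ r r′ i)

  ∈-meld⁺ʳ : ∀ {d b x} (t u : Trie d b) → Disjoint t u → x ∈ₜ u → x ∈ₜ meld t u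
  ∈-meld⁺ʳ nil          _              _    i         = i
  ∈-meld⁺ʳ (leaf _ _)   (leaf _ _)     disj i         = contradiction (λ {k} → disj {k}) leaves-not-disjoint
  ∈-meld⁺ʳ (node _ l r) (node _ l′ r′) disj (left i)  = left (∈-meld⁺ʳ l l′ (disjoint-left disj) i)
  ∈-meld⁺ʳ (node _ l r) (node _ l′ r′) disj (right i) = right (∈-meld⁺ʳ r r′ (disjoint-right disj) i)

  ∈ᵢ-meld⁻ : ∀ {d b k} (t u : Trie d b) → k ∈ᵢ meld t u → k ∈ᵢ t ⊎ k ∈ᵢ u
  ∈ᵢ-meld⁻ nil          _              i = inj₂ i
  ∈ᵢ-meld⁻ (leaf _ _)   _              i = inj₁ i
  ∈ᵢ-meld⁻ (node _ _ _) nil            i = inj₁ i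
  ∈ᵢ-meld⁻ (node _ l r) (node _ l′ r′) here = inj₁ here
  ∈ᵢ-meld⁻ (node _ l r) (node _ l′ r′) (left i) with ∈ᵢ-meld⁻ l l′ i
  ... | inj₁ j = inj₁ (left j)
  ... | inj₂ j = inj₂ (left j)
  ∈ᵢ-meld⁻ (node _ l r) (node _ l′ r′) (right i) with ∈ᵢ-meld⁻ r r′ i
  ... | inj₁ j = inj₁ (right j)
  ... | inj₂ j = inj₂ (right j)

  root-meldˡ : ∀ {d b} (t u : Trie d b) → root t ≢ 0 → root (meld t u) ≡ root t
  root-meldˡ nil          _            ≢0 = contradiction refl ≢0
  root-meldˡ (leaf _ _)   _            _  = refl
  root-meldˡ (node _ _ _) nil          _  = refl
  root-meldˡ (node _ _ _) (node _ _ _) _  = refl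

  root-meld≢0 : ∀ {d b} (t u : Trie d b) → root t ≢ 0 → root (meld t u) ≢ 0
  root-meld≢0 t u ≢0 = ≢0 ∘ trans (sym (root-meldˡ t u ≢0))

  proper-meld : ∀ {d b} {t u : Trie d b} → Disjoint t u → Proper t → Proper u → Proper (meld t u)
  proper-meld disj nil  pu  = pu
  proper-meld disj leaf pu  = leaf
  proper-meld disj pt@(node _ _ _ _ _ _) nil = pt
  proper-meld {t = node a l r} {node a′ l′ r′} disj
    (node a∉l a∉r l#r ≢0 pl pr) (node a′∉l′ a′∉r′ l′#r′ ≢0′ pl′ pr′) =
    node a∉ a∉′ l#r′ (nonempty ≢0)
         (proper-meld (disjoint-left disj) pl pl′) (proper-meld (disjoint-right disj) pr pr′)
    where
    a∉ : ¬ suc a ∈ᵢ meld l l′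
    a∉ i with ∈ᵢ-meld⁻ l l′ i
    ... | inj₁ j = a∉l j
    ... | inj₂ j = disj here (left j)
    a∉′ : ¬ suc a ∈ᵢ meld r r′
    a∉′ i with ∈ᵢ-meld⁻ r r′ i
    ... | inj₁ j = a∉r j
    ... | inj₂ j = disj here (right j)
    l#r′ : Disjoint (meld l l′) (meld r r′)
    l#r′ i j with ∈ᵢ-meld⁻ l l′ i | ∈ᵢ-meld⁻ r r′ j
    ... | inj₁ i | inj₁ j = l#r i j
    ... | inj₁ i | inj₂ j = disj (left i) (right j)
    ... | inj₂ i | inj₁ j = disj (right j) (left i)
    ... | inj₂ i | inj₂ j = l′#r′ i j
    nonempty : root l ≢ 0 ⊎ root r ≢ 0 → root (meld l l′) ≢ 0 ⊎ root (meld r r′) ≢ 0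
    nonempty (inj₁ l≢0) = inj₁ (root-meld≢0 l l′ l≢0)
    nonempty (inj₂ r≢0) = inj₂ (root-meld≢0 r r′ r≢0)

-- Merge

-- Node b (register 1) is dissolved into node a (register 0).  The task at label
-- 10 hangs the subtree b into the slot at address r₂ of node r₃.  Dissolved
-- nodes whose right subtrees are still pending form a stack (top in register 4).
mergeMacro : MacroProgram
mergeMacro =
  con #9 0 ∷
  con #4 0 ∷
  mov #8 #0 ∷
  -- 3: collision of a and b
  get #0 #5 #1 ∷
  put #0 #1 #0 ∷
  put #2 #1 #4 ∷
  mov #4 #1 ∷
  adr #0 #2 #0 ∷
  mov #3 #0 ∷
  mov #1 #5 ∷
  -- 10: task
  jeq #1 #9 16 ∷
  ld #0 #2 ∷
  jeq #0 #9 14 ∷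
  jmp 3 ∷
  st #2 #1 ∷
  put #2 #1 #3 ∷
  -- 16: next task
  jeq #4 #9 22 ∷
  get #0 #3 #4 ∷
  adr #1 #2 #3 ∷
  get #1 #1 #4 ∷
  get #2 #4 #4 ∷
  jmp 10 ∷
  mov #0 #8 ∷
  hlt ∷ []

module Melding {n : ℕ} (pos : Fin n → ℕ) (pos-injective : ∀ {x y} → pos x ≡ pos y → x ≡ y)
               (W B : ℕ) (0<W : 0 < W) (x₆ x₇ res x₁₀ free : ℕ) where

  open Tries pos pos-injective

  Junk : Set
  Junk = Vec ℕ 5

  -- The junk consists of registers 0, 1, 2, 3 and 5. The top of the stack, in register 4, is kept
  -- apart because it has to be restored.
  regs : Junk → ℕ → Regs
  regs (a ∷ b ∷ p ∷ o ∷ t ∷ []) s = a ∷ b ∷ p ∷ o ∷ s ∷ t ∷ x₆ ∷ x₇ ∷ res ∷ 0 ∷ x₁₀ ∷ free ∷ []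

  _⊢_⟶_ : ℕ → (Label × Regs × Mem) → (Label × Regs × Mem) → Set
  k ⊢ (l , R , M) ⟶ (l′ , R′ , M′) = Steps W B mergeMacro k l R M l′ R′ M′

  -- The contract of the code from label 3 on, as of a procedure: it arrives at label 16 with the
  -- same stack `s` with which it began, so pending work is untouched.
  Collided : ∀ {d b} (t u : Trie d b) (M : Mem) (p s : ℕ) (J : Junk) → Set
  Collided t u M p s J = ∃ λ M′ → ∃₂ λ k J′ →
    k ⊢ (3 , regs J s , M) ⟶ (16 , regs J′ s , M′) ×
    Rep M′ p (meld t u) ×
    (∀ {k} → ¬ k ∈ᵢ t → ¬ k ∈ᵢ u → Same M M′ k) ×
    k ≤ 23 * collisions t u

  -- The same contract for a task, whose slot is field `g` of node `o`. The frame excepts only this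
  -- one cell of `o`, since the other child, the parent and the middle of `o` have to survive.
  Performed : ∀ {d b} (t u : Trie d b) (M : Mem) (g : Field) (o s : ℕ) (J : Junk) → Set
  Performed t u M g o s J = ∃ λ M′ → ∃₂ λ k J′ →
    k ⊢ (10 , regs J s , M) ⟶ (16 , regs J′ s , M′) ×
    M′ (cell g o) ≡ root (meld t u) × Rep M′ o (meld t u) ×
    (∀ {f k} → ¬ k ∈ᵢ t → ¬ k ∈ᵢ u → (k ≡ o → f ≢ g) → M′ (cell f k) ≡ M (cell f k)) ×
    k ≤ 5 + 23 * collisions t u

  meld-nilʳ : ∀ {d b} (t : Trie d b) → meld t nil ≡ t
  meld-nilʳ nil          = refl
  meld-nilʳ (leaf _ _)   = refl
  meld-nilʳ (node _ _ _) = refl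

  link : ∀ {d b} (u : Trie d b) {M g o q s a t} → root u ≢ 0 →
         M (cell g o) ≡ 0 → Rep M q u → Proper u → ¬ o ∈ᵢ u → Below B u →
         Performed nil u M g o s (a ∷ root u ∷ cell g o ∷ o ∷ t ∷ [])
  link u {M} {g} {o} u≢0 slot repU properU o∉u u<B =
    _ , _ , _ ∷ _ ∷ _ ∷ _ ∷ _ ∷ [] ,
    (jeq-f u≢0 ▸ ld (cell g o) 0 refl slot ▸ jeq-t refl ▸
     st (cell g o) (root u) refl refl ▸
     put (root u) o refl (u<B (root-∈ᵢ u u≢0)) refl ▸ done) ,
    trans (other-node M₁ (λ { refl → o∉u (root-∈ᵢ u u≢0) })) (≔-same M) ,
    rep-reparent properU (rep-frame (λ i _ → other-node M (λ { refl → o∉u i })) repU) ,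
    (λ {f} {k} _ k∉u ≢slot → trans (other-node M₁ (λ { refl → k∉u (root-∈ᵢ u u≢0) }))
      (≔-other M (λ eq → ≢slot (proj₂ (cell-injective eq)) (proj₁ (cell-injective eq))))) ,
    m≤m+n 5 _
    where
    M₁ : Mem
    M₁ = M ⟨ cell g o ≔ root u ⟩

  mutual

    perform : ∀ {d b} (t u : Trie d b) {M g o q s a z} →
              M (cell g o) ≡ root t → Rep M o t → Rep M q u → Proper t → Proper u →
              Disjoint t u → ¬ o ∈ᵢ t → ¬ o ∈ᵢ u → Below B t → Below B u →
              Performed t u M g o s (a ∷ root u ∷ cell g o ∷ o ∷ z ∷ [])
    perform t nil {M} slot repT _ _ _ _ _ _ _ _ rewrite meld-nilʳ t =
      M , _ , _ ∷ _ ∷ _ ∷ _ ∷ _ ∷ [] , jeq-t refl ▸ done , slot , repT , (λ _ _ _ → refl) , s≤s z≤n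
    perform nil u@(leaf _ _) slot _ repU _ properU _ _ o∉u _ u<B = link u (λ ()) slot repU properU o∉u u<B
    perform nil u@(node _ _ _) slot _ repU _ properU _ _ o∉u _ u<B = link u (λ ()) slot repU properU o∉u u<B
    perform (leaf _ _) (leaf _ _) _ _ _ _ _ disj _ _ _ _ = contradiction (λ {k} → disj {k}) leaves-not-disjoint
    perform t@(node a l r) u@(node a′ l′ r′) {M} {g} {o} slot repT repU properT properU disj o∉t o∉u t<B u<B
      with M′ , _ , J′ , steps , rep , frame , time ← collide a l r a′ l′ r′ repT repU properT properU disj t<B u<B =
      M′ , _ , J′ ,
      (jeq-f (λ ()) ▸ ld (cell g o) (suc a) refl slot ▸ jeq-f (λ ()) ▸ jmp ▸ steps) ,
      trans (frame o∉t o∉u g) slot , rep , (λ ∉t ∉u _ → frame ∉t ∉u _) ,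
      ≤-trans (+-monoʳ-≤ 4 time) (n≤1+n _)

    -- The dissolved node `suc a′` becomes a stack frame: field 0 receives the surviving node, field
    -- 2 the previous top of the stack, and field 1 still holds the right subtrie to be hung later.
    -- The left subtrie is handled at once.
    collide : ∀ {d b} a l r a′ l′ r′ → let t = node {d} {b} a l r; u = node a′ l′ r′ in
              ∀ {M p q s x o z} → Rep M p t → Rep M q u → Proper t → Proper u →
              Disjoint t u → Below B t → Below B u →
              Collided t u M p s (suc a ∷ suc a′ ∷ x ∷ o ∷ z ∷ [])
    collide {d} {b} a l r a′ l′ r′ {M} {p} {q} {s}
      (node l≡ r≡ p≡ m≡ repL repR) (node l′≡ r′≡ _ _ repL′ repR′)
      (node a∉l a∉r l#r _ properL properR) (node a′∉l′ a′∉r′ l′#r′ _ properL′ properR′) disj t<B u<B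
      = conclude
      where
      a≢a′ : suc a ≢ suc a′
      a≢a′ eq = disj here (subst (_∈ᵢ node a′ l′ r′) (sym eq) here)

      M₁ : Mem
      M₁ = M ⟨ cell #0 (suc a′) ≔ suc a ⟩ ⟨ cell #2 (suc a′) ≔ s ⟩

      same₁ : ∀ {k} → k ≢ suc a′ → Same M M₁ k
      same₁ k≢ f = trans (other-node (M ⟨ cell #0 (suc a′) ≔ suc a ⟩) k≢) (other-node M k≢)

      ∉-from : ∀ {k k′ d b} {t : Trie d b} → k′ ∈ᵢ t → ¬ k ∈ᵢ t → k′ ≢ k
      ∉-from i ∉ refl = ∉ i

      conclude : Collided (node {d} {b} a l r) (node a′ l′ r′) M p s _
      conclude
        with M₂ , _ , _ ∷ _ ∷ _ ∷ _ ∷ _ ∷ [] , steps₂ , l₂≡ , repL₂ , frame₂ , time₂ ←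
               perform l l′ {M₁} {#0} {suc a}
                 (trans (same₁ a≢a′ #0) l≡)
                 (rep-frame (λ i → same₁ (λ { refl → disj (left i) here })) repL)
                 (rep-frame (λ i → same₁ (∉-from i a′∉l′)) repL′)
                 properL properL′ (disjoint-left disj) a∉l (λ i → disj here (left i))
                 (t<B ∘ left) (u<B ∘ left)
        -- The left task changes neither the stack frame `suc a′` nor the right subtries, all of
        -- which lie outside `l` and `l′` and differ from `suc a`.
        with keep₂ ← (λ {k} (k∉l : ¬ k ∈ᵢ l) (k∉l′ : ¬ k ∈ᵢ l′) (k≢a : k ≢ suc a) f →
                        frame₂ {f} k∉l k∉l′ (λ k≡a → contradiction k≡a k≢a))
        with a′∉l ← (λ (i : suc a′ ∈ᵢ l) → disj (left i) here)
        with M₃ , _ , J₃ , steps₃ , r₃≡ , repR₃ , frame₃ , time₃ ←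
               perform r r′ {M₂} {#1} {suc a}
                 (trans (frame₂ a∉l (λ i → disj here (left i)) (λ _ ())) (trans (same₁ a≢a′ #1) r≡))
                 (rep-frame (λ i f → trans
                    (keep₂ (λ j → l#r j i) (λ j → disj (right i) (left j)) (∉-from i a∉r) f)
                    (same₁ (λ { refl → disj (right i) here }) f)) repR)
                 (rep-frame (λ i f → trans
                    (keep₂ (λ j → disj (left j) (right i)) (λ j → l′#r′ j i)
                           (λ { refl → disj here (right i) }) f)
                    (same₁ (∉-from i a′∉r′) f)) repR′)
                 properR properR′ (disjoint-right disj) a∉r (λ i → disj here (right i))
                 (t<B ∘ right) (u<B ∘ right) =
        M₃ , _ , J₃ ,
        (get (suc a′) (root l′) refl (u<B here) l′≡ ▸
         put (suc a′) (suc a) refl (u<B here) refl ▸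
         put (suc a′) s refl (u<B here) refl ▸
         mov (suc a′) refl ▸ adr (suc a) refl (t<B here) ▸ mov (suc a) refl ▸ mov (root l′) refl ▸
         (steps₂ ▸▸
          (jeq-f (λ ()) ▸
           get (suc a′) (suc a) refl (u<B here)
             (trans (keep₂ a′∉l a′∉l′ (a≢a′ ∘ sym) #0)
               (trans (other-field (M ⟨ cell #0 (suc a′) ≔ suc a ⟩) (λ ())) (≔-same M))) ▸
           adr (suc a) refl (t<B here) ▸
           get (suc a′) (root r′) refl (u<B here)
             (trans (keep₂ a′∉l a′∉l′ (a≢a′ ∘ sym) #1)
               (trans (other-field (M ⟨ cell #0 (suc a′) ≔ suc a ⟩) (λ ()))
                 (trans (other-field M (λ ())) r′≡))) ▸
           get (suc a′) s refl (u<B here)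
             (trans (keep₂ a′∉l a′∉l′ (a≢a′ ∘ sym) #2) (≔-same (M ⟨ cell #0 (suc a′) ≔ suc a ⟩))) ▸
           jmp ▸ steps₃))) ,
        node (trans (atA #0 (λ ())) l₂≡) r₃≡
             (trans (atA #2 (λ ())) (trans (frame₂ a∉l a∉l′ (λ _ ())) (trans (same₁ a≢a′ #2) p≡)))
             (trans (atA #3 (λ ())) (trans (frame₂ a∉l a∉l′ (λ _ ())) (trans (same₁ a≢a′ #3) m≡)))
             (rep-frame (λ i f → frame₃ (proj₁ (∉R i)) (proj₂ (∉R i)) (λ eq → contradiction eq (≢A i))) repL₂)
             repR₃ ,
        (λ ∉t ∉u f → trans (frame₃ (∉t ∘ right) (∉u ∘ right) (λ { refl → contradiction here ∉t }))
                    (trans (keep₂ (∉t ∘ left) (∉u ∘ left) (λ { refl → ∉t here }) f)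
                           (same₁ (λ { refl → ∉u here }) f))) ,
        ≤-trans (+-monoʳ-≤ 7 (+-mono-≤ time₂ (+-monoʳ-≤ 6 time₃)))
                (≤-reflexive (total (collisions l l′) (collisions r r′)))
        where
        a∉l′ : ¬ suc a ∈ᵢ l′
        a∉l′ i = disj here (left i)
        atA : ∀ f → f ≢ #1 → M₃ (cell f (suc a)) ≡ M₂ (cell f (suc a))
        atA f f≢1 = frame₃ a∉r (λ i → disj here (right i)) (λ _ → f≢1)
        ∉R : ∀ {k} → k ∈ᵢ meld l l′ → ¬ k ∈ᵢ r × ¬ k ∈ᵢ r′
        ∉R i with ∈ᵢ-meld⁻ l l′ i
        ... | inj₁ j = l#r j , λ h → disj (left j) (right h)
        ... | inj₂ j = (λ h → disj (right h) (left j)) , l′#r′ j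
        ≢A : ∀ {k} → k ∈ᵢ meld l l′ → k ≢ suc a
        ≢A i refl with ∈ᵢ-meld⁻ l l′ i
        ... | inj₁ j = a∉l j
        ... | inj₂ j = a∉l′ j
        -- The origin of 23: 7 instructions to push a frame, 6 to pop it, and at most 5 of overhead
        -- for each of the two tasks.
        total : ∀ c c′ → 7 + ((5 + 23 * c) + (6 + (5 + 23 * c′))) ≡ 23 * suc (c + c′)
        total = solve-∀

module _ {n : ℕ} (pos : Fin n → ℕ) (pos-injective : ∀ {x y} → pos x ≡ pos y → x ≡ y)
         (W B : ℕ) (0<W : 0 < W) where

  open Tries pos pos-injective

  meld-run : ∀ {d b} (t u : Trie d b) {M p q x₂ x₃ x₄ x₅ x₆ x₇ x₈ x₉ x₁₀ free} →
             root t ≢ 0 → root u ≢ 0 → Rep M p t → Rep M q u → Proper t → Proper u →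
             Disjoint t u → Below B t → Below B u →
             ∃₂ λ M′ k → ∃ λ (x : Vec ℕ 10) →
               Steps W B mergeMacro k
                 0 (root t ∷ root u ∷ x₂ ∷ x₃ ∷ x₄ ∷ x₅ ∷ x₆ ∷ x₇ ∷ x₈ ∷ x₉ ∷ x₁₀ ∷ free ∷ []) M
                 23 (root (meld t u) ∷ (x ∷ʳ free)) M′ ×
               Rep M′ p (meld t u) × (∀ {k} → ¬ k ∈ᵢ t → ¬ k ∈ᵢ u → Same M M′ k) ×
               k ≤ 5 + 23 * collisions t u
  meld-run nil        _          ≢0 = contradiction refl ≢0
  meld-run (leaf _ _) nil        _ ≢0 = contradiction refl ≢0
  meld-run (leaf _ _) (leaf _ _) _ _ _ _ _ _ disj = contradiction (λ {k} → disj {k}) leaves-not-disjoint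
  meld-run (node _ _ _) nil      _ ≢0 = contradiction refl ≢0
  meld-run (node a l r) (node a′ l′ r′) {x₂ = x₂} {x₃} {x₅ = x₅} {x₆} {x₇} {x₁₀ = x₁₀} {free} _ _ repT repU properT properU disj t<B u<B
    with M′ , k , _ ∷ _ ∷ _ ∷ _ ∷ _ ∷ [] , steps , rep , frame , time ←
      Melding.collide pos pos-injective W B 0<W x₆ x₇ (suc a) x₁₀ free
        a l r a′ l′ r′ {x = x₂} {x₃} {x₅} repT repU properT properU disj t<B u<B =
    M′ , _ , _ ∷ _ ∷ _ ∷ _ ∷ _ ∷ _ ∷ _ ∷ _ ∷ _ ∷ _ ∷ [] ,
    (con 0<W ▸ con 0<W ▸ mov (suc a) refl ▸ (steps ▸▸ (jeq-t refl ▸ mov (suc a) refl ▸ done))) ,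
    rep , frame , ≤-trans (+-monoʳ-≤ 3 (+-monoˡ-≤ 2 time)) (≤-reflexive (cong (3 +_) (+-comm _ 2)))

-- Find and Search

findMacro : MacroProgram
findMacro =
  con #9 0 ∷
  -- 1: climb
  get #2 #1 #0 ∷
  jeq #1 #9 5 ∷
  mov #0 #1 ∷
  jmp 1 ∷
  hlt ∷ []

-- Register 3 holds the last nonempty left subtree that the search path bypassed.
searchMacro : MacroProgram
searchMacro =
  con #9 0 ∷
  get #0 #2 #1 ∷
  con #3 0 ∷
  -- 3: descend
  jeq #0 #9 15 ∷
  get #3 #4 #0 ∷
  jeq #4 #9 14 ∷
  jlt #2 #4 12 ∷
  get #0 #5 #0 ∷
  jeq #5 #9 10 ∷
  mov #3 #5 ∷
  get #1 #0 #0 ∷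
  jmp 3 ∷
  get #0 #0 #0 ∷
  jmp 3 ∷
  mov #3 #0 ∷
  jeq #3 #9 24 ∷
  -- 16: maximum of the subtree in register 3
  get #3 #4 #3 ∷
  jeq #4 #9 24 ∷
  get #1 #5 #3 ∷
  jeq #5 #9 22 ∷
  mov #3 #5 ∷
  jmp 16 ∷
  get #0 #3 #3 ∷
  jmp 16 ∷
  mov #0 #3 ∷
  hlt ∷ []

module _ {n : ℕ} (pos : Fin n → ℕ) (pos-injective : ∀ {x y} → pos x ≡ pos y → x ≡ y)
         (W B : ℕ) (0<W : 0 < W) where

  open Tries pos pos-injective

  root<B : ∀ {d b} (t : Trie d b) → Below B t → root t ≢ 0 → root t < B
  root<B t t<B ≢0 = t<B (root-∈ᵢ t ≢0)

  -- The membership proof leads from the root to the leaf and the run in the opposite direction, so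
  -- the steps of the recursive call come first; four instructions then move up to the parent.
  climb : ∀ {d b x p M y x₂ x₃ x₄ x₅ x₆ x₇ x₈ x₁₀ free} {t : Trie d b} → x ∈ₜ t → Rep M p t → Below B t →
          ∃₂ λ y′ k →
            Steps W B findMacro k
              1 (pointer x ∷ y ∷ x₂ ∷ x₃ ∷ x₄ ∷ x₅ ∷ x₆ ∷ x₇ ∷ x₈ ∷ 0 ∷ x₁₀ ∷ free ∷ []) M
              1 (root t ∷ y′ ∷ x₂ ∷ x₃ ∷ x₄ ∷ x₅ ∷ x₆ ∷ x₇ ∷ x₈ ∷ 0 ∷ x₁₀ ∷ free ∷ []) M ×
            k ≤ 4 * d
  climb leaf _ _ = _ , _ , done , z≤n
  climb {suc d} (left {a = a} {l} i) (node _ _ _ _ repL _) t<B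
    with _ , _ , steps , time ← climb i repL (t<B ∘ left) =
    _ , _ ,
    (steps ▸▸ (get (root l) (suc a) refl (root<B l (t<B ∘ left) l≢0) (rep-parent l≢0 repL) ▸
               jeq-f (λ ()) ▸ mov (suc a) refl ▸ jmp ▸ done)) ,
    ≤-trans (+-monoˡ-≤ 4 time) (≤-reflexive (trans (+-comm (4 * d) 4) (sym (*-suc 4 d))))
    where
    l≢0 : root l ≢ 0
    l≢0 = ∈⇒root≢0 i
  climb {suc d} (right {a = a} {r = r} i) (node _ _ _ _ _ repR) t<B
    with _ , _ , steps , time ← climb i repR (t<B ∘ right) =
    _ , _ ,
    (steps ▸▸ (get (root r) (suc a) refl (root<B r (t<B ∘ right) r≢0) (rep-parent r≢0 repR) ▸
               jeq-f (λ ()) ▸ mov (suc a) refl ▸ jmp ▸ done)) ,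
    ≤-trans (+-monoˡ-≤ 4 time) (≤-reflexive (trans (+-comm (4 * d) 4) (sym (*-suc 4 d))))
    where
    r≢0 : root r ≢ 0
    r≢0 = ∈⇒root≢0 i

  find-run : ∀ {d b x M x₁ x₂ x₃ x₄ x₅ x₆ x₇ x₈ x₉ x₁₀ free} {t : Trie d b} → x ∈ₜ t → Rep M 0 t → Below B t →
             ∃₂ λ k (y : Vec ℕ 10) →
               Steps W B findMacro k
                 0 (pointer x ∷ x₁ ∷ x₂ ∷ x₃ ∷ x₄ ∷ x₅ ∷ x₆ ∷ x₇ ∷ x₈ ∷ x₉ ∷ x₁₀ ∷ free ∷ []) M
                 5 (root t ∷ (y ∷ʳ free)) M ×
               k ≤ 3 + 4 * d
  find-run {t = t} i rep t<B with _ , _ , steps , time ← climb i rep t<B =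
    _ , _ ∷ _ ∷ _ ∷ _ ∷ _ ∷ _ ∷ _ ∷ _ ∷ _ ∷ _ ∷ [] ,
    (con 0<W ▸ (steps ▸▸
      (get (root t) 0 refl (root<B t t<B (∈⇒root≢0 i)) (rep-parent (∈⇒root≢0 i) rep) ▸ jeq-t refl ▸ done))) ,
    s≤s (≤-trans (+-monoˡ-≤ 2 time) (≤-reflexive (+-comm _ 2)))

  -- Every position in the right half exceeds those in the left half, so the run goes right whenever
  -- it can; `Proper` provides a left child otherwise. Leaves are recognized by field 3, as the
  -- middle of an inner node is positive.
  maximum : ∀ {d b p M x₀ x₁ x₂ x₄ x₅ x₆ x₇ x₈ x₁₀ free} (t : Trie d b) → root t ≢ 0 →
            Rep M p t → Proper t → Below B t →
            ∃₂ λ k y → ∃₂ λ x₄′ x₅′ →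
              Steps W B searchMacro k
                16 (x₀ ∷ x₁ ∷ x₂ ∷ root t ∷ x₄ ∷ x₅ ∷ x₆ ∷ x₇ ∷ x₈ ∷ 0 ∷ x₁₀ ∷ free ∷ []) M
                24 (x₀ ∷ x₁ ∷ x₂ ∷ pointer y ∷ x₄′ ∷ x₅′ ∷ x₆ ∷ x₇ ∷ x₈ ∷ 0 ∷ x₁₀ ∷ free ∷ []) M ×
              y ∈ₜ t × (∀ {z} → z ∈ₜ t → pos z ≤ pos y) × k ≤ 2 + 6 * d
  maximum nil ≢0 = contradiction refl ≢0
  maximum (leaf x e) _ (leaf _ _ e₃) _ t<B =
    _ , x , _ , _ , (get (pointer x) 0 refl (t<B leaf) e₃ ▸ jeq-t refl ▸ done) ,
    leaf , (λ { leaf → ≤-refl }) , ≤-refl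
  maximum {suc d} {b} (node a l r) _ (node e₀ e₁ _ e₃ repL repR) (node _ _ _ ≢0 properL properR) t<B
    with root r ≟ 0
  ... | no r≢0
    with _ , y , _ , _ , steps , y∈ , max , time ← maximum r r≢0 repR properR (t<B ∘ right) =
    _ , y , _ , _ ,
    (get (suc a) (b + 2 ^ d) refl (t<B here) e₃ ▸ jeq-f (mid≢0 b d) ▸
     get (suc a) (root r) refl (t<B here) e₁ ▸ jeq-f r≢0 ▸ mov (root r) refl ▸ jmp ▸ steps) ,
    right y∈ , (λ { (left i)  → <⇒≤ (<-≤-trans (proj₂ (∈-range i)) (proj₁ (∈-range y∈)))
                  ; (right i) → max i }) ,
    ≤-trans (+-monoʳ-≤ 6 time) (≤-reflexive (cong (2 +_) (sym (*-suc 6 d))))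
  ... | yes r≡0
    with l≢0 ← [ (λ l≢0 → l≢0) , (λ r≢0 → contradiction r≡0 r≢0) ]′ ≢0
    with _ , y , _ , _ , steps , y∈ , max , time ← maximum l l≢0 repL properL (t<B ∘ left) =
    _ , y , _ , _ ,
    (get (suc a) (b + 2 ^ d) refl (t<B here) e₃ ▸ jeq-f (mid≢0 b d) ▸
     get (suc a) (root r) refl (t<B here) e₁ ▸ jeq-t r≡0 ▸
     get (suc a) (root l) refl (t<B here) e₀ ▸ jmp ▸ steps) ,
    left y∈ , (λ { (left i)  → max i
                 ; (right i) → contradiction r≡0 (∈⇒root≢0 i) }) ,
    ≤-trans (+-monoʳ-≤ 6 time) (≤-reflexive (cong (2 +_) (sym (*-suc 6 d))))

  -- A nonempty subtree, in the memory M, that contains the predecessor of K in t.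
  record Candidate {d b} (M : Mem) (t : Trie d b) (K best : ℕ) : Set where
    field
      {depth base parent} : ℕ
      subtree  : Trie depth base
      depth≤   : depth ≤ d
      best≡    : best ≡ root subtree
      nonempty : root subtree ≢ 0
      rep      : Rep M parent subtree
      proper   : Proper subtree
      below    : Below B subtree
      included : ∀ {x} → x ∈ₜ subtree → x ∈ₜ t × pos x ≤ K
      maximal  : ∀ {x y} → x ∈ₜ t → pos x ≤ K → y ∈ₜ subtree → x ∈ₜ subtree ⊎ pos x ≤ pos y

  module _ {d b a K : ℕ} {M : Mem} {l : Trie d b} {r : Trie d (b + 2 ^ d)} where

    leftCandidate : ∀ {best} → K < b + 2 ^ d → Candidate M l K best → Candidate M (node a l r) K best
    leftCandidate K<mid c = record
      { Candidate c hiding (depth≤; included; maximal)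
      ; depth≤   = m≤n⇒m≤1+n (Candidate.depth≤ c)
      ; included = λ i → left (proj₁ (Candidate.included c i)) , proj₂ (Candidate.included c i)
      ; maximal  = λ { (left i)         → Candidate.maximal c i
                     ; (right i) ≤K _ → contradiction ≤K (<⇒≱ (<-≤-trans K<mid (proj₁ (∈-range i)))) } }

    rightCandidate : ∀ {best} → Candidate M r K best → Candidate M (node a l r) K best
    rightCandidate c = record
      { Candidate c hiding (depth≤; included; maximal)
      ; depth≤   = m≤n⇒m≤1+n (Candidate.depth≤ c)
      ; included = λ i → right (proj₁ (Candidate.included c i)) , proj₂ (Candidate.included c i)
      ; maximal  = λ { (left i) _ j → inj₂ (<⇒≤ (<-≤-trans (proj₂ (∈-range i))
                                        (proj₁ (∈-range (proj₁ (Candidate.included c j))))))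
                     ; (right i)    → Candidate.maximal c i } }

  -- Register 3 may hold a subtrie noted at an outer level. If this trie has nothing up to `K`, the
  -- register must come back unchanged, so that the level which noted it can conclude that the
  -- predecessor lies there.
  descend : ∀ {d b p M K best x₁ x₄ x₅ x₆ x₇ x₈ x₁₀ free} (t : Trie d b) →
            b ≤ K → K < b + 2 ^ d → Rep M p t → Proper t → Below B t →
            ∃₂ λ k best′ → ∃ λ x₀ → ∃₂ λ x₄′ x₅′ →
              Steps W B searchMacro k
                3 (root t ∷ x₁ ∷ K ∷ best ∷ x₄ ∷ x₅ ∷ x₆ ∷ x₇ ∷ x₈ ∷ 0 ∷ x₁₀ ∷ free ∷ []) M
                15 (x₀ ∷ x₁ ∷ K ∷ best′ ∷ x₄′ ∷ x₅′ ∷ x₆ ∷ x₇ ∷ x₈ ∷ 0 ∷ x₁₀ ∷ free ∷ []) M ×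
              (best′ ≡ best × (∀ {x} → x ∈ₜ t → K < pos x) ⊎ Candidate M t K best′) ×
              k ≤ 4 + 9 * d
  descend nil _ _ _ _ _ =
    _ , _ , _ , _ , _ , (jeq-t refl ▸ done) , inj₁ (refl , λ ()) , s≤s z≤n
  descend {b = b} {K = K} t@(leaf x e) b≤K K<b+1 rep@(leaf _ _ e₃) proper t<B =
    _ , _ , _ , _ , _ ,
    (jeq-f (λ ()) ▸ get (pointer x) 0 refl (t<B leaf) e₃ ▸ jeq-t refl ▸ mov (pointer x) refl ▸ done) ,
    inj₂ (record
      { subtree = t ; depth≤ = ≤-refl ; best≡ = refl ; nonempty = λ () ; rep = rep
      ; proper = proper ; below = t<B
      ; included = λ { leaf → leaf , ≤-trans (≤-reflexive e) b≤K }
      ; maximal = λ i _ _ → inj₁ i }) ,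
    ≤-refl
  descend {suc d} {b} {K = K} (node a l r) b≤K K<c (node e₀ e₁ _ e₃ repL repR) (node _ _ _ _ properL properR) t<B
    with K <? b + 2 ^ d | root l ≟ 0
  ... | yes K<mid | _
    with _ , best , _ , _ , _ , steps , result , time ←
      descend l b≤K K<mid repL properL (t<B ∘ left) =
    _ , best , _ , _ , _ ,
    (jeq-f (λ ()) ▸ get (suc a) (b + 2 ^ d) refl (t<B here) e₃ ▸ jeq-f (mid≢0 b d) ▸ jlt-t K<mid ▸
     get (suc a) (root l) refl (t<B here) e₀ ▸ jmp ▸ steps) ,
    [ (λ (eq , none) → inj₁ (eq , λ { (left i) → none i ; (right i) → <-≤-trans K<mid (proj₁ (∈-range i)) }))
    , inj₂ ∘ leftCandidate K<mid ]′ result ,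
    ≤-trans (+-monoʳ-≤ 6 time) (≤-trans (m≤n+m _ 3) (≤-reflexive (cong (4 +_) (sym (*-suc 9 d)))))
  ... | no K≮mid | yes l≡0
    with mid≤K ← ≮⇒≥ K≮mid
    with _ , best , _ , _ , _ , steps , result , time ←
      descend r mid≤K (<-≤-trans K<c (≤-reflexive (sym (double-2^ b d)))) repR properR (t<B ∘ right) =
    _ , best , _ , _ , _ ,
    (jeq-f (λ ()) ▸ get (suc a) (b + 2 ^ d) refl (t<B here) e₃ ▸ jeq-f (mid≢0 b d) ▸ jlt-f K≮mid ▸
     get (suc a) (root l) refl (t<B here) e₀ ▸ jeq-t l≡0 ▸
     get (suc a) (root r) refl (t<B here) e₁ ▸ jmp ▸ steps) ,
    [ (λ (eq , none) → inj₁ (eq , λ { (left i) → contradiction l≡0 (∈⇒root≢0 i) ; (right i) → none i }))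
    , inj₂ ∘ rightCandidate ]′ result ,
    ≤-trans (+-monoʳ-≤ 8 time) (≤-trans (n≤1+n _) (≤-reflexive (cong (4 +_) (sym (*-suc 9 d)))))
  ... | no K≮mid | no l≢0
    with mid≤K ← ≮⇒≥ K≮mid
    with _ , best , _ , _ , _ , steps , result , time ←
      descend r mid≤K (<-≤-trans K<c (≤-reflexive (sym (double-2^ b d)))) repR properR (t<B ∘ right) =
    _ , best , _ , _ , _ ,
    (jeq-f (λ ()) ▸ get (suc a) (b + 2 ^ d) refl (t<B here) e₃ ▸ jeq-f (mid≢0 b d) ▸ jlt-f K≮mid ▸
     get (suc a) (root l) refl (t<B here) e₀ ▸ jeq-f l≢0 ▸ mov (root l) refl ▸
     get (suc a) (root r) refl (t<B here) e₁ ▸ jmp ▸ steps) ,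
    -- The right half contains nothing up to `K` and register 3 still holds the left subtrie noted
    -- here, so the predecessor is the maximum of that subtrie.
    [ (λ (eq , none) → inj₂ (record
        { subtree = l ; depth≤ = n≤1+n d ; best≡ = eq ; nonempty = l≢0 ; rep = repL
        ; proper = properL ; below = t<B ∘ left
        ; included = λ i → left i , ≤-trans (<⇒≤ (proj₂ (∈-range i))) mid≤K
        ; maximal = λ { (left i) _ _ → inj₁ i ; (right i) ≤K _ → contradiction ≤K (<⇒≱ (none i)) } }))
    , inj₂ ∘ rightCandidate ]′ result ,
    ≤-trans (+-monoʳ-≤ 9 time) (≤-reflexive (cong (4 +_) (sym (*-suc 9 d))))

  search-run : ∀ {d x M x₂ x₃ x₄ x₅ x₆ x₇ x₈ x₉ x₁₀ free} (t : Trie d 0) →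
               pointer x < B → M (cell #0 (pointer x)) ≡ pos x → pos x < 2 ^ d →
               Rep M 0 t → Proper t → Below B t →
               ∃₂ λ k r → ∃ λ (y : Vec ℕ 10) →
                 Steps W B searchMacro k
                   0 (root t ∷ pointer x ∷ x₂ ∷ x₃ ∷ x₄ ∷ x₅ ∷ x₆ ∷ x₇ ∷ x₈ ∷ x₉ ∷ x₁₀ ∷ free ∷ []) M
                   25 (r ∷ (y ∷ʳ free)) M ×
                 ((∃ λ y → y ∈ₜ t × pos y ≤ pos x × (∀ {z} → z ∈ₜ t → pos z ≤ pos x → pos z ≤ pos y) ×
                           r ≡ pointer y) ⊎
                  ((∀ {z} → z ∈ₜ t → pos x < pos z) × r ≡ 0)) ×
                 k ≤ 11 + 15 * d
  search-run {d} {x} t x<B key x<2^d rep proper t<B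
    with k , best , _ , _ , _ , steps , result , time ← descend t z≤n x<2^d rep proper t<B
    with result
  ... | inj₁ (refl , none) =
    _ , 0 , _ ∷ _ ∷ _ ∷ _ ∷ _ ∷ _ ∷ _ ∷ _ ∷ _ ∷ _ ∷ [] ,
    (con 0<W ▸ get (pointer x) (pos x) refl x<B key ▸ con 0<W ▸
     (steps ▸▸ (jeq-t refl ▸ mov 0 refl ▸ done))) ,
    inj₂ (none , refl) ,
    ≤-trans (+-monoʳ-≤ 3 (+-monoˡ-≤ 2 time)) (≤-trans (≤-reflexive (cong (3 +_) (+-comm (4 + 9 * d) 2)))
      (+-mono-≤ (m≤m+n 9 2) (*-monoˡ-≤ d (m≤m+n 9 6))))
  ... | inj₂ record { subtree = s ; depth≤ = depth≤ ; best≡ = refl ; nonempty = s≢0 ; rep = repS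
                    ; proper = properS ; below = s<B ; included = included ; maximal = maximal }
    with k′ , y , _ , _ , steps′ , y∈s , max , time′ ← maximum s s≢0 repS properS s<B =
    _ , pointer y , _ ∷ _ ∷ _ ∷ _ ∷ _ ∷ _ ∷ _ ∷ _ ∷ _ ∷ _ ∷ [] ,
    (con 0<W ▸ get (pointer x) (pos x) refl x<B key ▸ con 0<W ▸
     (steps ▸▸ (jeq-f s≢0 ▸ (steps′ ▸▸ (mov (pointer y) refl ▸ done))))) ,
    inj₁ (y , proj₁ (included y∈s) , proj₂ (included y∈s) ,
          (λ i ≤K → [ max , (λ ≤y → ≤y) ]′ (maximal i ≤K y∈s)) , refl) ,
    (begin
      3 + (k + suc (k′ + 1))                            ≤⟨ +-monoʳ-≤ 3 (+-mono-≤ time (s≤s (+-monoˡ-≤ 1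
                                                           (≤-trans time′ (+-monoʳ-≤ 2 (*-monoʳ-≤ 6 depth≤)))))) ⟩
      3 + ((4 + 9 * d) + suc ((2 + 6 * d) + 1))         ≡⟨ total d ⟩
      11 + 15 * d                                       ∎)
    where
    open ≤-Reasoning
    total : ∀ d → 3 + ((4 + 9 * d) + suc ((2 + 6 * d) + 1)) ≡ 11 + 15 * d
    total = solve-∀

-- Split

-- The path of the split key enters child s of node r₃.  The part m of that
-- child moves to a new node, the part k stays.
ascendMacro : Label → (s s̄ : Field) (m k : Fin 12) → MacroProgram
ascendMacro l s s̄ m k =
  put s #11 m ∷
  put s̄ #11 #9 ∷
  put #3 #11 #7 ∷
  put #2 m #11 ∷
  put s #3 k ∷
  put #2 k #3 ∷
  jeq m #9 (8 + l) ∷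
  mov m #11 ∷
  jeq k #9 (10 + l) ∷
  jmp (12 + l) ∷
  get s̄ #4 #3 ∷
  jeq #4 #9 (13 + l) ∷
  mov k #3 ∷
  con #4 1 ∷
  ari add #11 #4 #11 ∷
  get #2 #3 #3 ∷
  jmp 16 ∷ []

splitMacro : MacroProgram
splitMacro =
  con #9 0 ∷
  get #0 #2 #1 ∷
  con #3 0 ∷
  -- 3: descend
  jeq #0 #9 14 ∷
  get #3 #7 #0 ∷
  jeq #7 #9 12 ∷
  mov #3 #0 ∷
  jlt #2 #7 10 ∷
  get #1 #0 #0 ∷
  jmp 3 ∷
  get #0 #0 #0 ∷
  jmp 3 ∷
  mov #5 #0 ∷
  jmp 15 ∷
  con #5 0 ∷
  con #6 0 ∷
  -- 16: ascend; registers 5 and 6 hold the lower and the upper part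
  jeq #3 #9 53 ∷
  get #3 #7 #3 ∷
  jlt #2 #7 36 ∷
  ascendMacro 19 #1 #0 #6 #5 ++
  ascendMacro 36 #0 #1 #5 #6 ++
  put #2 #5 #9 ∷
  put #2 #6 #9 ∷
  mov #0 #5 ∷
  mov #1 #6 ∷
  hlt ∷ []

-- A child pointer to a node a with children l and r, which is null if both are.
kept : (l r a : ℕ) → ℕ
kept zero    zero    a = 0
kept zero    (suc _) a = a
kept (suc _) _       a = a

kept-comm : ∀ l r a → kept l r a ≡ kept r l a
kept-comm zero    zero    a = refl
kept-comm zero    (suc _) a = refl
kept-comm (suc _) zero    a = refl
kept-comm (suc _) (suc _) a = refl

-- The six writes at the beginning of `ascendMacro`. They are unconditional: the new node is written
-- even if it will be discarded, and for a null `m` or `k` the parent is written to identifier 0.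
hang : Mem → (s s̄ : Field) (new cur mid m k : ℕ) → Mem
hang M s s̄ new cur mid m k =
  M ⟨ cell s new ≔ m ⟩ ⟨ cell s̄ new ≔ 0 ⟩ ⟨ cell #3 new ≔ mid ⟩ ⟨ cell #2 m ≔ new ⟩
    ⟨ cell s cur ≔ k ⟩ ⟨ cell #2 k ≔ cur ⟩

module _ {W B : ℕ} (0<B : 0 < B) (1<W : 1 < W) {x₀ x₁ K x₈ x₁₀ : ℕ} where

  regsU : (cur x₄ lo up mid free : ℕ) → Regs
  regsU cur x₄ lo up mid free =
    x₀ ∷ x₁ ∷ K ∷ cur ∷ x₄ ∷ lo ∷ up ∷ mid ∷ x₈ ∷ 0 ∷ x₁₀ ∷ free ∷ []

  -- The identifier `free` is used up even if `m` is null and the new node is dropped, so each level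
  -- takes exactly one. The bound 17 consists of 6 writes, at most 2 and 5 instructions for the two
  -- tests, and 4 to move up.
  ascend-left : ∀ {M cur x₄ mid free p other} m k →
    let M′ = hang M #0 #1 free cur mid m k in
    cur < B → m < B → k < B → free < B → suc free < W →
    M′ (cell #1 cur) ≡ other → M′ (cell #2 cur) ≡ p →
    ∃ λ c → Steps W B splitMacro c
      36 (regsU cur x₄ m k mid free) M
      16 (regsU p 1 (kept m 0 free) (kept k other cur) mid (suc free)) M′ × c ≤ 17
  ascend-left {M} {cur} {x₄} {mid} {free} {p} {other} m k cur<B m<B k<B free<B free<W other≡ p≡ =
    let c , moving , c≤ = move m
        _ , c′ , keeping , c′≤ = keep k other other≡ in
    _ ,
    (put free m refl free<B refl ▸ put free 0 refl free<B refl ▸ put free mid refl free<B refl ▸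
     put m free refl m<B refl ▸ put cur k refl cur<B refl ▸ put k cur refl k<B refl ▸
     (moving ▸▸ (keeping ▸▸
       (con 1<W ▸ ari (suc free) refl free<W ▸ get cur p refl cur<B p≡ ▸ jmp ▸ done)))) ,
    +-monoʳ-≤ 6 (+-mono-≤ c≤ (+-monoˡ-≤ 4 c′≤))
    where
    M′ : Mem
    M′ = hang M #0 #1 free cur mid m k

    move : ∀ m → ∃ λ c → Steps W B splitMacro c
             42 (regsU cur x₄ m k mid free) M′
             44 (regsU cur x₄ (kept m 0 free) k mid free) M′ × c ≤ 2
    move zero    = _ , (jeq-t refl ▸ done) , s≤s z≤n
    move (suc _) = _ , (jeq-f (λ ()) ▸ mov free refl ▸ done) , ≤-refl

    keep : ∀ {m} k other → M′ (cell #1 cur) ≡ other →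
           ∃₂ λ x₄′ c → Steps W B splitMacro c
             44 (regsU cur x₄ m k mid free) M′
             49 (regsU cur x₄′ m (kept k other cur) mid free) M′ × c ≤ 5
    keep zero    zero    eq = _ , _ , (jeq-t refl ▸ get cur 0 refl cur<B eq ▸ jeq-t refl ▸ done) , m≤m+n 3 2
    keep zero    (suc o) eq =
      _ , _ , (jeq-t refl ▸ get cur (suc o) refl cur<B eq ▸ jeq-f (λ ()) ▸ mov cur refl ▸ done) , m≤m+n 4 1
    keep (suc _) _       _  = _ , _ , (jeq-f (λ ()) ▸ jmp ▸ mov cur refl ▸ done) , m≤m+n 3 2

  ascend-right : ∀ {M cur x₄ mid free p other} m k →
    let M′ = hang M #1 #0 free cur mid m k in
    cur < B → m < B → k < B → free < B → suc free < W →
    M′ (cell #0 cur) ≡ other → M′ (cell #2 cur) ≡ p →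
    ∃ λ c → Steps W B splitMacro c
      19 (regsU cur x₄ k m mid free) M
      16 (regsU p 1 (kept k other cur) (kept m 0 free) mid (suc free)) M′ × c ≤ 17
  ascend-right {M} {cur} {x₄} {mid} {free} {p} {other} m k cur<B m<B k<B free<B free<W other≡ p≡ =
    let c , moving , c≤ = move m
        _ , c′ , keeping , c′≤ = keep k other other≡ in
    _ ,
    (put free m refl free<B refl ▸ put free 0 refl free<B refl ▸ put free mid refl free<B refl ▸
     put m free refl m<B refl ▸ put cur k refl cur<B refl ▸ put k cur refl k<B refl ▸
     (moving ▸▸ (keeping ▸▸
       (con 1<W ▸ ari (suc free) refl free<W ▸ get cur p refl cur<B p≡ ▸ jmp ▸ done)))) ,
    +-monoʳ-≤ 6 (+-mono-≤ c≤ (+-monoˡ-≤ 4 c′≤))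
    where
    M′ : Mem
    M′ = hang M #1 #0 free cur mid m k

    move : ∀ m → ∃ λ c → Steps W B splitMacro c
             25 (regsU cur x₄ k m mid free) M′
             27 (regsU cur x₄ k (kept m 0 free) mid free) M′ × c ≤ 2
    move zero    = _ , (jeq-t refl ▸ done) , s≤s z≤n
    move (suc _) = _ , (jeq-f (λ ()) ▸ mov free refl ▸ done) , ≤-refl

    keep : ∀ {m} k other → M′ (cell #0 cur) ≡ other →
           ∃₂ λ x₄′ c → Steps W B splitMacro c
             27 (regsU cur x₄ k m mid free) M′
             32 (regsU cur x₄′ (kept k other cur) m mid free) M′ × c ≤ 5
    keep zero    zero    eq = _ , _ , (jeq-t refl ▸ get cur 0 refl cur<B eq ▸ jeq-t refl ▸ done) , m≤m+n 3 2
    keep zero    (suc o) eq =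
      _ , _ , (jeq-t refl ▸ get cur (suc o) refl cur<B eq ▸ jeq-f (λ ()) ▸ mov cur refl ▸ done) , m≤m+n 4 1
    keep (suc _) _       _  = _ , _ , (jeq-f (λ ()) ▸ jmp ▸ mov cur refl ▸ done) , m≤m+n 3 2

-- Correctness of Split

module _ {n : ℕ} (pos : Fin n → ℕ) (pos-injective : ∀ {x y} → pos x ≡ pos y → x ≡ y) where

  open Tries pos pos-injective

  ≢root : ∀ {d b k} (t : Trie d b) → k ≢ 0 → ¬ k ∈ᵢ t → k ≢ root t
  ≢root t k≢0 k∉t refl = k∉t (root-∈ᵢ t k≢0)

  -- A node without children would violate `Proper`. The case distinction is on the two roots, in
  -- the shape of `kept`, so that it mirrors the null tests of the code.
  pruneWith : ∀ {d b} → ℕ → ℕ → Trie d b → Trie d b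
  pruneWith zero    zero    t = nil
  pruneWith zero    (suc _) t = t
  pruneWith (suc _) _       t = t

  prune : ∀ {d b} → ℕ → Trie d b → Trie d (b + 2 ^ d) → Trie (suc d) b
  prune a l r = pruneWith (root l) (root r) (node a l r)

  data Pruned {d b} (a : ℕ) (l : Trie d b) (r : Trie d (b + 2 ^ d)) : Trie (suc d) b → Set where
    empty    : root l ≡ 0 → root r ≡ 0 → Pruned a l r nil
    nonempty : root l ≢ 0 ⊎ root r ≢ 0 → Pruned a l r (node a l r)

  pruned : ∀ {d b} a (l : Trie d b) r → Pruned a l r (prune a l r)
  pruned a l r with root l in eqˡ | root r in eqʳ
  ... | zero  | zero  = empty eqˡ eqʳ
  ... | zero  | suc _ = nonempty (inj₂ (λ eq → 1+n≢0 (trans (sym eqʳ) eq)))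
  ... | suc _ | _     = nonempty (inj₁ (λ eq → 1+n≢0 (trans (sym eqˡ) eq)))

  root-prune : ∀ {d b} a (l : Trie d b) r → root (prune a l r) ≡ kept (root l) (root r) (suc a)
  root-prune a l r with root l | root r
  ... | zero  | zero  = refl
  ... | zero  | suc _ = refl
  ... | suc _ | _     = refl

  module _ {d b a : ℕ} {l : Trie d b} {r : Trie d (b + 2 ^ d)} where

    ∈-prune⁺ : ∀ {x} → x ∈ₜ node a l r → x ∈ₜ prune a l r
    ∈-prune⁺ i with prune a l r | pruned a l r
    ∈-prune⁺ (left i)  | _ | empty l≡0 _ = contradiction l≡0 (∈⇒root≢0 i)
    ∈-prune⁺ (right i) | _ | empty _ r≡0 = contradiction r≡0 (∈⇒root≢0 i)
    ∈-prune⁺ i         | _ | nonempty _  = i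

    ∈-prune⁻ : ∀ {x} → x ∈ₜ prune a l r → x ∈ₜ node a l r
    ∈-prune⁻ i with prune a l r | pruned a l r
    ∈-prune⁻ i | _ | nonempty _ = i

    ∈ᵢ-prune⁻ : ∀ {k} → k ∈ᵢ prune a l r → k ∈ᵢ node a l r
    ∈ᵢ-prune⁻ i with prune a l r | pruned a l r
    ∈ᵢ-prune⁻ i | _ | nonempty _ = i

    size-prune : size (prune a l r) ≤ suc (size l + size r)
    size-prune with prune a l r | pruned a l r
    ... | _ | empty _ _  = z≤n
    ... | _ | nonempty _ = ≤-refl

    proper-prune : ¬ suc a ∈ᵢ l → ¬ suc a ∈ᵢ r → Disjoint l r → Proper l → Proper r → Proper (prune a l r)
    proper-prune a∉l a∉r l#r pl pr with prune a l r | pruned a l r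
    ... | _ | empty _ _   = nil
    ... | _ | nonempty ≢0 = node a∉l a∉r l#r ≢0 pl pr

    rep-prune : ∀ {M p} → M (cell #0 (suc a)) ≡ root l → M (cell #1 (suc a)) ≡ root r →
                M (cell #2 (suc a)) ≡ p → M (cell #3 (suc a)) ≡ b + 2 ^ d →
                Rep M (suc a) l → Rep M (suc a) r → Rep M p (prune a l r)
    rep-prune e₀ e₁ e₂ e₃ rl rr with prune a l r | pruned a l r
    ... | _ | empty _ _  = nil
    ... | _ | nonempty _ = node e₀ e₁ e₂ e₃ rl rr

  -- The contents of memory after `hang`, with `t` moved below the new node and `u` left below the
  -- current one. The two directions of the split path are the instances with `s` and `s̄`
  -- exchanged.
  module Hang (M : Mem) (s s̄ : Field) (new cur mid : ℕ)
              {d b d′ b′ : ℕ} (t : Trie d b) (u : Trie d′ b′)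
              (s≢s̄ : s ≢ s̄) (s≢3 : s ≢ #3) (s̄≢3 : s̄ ≢ #3)
              (new≢0 : new ≢ 0) (cur≢0 : cur ≢ 0) (new≢cur : new ≢ cur)
              (new∉t : ¬ new ∈ᵢ t) (new∉u : ¬ new ∈ᵢ u) (cur∉t : ¬ cur ∈ᵢ t) (cur∉u : ¬ cur ∈ᵢ u)
              (t#u : Disjoint t u) where

    M₁ M₂ M₃ M₄ M₅ M₆ : Mem
    M₁ = M  ⟨ cell s new ≔ root t ⟩
    M₂ = M₁ ⟨ cell s̄ new ≔ 0 ⟩
    M₃ = M₂ ⟨ cell #3 new ≔ mid ⟩
    M₄ = M₃ ⟨ cell #2 (root t) ≔ new ⟩
    M₅ = M₄ ⟨ cell s cur ≔ root u ⟩
    M₆ = M₅ ⟨ cell #2 (root u) ≔ cur ⟩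

    same₃ : ∀ {k} → k ≢ new → Same M M₃ k
    same₃ k≢new f = trans (other-node M₂ k≢new) (trans (other-node M₁ k≢new) (other-node M k≢new))

    hang-frame : ∀ {k} → k ≢ new → k ≢ cur → k ≢ root t → k ≢ root u → Same M M₆ k
    hang-frame k≢new k≢cur k≢t k≢u f =
      trans (other-node M₅ k≢u) (trans (other-node M₄ k≢cur) (trans (other-node M₃ k≢t) (same₃ k≢new f)))

    hang-new : ∀ f → M₆ (cell f new) ≡ M₃ (cell f new)
    hang-new f = trans (other-node M₅ (≢root u new≢0 new∉u)) (trans (other-node M₄ new≢cur)
                   (other-node M₃ (≢root t new≢0 new∉t)))

    hang-new-s : M₆ (cell s new) ≡ root t
    hang-new-s = trans (hang-new s) (trans (other-field M₂ s≢3) (trans (other-field M₁ s≢s̄) (≔-same M)))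

    hang-new-s̄ : M₆ (cell s̄ new) ≡ 0
    hang-new-s̄ = trans (hang-new s̄) (trans (other-field M₂ s̄≢3) (≔-same M₁))

    hang-new-mid : M₆ (cell #3 new) ≡ mid
    hang-new-mid = trans (hang-new #3) (≔-same M₂)

    hang-cur-s : M₆ (cell s cur) ≡ root u
    hang-cur-s = trans (other-node M₅ (≢root u cur≢0 cur∉u)) (≔-same M₄)

    hang-cur : ∀ f → f ≢ s → M₆ (cell f cur) ≡ M (cell f cur)
    hang-cur f f≢s = trans (other-node M₅ (≢root u cur≢0 cur∉u)) (trans (other-field M₄ f≢s)
                       (trans (other-node M₃ (≢root t cur≢0 cur∉t)) (same₃ (new≢cur ∘ sym) f)))

    ∈t⇒≢rootᵤ : ∀ {k} → k ∈ᵢ t → k ≢ root u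
    ∈t⇒≢rootᵤ i = ≢root u (∈ᵢ⇒≢0 i) (t#u i)

    hang-rep-t : ∀ {p} → Proper t → Rep M p t → Rep M₆ new t
    hang-rep-t proper rep =
      rep-frame (λ i f → trans (other-node M₅ (∈t⇒≢rootᵤ i)) (other-node M₄ (λ { refl → cur∉t i })))
        (rep-reparent proper (rep-frame (λ i → same₃ (λ { refl → new∉t i })) rep))

    hang-rep-u : ∀ {p} → Proper u → Rep M p u → Rep M₆ cur u
    hang-rep-u proper rep =
      rep-reparent proper
        (rep-frame (λ i f → trans (other-node M₄ (λ { refl → cur∉u i }))
                            (trans (other-node M₃ (≢root t (∈ᵢ⇒≢0 i) (λ j → t#u j i)))
                                   (same₃ (λ { refl → new∉u i }) f))) rep)

  -- The outcome of splitting t at K, with new nodes g + 1, …, g′.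
  record Parts {d b} (t : Trie d b) (M : Mem) (K g : ℕ) (M′ : Mem) (g′ : ℕ)
               (lower upper : Trie d b) : Set where
    field
      {p₁ p₂}     : ℕ
      rep₁        : Rep M′ p₁ lower
      rep₂        : Rep M′ p₂ upper
      proper₁     : Proper lower
      proper₂     : Proper upper
      disjoint    : Disjoint lower upper
      ids₁        : ∀ {k} → k ∈ᵢ lower → k ∈ᵢ t ⊎ (g < k × k ≤ g′)
      ids₂        : ∀ {k} → k ∈ᵢ upper → k ∈ᵢ t ⊎ (g < k × k ≤ g′)
      g≤g′        : g ≤ g′
      g′≤         : g′ ≤ g + d
      sound₁      : ∀ {x} → x ∈ₜ lower → x ∈ₜ t × pos x ≤ K
      sound₂      : ∀ {x} → x ∈ₜ upper → x ∈ₜ t × K < pos x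
      complete₁   : ∀ {x} → x ∈ₜ t → pos x ≤ K → x ∈ₜ lower
      complete₂   : ∀ {x} → x ∈ₜ t → K < pos x → x ∈ₜ upper
      frame       : ∀ {k} → k ≢ 0 → ¬ k ∈ᵢ t → k ≤ g → Same M M′ k
      size≤       : size lower + size upper ≤ size t + d

  -- c is the child of node a on the split path, e the other child.
  module Ascent {d d′ b b′ a K g g′ : ℕ} {M M′ : Mem} {lower upper : Trie d b} (c : Trie d b) (e : Trie d′ b′)
                (a≤g : suc a ≤ g) (c≤g : Below (suc g) c) (e≤g : Below (suc g) e)
                (a∉c : ¬ suc a ∈ᵢ c) (c#e : Disjoint c e) (P : Parts c M K g M′ g′ lower upper) where

    open Parts P

    Id : ℕ → Set
    Id k = k ∈ᵢ c ⊎ (g < k × k ≤ g′)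

    old∉ : ∀ {k} → ¬ k ∈ᵢ c → k ≤ g → ¬ Id k
    old∉ k∉c k≤g = [ k∉c , (λ (g<k , _) → <⇒≱ g<k k≤g) ]′

    new∉ : ¬ Id (suc g′)
    new∉ (inj₁ i)          = <⇒≱ (s≤s g≤g′) (s≤s⁻¹ (c≤g i))
    new∉ (inj₂ (_ , k≤g′)) = <⇒≱ ≤-refl k≤g′

    new∉e : ¬ suc g′ ∈ᵢ e
    new∉e i = <⇒≱ (s≤s g≤g′) (s≤s⁻¹ (e≤g i))

    new≢a : suc g′ ≢ suc a
    new≢a eq = <⇒≱ (s≤s g≤g′) (subst (_≤ g) (sym eq) a≤g)

    a∉ : ¬ Id (suc a)
    a∉ = old∉ a∉c a≤g

    e∉ : ∀ {k} → k ∈ᵢ e → ¬ Id k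
    e∉ i = old∉ (λ j → c#e j i) (s≤s⁻¹ (e≤g i))

    same-a : Same M M′ (suc a)
    same-a = frame (λ ()) a∉c a≤g

    same-e : ∀ {k} → k ∈ᵢ e → Same M M′ k
    same-e i = frame (∈ᵢ⇒≢0 i) (λ j → c#e j i) (s≤s⁻¹ (e≤g i))

    sizes : ∀ {d″ b″ d‴ b‴} (t : Trie d″ b″) (u : Trie d‴ b‴) → ∀ m n →
            size t ≤ suc m → size u ≤ suc n → m + n ≡ size lower + size upper + size e →
            size t + size u ≤ suc (size c + size e) + suc d
    sizes t u m n t≤ u≤ eq = begin
      size t + size u                               ≤⟨ +-mono-≤ t≤ u≤ ⟩
      suc m + suc n                                 ≡⟨ cong suc (+-suc m n) ⟩
      2 + (m + n)                                   ≡⟨ cong (2 +_) eq ⟩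
      2 + (size lower + size upper + size e)        ≤⟨ +-monoʳ-≤ 2 (+-monoˡ-≤ (size e) size≤) ⟩
      2 + (size c + d + size e)                     ≡⟨ shuffle (size c) (size e) d ⟩
      suc (size c + size e) + suc d                 ∎
      where
      open ≤-Reasoning
      shuffle : ∀ c e d → 2 + (c + d + e) ≡ suc (c + e) + suc d
      shuffle = solve-∀

  -- The key lies left of the middle, so `r` belongs to the upper part as a whole. The upper part
  -- therefore keeps node `a`, and only the lower part needs a new node.
  parts-left : ∀ {d b a M p K g M′ g′ lower upper} {l : Trie d b} {r : Trie d (b + 2 ^ d)} →
    Rep M p (node a l r) → Proper (node a l r) → Below (suc g) (node a l r) → K < b + 2 ^ d →
    Parts l M K g M′ g′ lower upper →
    let M″ = hang M′ #0 #1 (suc g′) (suc a) (b + 2 ^ d) (root lower) (root upper) in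
    Parts (node a l r) M K g M″ (suc g′) (prune g′ lower nil) (prune a upper r) ×
    M″ (cell #1 (suc a)) ≡ root r × M″ (cell #2 (suc a)) ≡ p
  parts-left {d} {b} {a} {M} {p} {K} {g} {M′} {g′} {lower} {upper} {l} {r}
    (node e₀ e₁ e₂ e₃ repL repR) (node a∉l a∉r l#r _ properL properR) t≤g K<mid P =
    (record
      -- The parent of the new node is written only at the next level or at the end of Split; until
      -- then `p₁` is whatever its cell contains, hence `refl`.
      { rep₁ = rep-prune hang-new-s hang-new-s̄ refl hang-new-mid (hang-rep-t proper₁ rep₁) nil
      ; rep₂ = rep-prune hang-cur-s other≡
                 parent≡
                 (trans (hang-cur #3 (λ ())) (trans (same-a #3) e₃))
                 (hang-rep-u proper₂ rep₂) (rep-frame (λ i f → trans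
                    (hang-frame (λ { refl → new∉e i }) (λ { refl → a∉r i })
                      (≢root lower (∈ᵢ⇒≢0 i) (e∉ i ∘ ids₁)) (≢root upper (∈ᵢ⇒≢0 i) (e∉ i ∘ ids₂)) f)
                    (same-e i f)) repR)
      ; proper₁ = proper-prune (new∉ ∘ ids₁) (λ ()) (λ _ ()) proper₁ nil
      ; proper₂ = proper-prune (a∉ ∘ ids₂) a∉r (λ i j → e∉ j (ids₂ i)) proper₂ properR
      ; disjoint = λ i j → apart (∈ᵢ-prune⁻ i) (∈ᵢ-prune⁻ j)
      ; ids₁ = λ i → ids-new (∈ᵢ-prune⁻ i)
      ; ids₂ = λ i → ids-cur (∈ᵢ-prune⁻ i)
      ; g≤g′ = m≤n⇒m≤1+n g≤g′
      ; g′≤ = ≤-trans (s≤s g′≤) (≤-reflexive (sym (+-suc g d)))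
      ; sound₁ = λ i → sound-new (∈-prune⁻ i)
      ; sound₂ = λ i → sound-cur (∈-prune⁻ i)
      ; complete₁ = λ { (left i) ≤K → ∈-prune⁺ (left (complete₁ i ≤K))
                      ; (right i) ≤K → contradiction ≤K (<⇒≱ (K<right i)) }
      ; complete₂ = λ { (left i) K< → ∈-prune⁺ (left (complete₂ i K<))
                      ; (right i) _ → ∈-prune⁺ (right i) }
      ; frame = λ {k} k≢0 k∉t k≤g f → trans
          (hang-frame (λ { refl → <⇒≱ (s≤s g≤g′) k≤g }) (λ { refl → k∉t here })
             (≢root lower k≢0 (old∉ (k∉t ∘ left) k≤g ∘ ids₁))
             (≢root upper k≢0 (old∉ (k∉t ∘ left) k≤g ∘ ids₂)) f)
          (frame k≢0 (k∉t ∘ left) k≤g f)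
      ; size≤ = sizes (prune g′ lower nil) (prune a upper r) (size lower + 0) (size upper + size r)
          (size-prune {a = g′} {lower} {nil}) (size-prune {a = a} {upper} {r})
          (shuffleˡ (size lower) (size upper) (size r))
      }) , other≡ , parent≡
    where
    open Parts P
    open Ascent l r (s≤s⁻¹ (t≤g here)) (t≤g ∘ left) (t≤g ∘ right) a∉l l#r P
    open Hang M′ #0 #1 (suc g′) (suc a) (b + 2 ^ d) lower upper (λ ()) (λ ()) (λ ()) (λ ()) (λ ())
              new≢a (new∉ ∘ ids₁) (new∉ ∘ ids₂) (a∉ ∘ ids₁) (a∉ ∘ ids₂) disjoint
    other≡ : M₆ (cell #1 (suc a)) ≡ root r
    other≡ = trans (hang-cur #1 (λ ())) (trans (same-a #1) e₁)
    parent≡ : M₆ (cell #2 (suc a)) ≡ p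
    parent≡ = trans (hang-cur #2 (λ ())) (trans (same-a #2) e₂)
    apart : Disjoint (node {d} {b} g′ lower nil) (node {d} {b} a upper r)
    apart here here = new≢a refl
    apart here (left j) = new∉ (ids₂ j)
    apart here (right j) = new∉e j
    apart (left i) here = a∉ (ids₁ i)
    apart (left i) (left j) = disjoint i j
    apart (left i) (right j) = e∉ j (ids₁ i)
    widen : ∀ {k} → Id k → k ∈ᵢ node a l r ⊎ (g < k × k ≤ suc g′)
    widen (inj₁ i)            = inj₁ (left i)
    widen (inj₂ (g<k , k≤g′)) = inj₂ (g<k , m≤n⇒m≤1+n k≤g′)
    ids-new : ∀ {k} → k ∈ᵢ node {d} {b} g′ lower nil → k ∈ᵢ node a l r ⊎ (g < k × k ≤ suc g′)
    ids-new here     = inj₂ (s≤s g≤g′ , ≤-refl)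
    ids-new (left i) = widen (ids₁ i)
    ids-cur : ∀ {k} → k ∈ᵢ node {d} {b} a upper r → k ∈ᵢ node a l r ⊎ (g < k × k ≤ suc g′)
    ids-cur here      = inj₁ here
    ids-cur (left i)  = widen (ids₂ i)
    ids-cur (right i) = inj₁ (right i)
    K<right : ∀ {x} → x ∈ₜ r → K < pos x
    K<right i = <-≤-trans K<mid (proj₁ (∈-range i))
    sound-new : ∀ {x} → x ∈ₜ node {d} {b} g′ lower nil → x ∈ₜ node a l r × pos x ≤ K
    sound-new (left i) = left (proj₁ (sound₁ i)) , proj₂ (sound₁ i)
    sound-cur : ∀ {x} → x ∈ₜ node {d} {b} a upper r → x ∈ₜ node a l r × K < pos x
    sound-cur (left i) = left (proj₁ (sound₂ i)) , proj₂ (sound₂ i)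
    sound-cur (right i) = right i , K<right i
    shuffleˡ : ∀ t u e → t + 0 + (u + e) ≡ t + u + e
    shuffleˡ = solve-∀

  parts-right : ∀ {d b a M p K g M′ g′ lower upper} {l : Trie d b} {r : Trie d (b + 2 ^ d)} →
    Rep M p (node a l r) → Proper (node a l r) → Below (suc g) (node a l r) → b + 2 ^ d ≤ K →
    Parts r M K g M′ g′ lower upper →
    let M″ = hang M′ #1 #0 (suc g′) (suc a) (b + 2 ^ d) (root upper) (root lower) in
    Parts (node a l r) M K g M″ (suc g′) (prune a l lower) (prune g′ nil upper) ×
    M″ (cell #0 (suc a)) ≡ root l × M″ (cell #2 (suc a)) ≡ p
  parts-right {d} {b} {a} {M} {p} {K} {g} {M′} {g′} {lower} {upper} {l} {r}
    (node e₀ e₁ e₂ e₃ repL repR) (node a∉l a∉r l#r _ properL properR) t≤g mid≤K P =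
    (record
      { rep₂ = rep-prune hang-new-s̄ hang-new-s refl hang-new-mid nil (hang-rep-t proper₂ rep₂)
      ; rep₁ = rep-prune other≡ hang-cur-s
                 parent≡
                 (trans (hang-cur #3 (λ ())) (trans (same-a #3) e₃))
                 (rep-frame (λ i f → trans
                    (hang-frame (λ { refl → new∉e i }) (λ { refl → a∉l i })
                      (≢root upper (∈ᵢ⇒≢0 i) (e∉ i ∘ ids₂)) (≢root lower (∈ᵢ⇒≢0 i) (e∉ i ∘ ids₁)) f)
                    (same-e i f)) repL) (hang-rep-u proper₁ rep₁)
      ; proper₂ = proper-prune (λ ()) (new∉ ∘ ids₂) (λ ()) nil proper₂
      ; proper₁ = proper-prune a∉l (a∉ ∘ ids₁) (λ i j → e∉ i (ids₁ j)) properL proper₁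
      ; disjoint = λ i j → apart (∈ᵢ-prune⁻ i) (∈ᵢ-prune⁻ j)
      ; ids₂ = λ i → ids-new (∈ᵢ-prune⁻ i)
      ; ids₁ = λ i → ids-cur (∈ᵢ-prune⁻ i)
      ; g≤g′ = m≤n⇒m≤1+n g≤g′
      ; g′≤ = ≤-trans (s≤s g′≤) (≤-reflexive (sym (+-suc g d)))
      ; sound₂ = λ i → sound-new (∈-prune⁻ i)
      ; sound₁ = λ i → sound-cur (∈-prune⁻ i)
      ; complete₁ = λ { (left i) _ → ∈-prune⁺ (left i)
                      ; (right i) ≤K → ∈-prune⁺ (right (complete₁ i ≤K)) }
      ; complete₂ = λ { (left i) K< → contradiction (left≤K i) (<⇒≱ K<)
                      ; (right i) K< → ∈-prune⁺ (right (complete₂ i K<)) }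
      ; frame = λ {k} k≢0 k∉t k≤g f → trans
          (hang-frame (λ { refl → <⇒≱ (s≤s g≤g′) k≤g }) (λ { refl → k∉t here })
             (≢root upper k≢0 (old∉ (k∉t ∘ right) k≤g ∘ ids₂))
             (≢root lower k≢0 (old∉ (k∉t ∘ right) k≤g ∘ ids₁)) f)
          (frame k≢0 (k∉t ∘ right) k≤g f)
      ; size≤ = ≤-trans
          (sizes (prune a l lower) (prune {b = b} g′ nil upper) (size l + size lower) (size upper)
            (size-prune {a = a} {l} {lower}) (size-prune {b = b} {a = g′} {nil} {upper})
            (shuffleʳ (size l) (size lower) (size upper)))
          (≤-reflexive (cong (λ m → suc m + suc d) (+-comm (size r) (size l))))
      }) , other≡ , parent≡
    where
    open Parts P
    open Ascent r l (s≤s⁻¹ (t≤g here)) (t≤g ∘ right) (t≤g ∘ left) a∉r (λ i j → l#r j i) P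
    open Hang M′ #1 #0 (suc g′) (suc a) (b + 2 ^ d) upper lower (λ ()) (λ ()) (λ ()) (λ ()) (λ ())
              new≢a (new∉ ∘ ids₂) (new∉ ∘ ids₁) (a∉ ∘ ids₂) (a∉ ∘ ids₁) (λ i j → disjoint j i)
    other≡ : M₆ (cell #0 (suc a)) ≡ root l
    other≡ = trans (hang-cur #0 (λ ())) (trans (same-a #0) e₀)
    parent≡ : M₆ (cell #2 (suc a)) ≡ p
    parent≡ = trans (hang-cur #2 (λ ())) (trans (same-a #2) e₂)
    apart : Disjoint (node {d} {b} a l lower) (node {d} {b} g′ nil upper)
    apart here here = new≢a refl
    apart (right j) here = new∉ (ids₁ j)
    apart (left j) here = new∉e j
    apart here (right i) = a∉ (ids₂ i)
    apart (right j) (right i) = disjoint j i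
    apart (left j) (right i) = e∉ j (ids₂ i)
    widen : ∀ {k} → Id k → k ∈ᵢ node a l r ⊎ (g < k × k ≤ suc g′)
    widen (inj₁ i)            = inj₁ (right i)
    widen (inj₂ (g<k , k≤g′)) = inj₂ (g<k , m≤n⇒m≤1+n k≤g′)
    ids-new : ∀ {k} → k ∈ᵢ node {d} {b} g′ nil upper → k ∈ᵢ node a l r ⊎ (g < k × k ≤ suc g′)
    ids-new here     = inj₂ (s≤s g≤g′ , ≤-refl)
    ids-new (right i) = widen (ids₂ i)
    ids-cur : ∀ {k} → k ∈ᵢ node {d} {b} a l lower → k ∈ᵢ node a l r ⊎ (g < k × k ≤ suc g′)
    ids-cur here      = inj₁ here
    ids-cur (right i)  = widen (ids₁ i)
    ids-cur (left i) = inj₁ (left i)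
    left≤K : ∀ {x} → x ∈ₜ l → pos x ≤ K
    left≤K i = ≤-trans (<⇒≤ (proj₂ (∈-range i))) mid≤K
    sound-new : ∀ {x} → x ∈ₜ node {d} {b} g′ nil upper → x ∈ₜ node a l r × K < pos x
    sound-new (right i) = right (proj₁ (sound₂ i)) , proj₂ (sound₂ i)
    sound-cur : ∀ {x} → x ∈ₜ node {d} {b} a l lower → x ∈ₜ node a l r × pos x ≤ K
    sound-cur (right i) = right (proj₁ (sound₁ i)) , proj₂ (sound₁ i)
    sound-cur (left i) = left i , left≤K i
    shuffleʳ : ∀ e t u → e + t + u ≡ t + u + e
    shuffleʳ = solve-∀

  nil-parts : ∀ {d b M K g} → Parts (nil {d} {b}) M K g M g nil nil
  nil-parts {d} {g = g} = record
    { p₁ = 0 ; p₂ = 0 ; rep₁ = nil ; rep₂ = nil ; proper₁ = nil ; proper₂ = nil ; disjoint = λ ()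
    ; ids₁ = λ () ; ids₂ = λ () ; g≤g′ = ≤-refl ; g′≤ = m≤m+n g d
    ; sound₁ = λ () ; sound₂ = λ () ; complete₁ = λ () ; complete₂ = λ ()
    ; frame = λ _ _ _ _ → refl ; size≤ = z≤n }

  leaf-parts : ∀ {b x M p K g} {e : pos x ≡ b} → b ≤ K → Rep M p (leaf x e) →
               Parts (leaf x e) M K g M g (leaf x e) nil
  leaf-parts {p = p} {g = g} {e = e} b≤K rep = record
    { p₁ = p ; p₂ = 0 ; rep₁ = rep ; rep₂ = nil ; proper₁ = leaf ; proper₂ = nil ; disjoint = λ _ ()
    ; ids₁ = inj₁ ; ids₂ = λ () ; g≤g′ = ≤-refl ; g′≤ = m≤m+n g 0
    ; sound₁ = λ { leaf → leaf , ≤-trans (≤-reflexive e) b≤K } ; sound₂ = λ ()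
    ; complete₁ = λ i _ → i
    ; complete₂ = λ { leaf K< → contradiction (≤-trans (≤-reflexive e) b≤K) (<⇒≱ K<) }
    ; frame = λ _ _ _ _ → refl ; size≤ = ≤-refl }

  module _ (W B : ℕ) (0<B : 0 < B) (1<W : 1 < W) (B<W : B < W) where

    root-part<B : ∀ {d b d′ b′ g g′ D} (t : Trie d b) (u : Trie d′ b′) → Below (suc g) t →
                  g′ ≤ g + D → g + D < B → (∀ {k} → k ∈ᵢ u → k ∈ᵢ t ⊎ (g < k × k ≤ g′)) → root u < B
    root-part<B {g = g} {D = D} t u t≤g g′≤ <B ids with root u ≟ 0
    ... | yes ≡0 = subst (_< B) (sym ≡0) 0<B
    ... | no ≢0 with ids (root-∈ᵢ u ≢0)
    ...   | inj₁ i          = ≤-<-trans (≤-trans (s≤s⁻¹ (t≤g i)) (m≤m+n g D)) <B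
    ...   | inj₂ (_ , k≤g′) = ≤-<-trans (≤-trans k≤g′ g′≤) <B

    -- The origin of 27: a level costs 7 instructions on the way down, 3 before the branch on the
    -- way up, and at most 17 in `ascendMacro`.
    time-bound : ∀ c d {c′} → c ≤ 6 + 27 * d → c′ ≤ 17 → 7 + (c + (3 + c′)) ≤ 6 + 27 * suc d
    time-bound c d c≤ c′≤ =
      ≤-trans (+-monoʳ-≤ 7 (+-mono-≤ c≤ (+-monoʳ-≤ 3 c′≤))) (≤-reflexive (total d))
      where
      total : ∀ d → 7 + ((6 + 27 * d) + (3 + 17)) ≡ 6 + 27 * suc d
      total = solve-∀

    -- Register 3 contains the parent `p` on entry and again on exit, which is what allows the
    -- ascent to proceed without a stack.
    divide : ∀ {d b p M K g x₁ x₄ x₅ x₆ x₇ x₈ x₁₀} (t : Trie d b) →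
             b ≤ K → K < b + 2 ^ d → Rep M p t → Proper t → Below (suc g) t → g + d < B →
             ∃₂ λ M′ g′ → ∃₂ λ lower upper → Parts t M K g M′ g′ lower upper × ∃₂ λ c x₀ → ∃₂ λ x₄′ x₇′ →
               Steps W B splitMacro c
                 3 (root t ∷ x₁ ∷ K ∷ p ∷ x₄ ∷ x₅ ∷ x₆ ∷ x₇ ∷ x₈ ∷ 0 ∷ x₁₀ ∷ suc g ∷ []) M
                 16 (x₀ ∷ x₁ ∷ K ∷ p ∷ x₄′ ∷ root lower ∷ root upper ∷ x₇′ ∷ x₈ ∷ 0 ∷ x₁₀ ∷ suc g′ ∷ []) M′ ×
               c ≤ 6 + 27 * d
    divide nil _ _ _ _ _ _ =
      _ , _ , nil , nil , nil-parts , _ , _ , _ , _ ,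
      (jeq-t refl ▸ con (<-trans z<s 1<W) ▸ con (<-trans z<s 1<W) ▸ done) , m≤m+n 3 _
    -- The range of a leaf is a single position, so a leaf on the split path lies at `K` itself and
    -- goes to the lower part.
    divide {g = g} (leaf x e) b≤K _ rep@(leaf _ _ e₃) _ t≤g <B =
      _ , _ , leaf x e , nil , leaf-parts b≤K rep , _ , _ , _ , _ ,
      (jeq-f (λ ()) ▸ get (pointer x) 0 refl x<B e₃ ▸ jeq-t refl ▸
       mov (pointer x) refl ▸ jmp ▸ con (<-trans z<s 1<W) ▸ done) , ≤-refl
      where
      x<B : pointer x < B
      x<B = ≤-<-trans (≤-trans (s≤s⁻¹ (t≤g leaf)) (m≤m+n g 0)) <B
    divide {suc d} {b} {p} {K = K} {g} (node a l r) b≤K K<c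
      rep@(node e₀ e₁ e₂ e₃ repL repR) proper@(node a∉l a∉r l#r _ properL properR) t≤g <B
      with a<B ← ≤-<-trans (≤-trans (s≤s⁻¹ (t≤g here)) (m≤m+n g (suc d))) <B
         | <B′ ← ≤-<-trans (+-monoʳ-≤ g (n≤1+n d)) <B
         | K <? b + 2 ^ d
    ... | yes K<mid
      with M′ , g′ , lower , upper , P , c , _ , _ , _ , steps , time ←
             divide l b≤K K<mid repL properL (t≤g ∘ left) <B′
      with P′ , other≡ , parent≡ ← parts-left rep proper t≤g K<mid P
      with g′<B ← ≤-<-trans (≤-trans (s≤s (Parts.g′≤ P)) (≤-reflexive (sym (+-suc g d)))) <B
      with c′ , ascending , time′ ← ascend-left 0<B 1<W (root lower) (root upper) a<B
             (root-part<B l lower (t≤g ∘ left) (Parts.g′≤ P) <B′ (Parts.ids₁ P))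
             (root-part<B l upper (t≤g ∘ left) (Parts.g′≤ P) <B′ (Parts.ids₂ P))
             g′<B (≤-<-trans g′<B B<W) other≡ parent≡
      rewrite sym (root-prune g′ lower nil) | sym (root-prune a upper r) =
      _ , _ , _ , _ , P′ , _ , _ , _ , _ ,
      (jeq-f (λ ()) ▸ get (suc a) (b + 2 ^ d) refl a<B e₃ ▸ jeq-f (mid≢0 b d) ▸ mov (suc a) refl ▸
       jlt-t K<mid ▸ get (suc a) (root l) refl a<B e₀ ▸ jmp ▸
       (steps ▸▸ (jeq-f (λ ()) ▸
        get (suc a) (b + 2 ^ d) refl a<B (trans (Parts.frame P (λ ()) a∉l (s≤s⁻¹ (t≤g here)) #3) e₃) ▸
        jlt-t K<mid ▸ ascending))) ,
      time-bound c d time time′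
    ... | no K≮mid
      with mid≤K ← ≮⇒≥ K≮mid
      with M′ , g′ , lower , upper , P , c , _ , _ , _ , steps , time ←
             divide r mid≤K (<-≤-trans K<c (≤-reflexive (sym (double-2^ b d)))) repR properR (t≤g ∘ right) <B′
      with P′ , other≡ , parent≡ ← parts-right rep proper t≤g mid≤K P
      with g′<B ← ≤-<-trans (≤-trans (s≤s (Parts.g′≤ P)) (≤-reflexive (sym (+-suc g d)))) <B
      with c′ , ascending , time′ ← ascend-right 0<B 1<W (root upper) (root lower) a<B
             (root-part<B r upper (t≤g ∘ right) (Parts.g′≤ P) <B′ (Parts.ids₂ P))
             (root-part<B r lower (t≤g ∘ right) (Parts.g′≤ P) <B′ (Parts.ids₁ P))
             g′<B (≤-<-trans g′<B B<W) other≡ parent≡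
      -- The code first tests the part that it has just attached, here the right child, whereas
      -- `prune` first tests the left child.
      rewrite kept-comm (root lower) (root l) (suc a) | kept-comm (root upper) 0 (suc g′)
            | sym (root-prune a l lower) | sym (root-prune {b = b} g′ nil upper) =
      _ , _ , _ , _ , P′ , _ , _ , _ , _ ,
      (jeq-f (λ ()) ▸ get (suc a) (b + 2 ^ d) refl a<B e₃ ▸ jeq-f (mid≢0 b d) ▸ mov (suc a) refl ▸
       jlt-f K≮mid ▸ get (suc a) (root r) refl a<B e₁ ▸ jmp ▸
       (steps ▸▸ (jeq-f (λ ()) ▸
        get (suc a) (b + 2 ^ d) refl a<B (trans (Parts.frame P (λ ()) a∉r (s≤s⁻¹ (t≤g here)) #3) e₃) ▸
        jlt-f K≮mid ▸ ascending))) ,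
      time-bound c d time time′

    split-run : ∀ {d x M g x₂ x₃ x₄ x₅ x₆ x₇ x₈ x₉ x₁₀} (t : Trie d 0) →
                pointer x < B → M (cell #0 (pointer x)) ≡ pos x → pos x < 2 ^ d →
                Rep M 0 t → Proper t → Below (suc g) t → g + d < B →
                ∃₂ λ M′ g′ → ∃₂ λ lower upper → Parts t M (pos x) g M′ g′ lower upper ×
                  ∃₂ λ k (y : Vec ℕ 9) →
                  Steps W B splitMacro k
                    0 (root t ∷ pointer x ∷ x₂ ∷ x₃ ∷ x₄ ∷ x₅ ∷ x₆ ∷ x₇ ∷ x₈ ∷ x₉ ∷ x₁₀ ∷ suc g ∷ []) M
                    57 (root lower ∷ root upper ∷ (y ∷ʳ suc g′))
                       (M′ ⟨ cell #2 (root lower) ≔ 0 ⟩ ⟨ cell #2 (root upper) ≔ 0 ⟩) ×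
                  k ≤ 14 + 27 * d
    split-run {d} {x} t x<B key x<2^d rep proper t≤g <B
      with M′ , g′ , lower , upper , P , c , _ , _ , _ , steps , time ←
             divide t z≤n x<2^d rep proper t≤g <B =
      M′ , g′ , lower , upper , P , _ , _ ∷ _ ∷ _ ∷ _ ∷ _ ∷ _ ∷ _ ∷ _ ∷ _ ∷ [] ,
      (con (<-trans z<s 1<W) ▸ get (pointer x) (pos x) refl x<B key ▸ con (<-trans z<s 1<W) ▸
       (steps ▸▸ (jeq-t refl ▸
        put (root lower) 0 refl (root-part<B t lower t≤g (Parts.g′≤ P) <B (Parts.ids₁ P)) refl ▸
        put (root upper) 0 refl (root-part<B t upper t≤g (Parts.g′≤ P) <B (Parts.ids₂ P)) refl ▸
        mov (root lower) refl ▸ mov (root upper) refl ▸ done))) ,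
      ≤-trans (+-monoʳ-≤ 3 (+-monoˡ-≤ 5 time)) (≤-reflexive (total d))
      where
      total : ∀ d → 3 + ((6 + 27 * d) + 5) ≡ 14 + 27 * d
      total = solve-∀

-- Initialization

-- Register 5 holds the address at which the identifier of the next node on the
-- path of element p has to be stored, initially the entry of p in the table.
initMacro : MacroProgram
initMacro =
  con #9 0 ∷
  ld #0 #9 ∷
  con #8 1 ∷
  con #1 1 ∷
  -- 4: least power of two above n
  jlt #0 #1 7 ∷
  ari add #1 #1 #1 ∷
  jmp 4 ∷
  ari add #11 #0 #0 ∷
  ari add #11 #8 #11 ∷
  ari add #11 #8 #11 ∷
  adr #3 #3 #0 ∷
  mov #2 #0 ∷
  -- 12: for p = n, …, 1
  jeq #2 #9 41 ∷
  ld #4 #2 ∷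
  ari add #5 #3 #2 ∷
  con #6 0 ∷
  mov #7 #1 ∷
  con #10 0 ∷
  -- 18: build the path
  jeq #7 #8 35 ∷
  st #5 #11 ∷
  con #0 2 ∷
  ari quo #7 #7 #0 ∷
  ari add #0 #6 #7 ∷
  put #3 #11 #0 ∷
  put #2 #11 #10 ∷
  put #0 #11 #9 ∷
  put #1 #11 #9 ∷
  mov #10 #11 ∷
  jlt #4 #0 32 ∷
  mov #6 #0 ∷
  adr #1 #5 #11 ∷
  jmp 33 ∷
  adr #0 #5 #11 ∷
  ari add #11 #8 #11 ∷
  jmp 18 ∷
  st #5 #2 ∷
  put #0 #2 #4 ∷
  put #2 #2 #10 ∷
  put #3 #2 #9 ∷
  ari sub #2 #2 #8 ∷
  jmp 12 ∷
  ari add #0 #8 #3 ∷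
  hlt ∷ []

-- Correctness of the initialization

module Building {n : ℕ} (pos : Fin n → ℕ) (pos-injective : ∀ {x y} → pos x ≡ pos y → x ≡ y)
                (W B : ℕ) (B<W : B < W) (2<W : 2 < W) where

  open Tries pos pos-injective

  PathId : Fin n → ℕ → ℕ → ℕ → Set
  PathId x g e k = k ≡ pointer x ⊎ (g < k × k ≤ e)

  -- The address `q` is the cell that receives the root of the path: the table entry for the whole
  -- path, a child field of the parent for each of its tails. One record thus serves both, and `o`
  -- is the parent.
  record Path {d b} (x : Fin n) (M : Mem) (q o g e : ℕ) (M′ : Mem) (t : Trie d b) : Set where
    field
      element  : x ∈ₜ t
      single   : ∀ {y} → y ∈ₜ t → y ≡ x
      ids      : ∀ {k} → k ∈ᵢ t → PathId x g e k
      proper   : Proper t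
      size≡    : size t ≡ suc d
      rep      : Rep M′ o t
      stored   : M′ q ≡ root t
      frame    : ∀ {c} → c ≢ q → (∀ f {k} → PathId x g e k → c ≢ cell f k) → M′ c ≡ M c

  leaf-path : ∀ {b x M q o g e} (x≡b : pos x ≡ b) → (∀ f {k} → PathId x g e k → q ≢ cell f k) →
              Path x M q o g e
                (M ⟨ q ≔ pointer x ⟩ ⟨ cell #0 (pointer x) ≔ pos x ⟩
                   ⟨ cell #2 (pointer x) ≔ o ⟩ ⟨ cell #3 (pointer x) ≔ 0 ⟩) (leaf x x≡b)
  leaf-path {x = x} {M} {q} {o} x≡b q∉ = record
    { element = leaf
    ; single = λ { leaf → refl }
    ; ids = λ { leaf → inj₁ refl }
    ; proper = leaf
    ; size≡ = refl
    ; rep = leaf (trans (other-field M₃ (λ ())) (trans (other-field M₂ (λ ())) (trans (≔-same M₁) x≡b)))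
                 (trans (other-field M₃ (λ ())) (≔-same M₂)) (≔-same M₃)
    ; stored = trans (outside (λ f → q∉ f (inj₁ refl))) (≔-same M)
    ; frame = λ c≢q c∉ → trans (outside (λ f → c∉ f (inj₁ refl))) (≔-other M c≢q)
    }
    where
    M₁ M₂ M₃ : Mem
    M₁ = M ⟨ q ≔ pointer x ⟩
    M₂ = M₁ ⟨ cell #0 (pointer x) ≔ pos x ⟩
    M₃ = M₂ ⟨ cell #2 (pointer x) ≔ o ⟩
    outside : ∀ {c} → (∀ f → c ≢ cell f (pointer x)) → (M₃ ⟨ cell #3 (pointer x) ≔ 0 ⟩) c ≡ M₁ c
    outside c∉ = trans (≔-other M₃ (c∉ #3)) (trans (≔-other M₂ (c∉ #2)) (≔-other M₁ (c∉ #0)))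

  module Node {d b : ℕ} (x : Fin n) (M : Mem) (q o g e : ℕ) (x≤g : pointer x ≤ g) (g<e : g < e)
              (q∉ : ∀ f {k} → PathId x g e k → q ≢ cell f k) where

    mid : ℕ
    mid = b + 2 ^ d

    M₁ M₂ M₃ M₄ M₅ : Mem
    M₁ = M ⟨ q ≔ suc g ⟩
    M₂ = M₁ ⟨ cell #3 (suc g) ≔ mid ⟩
    M₃ = M₂ ⟨ cell #2 (suc g) ≔ o ⟩
    M₄ = M₃ ⟨ cell #0 (suc g) ≔ 0 ⟩
    M₅ = M₄ ⟨ cell #1 (suc g) ≔ 0 ⟩

    outside : ∀ {c} → (∀ f → c ≢ cell f (suc g)) → M₅ c ≡ M₁ c
    outside c∉ = trans (≔-other M₄ (c∉ #1)) (trans (≔-other M₃ (c∉ #0))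
                   (trans (≔-other M₂ (c∉ #2)) (≔-other M₁ (c∉ #3))))

    new-id : PathId x g e (suc g)
    new-id = inj₂ (≤-refl , g<e)

    widen : ∀ {k} → PathId x (suc g) e k → PathId x g e k
    widen (inj₁ eq)        = inj₁ eq
    widen (inj₂ (g<k , k≤)) = inj₂ (<-trans ≤-refl g<k , k≤)

    new∉ : ∀ {k} → PathId x (suc g) e k → suc g ≢ k
    new∉ (inj₁ refl)      refl = <⇒≱ ≤-refl x≤g
    new∉ (inj₂ (g<k , _)) refl = <⇒≱ g<k ≤-refl

    slot∉ : ∀ (s f : Field) {k} → PathId x (suc g) e k → cell s (suc g) ≢ cell f k
    slot∉ s f i eq = new∉ i (proj₂ (cell-injective eq))

    module _ (s : Field) {b′ : ℕ} {u : Trie d b′} {M′ : Mem} (P : Path x M₅ (cell s (suc g)) (suc g) (suc g) e M′ u) where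

      open Path P

      at-new : ∀ f → f ≢ s → M′ (cell f (suc g)) ≡ M₅ (cell f (suc g))
      at-new f f≢s = frame (f≢s ∘ proj₁ ∘ cell-injective) (λ h i eq → new∉ i (proj₂ (cell-injective eq)))

      rest : ∀ {c} → (∀ f {k} → PathId x g e k → c ≢ cell f k) → M′ c ≡ M₁ c
      rest c∉ = trans (frame (c∉ s new-id) (λ f i → c∉ f (widen i))) (outside (λ f → c∉ f new-id))

      new∉u : ¬ suc g ∈ᵢ u
      new∉u i = new∉ (ids i) refl

    left-path : ∀ {M′} {u : Trie d b} → Path x M₅ (cell #0 (suc g)) (suc g) (suc g) e M′ u →
                Path x M q o g e M′ (node g u nil)
    left-path {M′} {u} P = record
      { element = left element
      ; single = λ { (left i) → single i }
      ; ids = λ { here → new-id ; (left i) → widen (ids i) }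
      ; proper = node (new∉u #0 P) (λ ()) (λ _ ()) (inj₁ (∈⇒root≢0 element)) proper nil
      ; size≡ = cong suc (trans (+-identityʳ _) size≡)
      ; rep = node stored (trans (at-new #0 P #1 (λ ())) (≔-same M₄))
                (trans (at-new #0 P #2 (λ ())) (trans (other-field M₄ (λ ()))
                  (trans (other-field M₃ (λ ())) (≔-same M₂))))
                (trans (at-new #0 P #3 (λ ())) (trans (other-field M₄ (λ ()))
                  (trans (other-field M₃ (λ ())) (trans (other-field M₂ (λ ())) (≔-same M₁)))))
                rep nil
      ; stored = trans (rest #0 P q∉) (≔-same M)
      ; frame = λ c≢q c∉ → trans (rest #0 P c∉) (≔-other M c≢q)
      }
      where open Path P

    right-path : ∀ {M′} {u : Trie d mid} → Path x M₅ (cell #1 (suc g)) (suc g) (suc g) e M′ u →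
                 Path x M q o g e M′ (node {d} {b} g nil u)
    right-path {M′} {u} P = record
      { element = right element
      ; single = λ { (right i) → single i }
      ; ids = λ { here → new-id ; (right i) → widen (ids i) }
      ; proper = node (λ ()) (new∉u #1 P) (λ ()) (inj₂ (∈⇒root≢0 element)) nil proper
      ; size≡ = cong suc size≡
      ; rep = node (trans (at-new #1 P #0 (λ ())) (trans (other-field M₄ (λ ())) (≔-same M₃))) stored
                (trans (at-new #1 P #2 (λ ())) (trans (other-field M₄ (λ ()))
                  (trans (other-field M₃ (λ ())) (≔-same M₂))))
                (trans (at-new #1 P #3 (λ ())) (trans (other-field M₄ (λ ()))
                  (trans (other-field M₃ (λ ())) (trans (other-field M₂ (λ ())) (≔-same M₁)))))
                nil rep
      ; stored = trans (rest #1 P q∉) (≔-same M)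
      ; frame = λ c≢q c∉ → trans (rest #1 P c∉) (≔-other M c≢q)
      }
      where open Path P

  module _ {h T : ℕ} where

    mid≤ : ∀ b d → b + 2 ^ d ≤ b + 2 ^ suc d
    mid≤ b d = +-monoʳ-≤ b (m≤m+n (2 ^ d) _)

    2^≢1 : ∀ d → 2 ^ suc d ≢ 1
    2^≢1 d eq = <⇒≢ (*-monoʳ-≤ 2 (m^n>0 2 d)) (sym eq)

    half : ∀ d → 2 ^ suc d / 2 ≡ 2 ^ d
    half d = trans (cong (_/ 2) (*-comm 2 (2 ^ d))) (m*n/n≡m (2 ^ d) 2)

    -- Each node is first written with two null children; then `q` becomes the child field in which
    -- the path continues, and the recursive call fills it.
    build : ∀ {d b M q o g e y} (x : Fin n) → e ≡ g + d → b ≤ pos x → pos x < b + 2 ^ d → pointer x ≤ g →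
            (∀ f {k} → PathId x g e k → q ≢ cell f k) → e < B → b + 2 ^ d < W →
            ∃₂ λ M′ (t : Trie d b) → Path x M q o g e M′ t × ∃ λ c → ∃₂ λ y′ q′ → ∃₂ λ b′ s′ → ∃ λ o′ →
              Steps W B initMacro c
                18 (y ∷ h ∷ pointer x ∷ T ∷ pos x ∷ q ∷ b ∷ 2 ^ d ∷ 1 ∷ 0 ∷ o ∷ suc g ∷ []) M
                12 (y′ ∷ h ∷ toℕ x ∷ T ∷ pos x ∷ q′ ∷ b′ ∷ s′ ∷ 1 ∷ 0 ∷ o′ ∷ suc e ∷ []) M′
    build {zero} {b} {M} {q} {o} {g} {e} x e≡ b≤ <b+1 x≤g q∉ <B _ with refl ← trans e≡ (+-identityʳ g) =
      _ , leaf x x≡b , leaf-path x≡b q∉ , _ , _ , _ , _ , _ , _ ,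
      (jeq-t refl ▸ st q (pointer x) refl refl ▸ put (pointer x) (pos x) refl x<B refl ▸
       put (pointer x) o refl x<B refl ▸ put (pointer x) 0 refl x<B refl ▸
       ari (toℕ x) refl (<-trans (<-trans ≤-refl x<B) B<W) ▸ jmp ▸ done)
      where
      x≡b : pos x ≡ b
      x≡b = ≤-antisym (s≤s⁻¹ (≤-trans <b+1 (≤-reflexive (+-comm b 1)))) b≤
      x<B : pointer x < B
      x<B = ≤-<-trans x≤g <B
    build {suc d} {b} {M} {q} {o} {g} {e} x e≡ b≤ <c x≤g q∉ <B <W
      with pos x <? b + 2 ^ d
    ... | yes <mid =
      let M′ , t , P , _ , _ , _ , _ , _ , _ , steps =
            build x (trans e≡ (+-suc g d)) b≤ <mid (m≤n⇒m≤1+n x≤g) (slot∉ #0) <B mid<W in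
      M′ , _ , left-path P , _ , _ , _ , _ , _ , _ ,
      (jeq-f (2^≢1 d) ▸ st q (suc g) refl refl ▸ con 2<W ▸ ari (2 ^ d) (half d) 2^<W ▸
       ari (b + 2 ^ d) refl mid<W ▸
       put (suc g) (b + 2 ^ d) refl g<B refl ▸ put (suc g) o refl g<B refl ▸
       put (suc g) 0 refl g<B refl ▸ put (suc g) 0 refl g<B refl ▸ mov (suc g) refl ▸
       jlt-t <mid ▸ adr (suc g) refl g<B ▸ ari (suc (suc g)) refl (≤-<-trans g<B B<W) ▸ jmp ▸ steps)
      where
      mid<W : b + 2 ^ d < W
      mid<W = ≤-<-trans (mid≤ b d) <W
      2^<W : 2 ^ d < W
      2^<W = ≤-<-trans (m≤n+m (2 ^ d) b) mid<W
      g<e : g < e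
      g<e = ≤-trans (≤-trans (s≤s (m≤m+n g d)) (≤-reflexive (sym (+-suc g d)))) (≤-reflexive (sym e≡))
      g<B : suc g < B
      g<B = ≤-<-trans g<e <B
      open Node {d} {b} x M q o g e x≤g g<e q∉
    ... | no ≮mid =
      let M′ , t , P , _ , _ , _ , _ , _ , _ , steps =
            build x (trans e≡ (+-suc g d)) (≮⇒≥ ≮mid) (<-≤-trans <c (≤-reflexive (sym (double-2^ b d))))
              (m≤n⇒m≤1+n x≤g) (slot∉ #1) <B (≤-<-trans (≤-reflexive (double-2^ b d)) <W) in
      M′ , _ , right-path P , _ , _ , _ , _ , _ , _ ,
      (jeq-f (2^≢1 d) ▸ st q (suc g) refl refl ▸ con 2<W ▸ ari (2 ^ d) (half d) 2^<W ▸
       ari (b + 2 ^ d) refl mid<W ▸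
       put (suc g) (b + 2 ^ d) refl g<B refl ▸ put (suc g) o refl g<B refl ▸
       put (suc g) 0 refl g<B refl ▸ put (suc g) 0 refl g<B refl ▸ mov (suc g) refl ▸
       jlt-f ≮mid ▸ mov (b + 2 ^ d) refl ▸ adr (suc g) refl g<B ▸ jmp ▸
       ari (suc (suc g)) refl (≤-<-trans g<B B<W) ▸ jmp ▸ steps)
      where
      mid<W : b + 2 ^ d < W
      mid<W = ≤-<-trans (mid≤ b d) <W
      2^<W : 2 ^ d < W
      2^<W = ≤-<-trans (m≤n+m (2 ^ d) b) mid<W
      g<e : g < e
      g<e = ≤-trans (≤-trans (s≤s (m≤m+n g d)) (≤-reflexive (sym (+-suc g d)))) (≤-reflexive (sym e≡))
      g<B : suc g < B
      g<B = ≤-<-trans g<e <B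
      open Node {d} {b} x M q o g e x≤g g<e q∉

levels : ∀ n → ∃ λ L → n < 2 ^ L × (∀ {e} → e < L → 2 ^ e ≤ n)
levels zero = 0 , ≤-refl , λ ()
levels (suc n) with L , n<2^L , minimal ← levels n | suc n <? 2 ^ L
... | yes 1+n<2^L = L , 1+n<2^L , λ e<L → m≤n⇒m≤1+n (minimal e<L)
... | no  1+n≮2^L =
  suc L , ≤-<-trans n<2^L (m<m+n (2 ^ L) (≤-trans (m^n>0 2 L) (m≤m+n _ 0))) ,
  λ e<1+L → ≤-trans (^-monoʳ-≤ 2 (s≤s⁻¹ e<1+L)) (≮⇒≥ 1+n≮2^L)

-- Halving the least power above n gives at most n. This bounds the powers of two that the code
-- computes, and through them L itself.
least-power : ∀ L {n} → (∀ {e} → e < L → 2 ^ e ≤ n) → 2 ^ L ≤ suc (n + n)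
least-power zero    _       = s≤s z≤n
least-power (suc e) minimal =
  m≤n⇒m≤1+n (+-mono-≤ (minimal ≤-refl) (≤-trans (≤-reflexive (+-identityʳ _)) (minimal ≤-refl)))

module Initializing {n : ℕ} (pos : Fin n → ℕ) (pos-injective : ∀ {x y} → pos x ≡ pos y → x ≡ y)
                    (pos≤n : ∀ x → pos x ≤ n) (W B L : ℕ) (n<2^L : n < 2 ^ L)
                    (minimal : ∀ {e} → e < L → 2 ^ e ≤ n)
                    (4B≤W : 4 * B ≤ W) (capacity : suc (n + n) + n * L < B) where

  open Tries pos pos-injective

  -- The layout of memory: leaves have identifiers 1 to n and cells up to address 4 n + 3, the table
  -- entries follow at 4 n + 4 to 5 n + 3, and inner nodes start with identifier 2 n + 2, that is,
  -- at address 8 n + 8.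
  base : ℕ
  base = suc (n + n)

  base<B : base < B
  base<B = ≤-<-trans (m≤m+n base (n * L)) capacity

  8n+8≤W : 8 * n + 8 ≤ W
  8n+8≤W = ≤-trans (≤-reflexive (identity n)) (≤-trans (*-monoʳ-≤ 4 base<B) 4B≤W)
    where
    identity : ∀ n → 8 * n + 8 ≡ 4 * suc (suc (n + n))
    identity = solve-∀

  B<W : B < W
  B<W = <-≤-trans (m<m+n B (≤-trans (≤-<-trans z≤n base<B) (m≤m+n B _))) 4B≤W

  7<W : 7 < W
  7<W = ≤-trans (m≤n+m 8 (8 * n)) 8n+8≤W

  2^L≤base : 2 ^ L ≤ base
  2^L≤base = least-power L minimal

  2^L<W : 2 ^ L < W
  2^L<W = ≤-<-trans 2^L≤base (<-trans base<B B<W)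

  open Building pos pos-injective W B B<W (<-trans (m≤m+n 3 4) 7<W)

  table : ℕ
  table = cell #3 n

  ≤cell : ∀ f k → k ≤ cell f k
  ≤cell f k = ≤-trans (≤-trans (m≤m+n k _) (m≤n+m (4 * k) (toℕ f))) (≤-reflexive (sym (cell-def f k)))

  cell≤table : ∀ f {k} → k ≤ n → cell f k ≤ table
  cell≤table f {k} k≤n = begin
    cell f k        ≡⟨ cell-def f k ⟩
    toℕ f + 4 * k   ≤⟨ +-mono-≤ (s≤s⁻¹ (Fin.toℕ<n f)) (*-monoʳ-≤ 4 k≤n) ⟩
    3 + 4 * n       ≡⟨ cell-def #3 n ⟨
    table           ∎
    where open ≤-Reasoning

  entry< : ∀ {p} → p ≤ n → table + p < 8 * n + 8
  entry< {p} p≤n = begin-strict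
    table + p       ≡⟨ cong (_+ p) (cell-def #3 n) ⟩
    3 + 4 * n + p   <⟨ +-mono-≤ (+-monoˡ-≤ (4 * n) (m≤m+n 4 4)) p≤n ⟩
    8 + 4 * n + n   ≤⟨ +-monoʳ-≤ (8 + 4 * n) (m≤m+n n _) ⟩
    8 + 4 * n + 4 * n ≡⟨ identity n ⟩
    8 * n + 8       ∎
    where
    open ≤-Reasoning
    identity : ∀ n → 8 + 4 * n + 4 * n ≡ 8 * n + 8
    identity = solve-∀

  entry<cell : ∀ f {k p} → base < k → p ≤ n → table + p < cell f k
  entry<cell f {k} {p} base<k p≤n = begin-strict
    table + p                 <⟨ entry< p≤n ⟩
    8 * n + 8                 ≡⟨ identity n ⟩
    4 * suc (suc (n + n))     ≤⟨ *-monoʳ-≤ 4 base<k ⟩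
    4 * k                     ≤⟨ m≤n+m (4 * k) (toℕ f) ⟩
    toℕ f + 4 * k             ≡⟨ cell-def f k ⟨
    cell f k                  ∎
    where
    open ≤-Reasoning
    identity : ∀ n → 8 * n + 8 ≡ 4 * suc (suc (n + n))
    identity = solve-∀

  entry≢cell : ∀ f {k} (x : Fin n) → k ≤ n ⊎ base < k → table + pointer x ≢ cell f k
  entry≢cell f x (inj₁ k≤n) eq =
    <⇒≢ (≤-<-trans (cell≤table f k≤n) (m<m+n table z<s)) (sym eq)
  entry≢cell f x (inj₂ base<k) eq = <⇒≢ (entry<cell f base<k (Fin.toℕ<n x)) eq

  Used : ℕ → ℕ → ℕ → Set
  Used j g k = (j < k × k ≤ n) ⊎ (base < k × k ≤ g)

  record Singleton (M : Mem) (j g : ℕ) (t : Trie L 0) : Set where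
    field
      rep    : Rep M 0 t
      proper : Proper t
      size≡  : size t ≡ suc L
      used   : ∀ {k} → k ∈ᵢ t → Used j g k

  -- The state when the elements with pointers above `j` are finished. The input shares addresses
  -- with the leaf cells, but node k begins at address 4 k, so going down from n to 1 never destroys
  -- a position that is still to be read. By `g≡`, the identifiers taken and those still to be taken
  -- have a constant sum.
  record Prepared (j : ℕ) (M : Mem) (g : ℕ) (F : List (Trie L 0)) : Set where
    field
      base≤g   : base ≤ g
      g≡       : g + j * L ≡ base + n * L
      unread   : ∀ x → toℕ x < j → M (pointer x) ≡ pos x
      good     : All (Singleton M j g) F
      disjoint : AllPairs Disjoint F
      entries  : ∀ x → j ≤ toℕ x → ∃ λ t → t List.∈ F × x ∈ₜ t × (∀ {y} → y ∈ₜ t → y ≡ x) ×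
                 M (table + pointer x) ≡ root t

  n≤base : n ≤ base
  n≤base = m≤n⇒m≤1+n (m≤m+n n n)

  module _ {x : Fin n} {M : Mem} {g : ℕ} {F : List (Trie L 0)} (I : Prepared (pointer x) M g F) where

    open Prepared I

    e : ℕ
    e = g + L

    path-id : ∀ {k} → PathId x g e k → k ≤ n ⊎ base < k
    path-id (inj₁ refl)      = inj₁ (Fin.toℕ<n x)
    path-id (inj₂ (g<k , _)) = inj₂ (≤-<-trans base≤g g<k)

    used≢path : ∀ {k k′} → Used (pointer x) g k → PathId x g e k′ → k ≢ k′
    used≢path (inj₁ (x<k , _))    (inj₁ refl)      refl = <⇒≱ x<k ≤-refl
    used≢path (inj₁ (_ , k≤n))    (inj₂ (g<k , _)) refl = <⇒≱ g<k (≤-trans k≤n (≤-trans n≤base base≤g))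
    used≢path (inj₂ (base<k , _)) (inj₁ refl)      refl = <⇒≱ base<k (≤-trans (Fin.toℕ<n x) n≤base)
    used≢path (inj₂ (_ , k≤g))    (inj₂ (g<k , _)) refl = <⇒≱ g<k k≤g

    used⇒ : ∀ {k} → Used (pointer x) g k → k ≤ n ⊎ base < k
    used⇒ (inj₁ (_ , k≤n))    = inj₁ k≤n
    used⇒ (inj₂ (base<k , _)) = inj₂ base<k

    widen : ∀ {k} → Used (pointer x) g k → Used (toℕ x) e k
    widen (inj₁ (x<k , k≤n))    = inj₁ (<-trans ≤-refl x<k , k≤n)
    widen (inj₂ (base<k , k≤g)) = inj₂ (base<k , ≤-trans k≤g (m≤m+n g L))

    path-used : ∀ {k} → PathId x g e k → Used (toℕ x) e k
    path-used (inj₁ refl)        = inj₁ (≤-refl , Fin.toℕ<n x)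
    path-used (inj₂ (g<k , k≤e)) = inj₂ (≤-<-trans base≤g g<k , k≤e)

    prepare : ∀ {M′ t} → Path x M (table + pointer x) 0 g e M′ t → Prepared (toℕ x) M′ e (t ∷ F)
    prepare {M′} {t} P = record
      { base≤g = ≤-trans base≤g (m≤m+n g L)
      ; g≡ = trans (+-assoc g L (toℕ x * L)) g≡
      ; unread = λ y y<x → trans
          (Path.frame P (<⇒≢ (≤-<-trans (Fin.toℕ<n y) (≤-<-trans (≤cell #3 n) (m<m+n table z<s))))
            (λ f i eq → <⇒≢ (<-≤-trans (s≤s y<x) (≤-trans (x≤ i) (≤cell f _))) eq))
          (unread y (m<n⇒m<1+n y<x))
      ; good = record { rep = Path.rep P ; proper = Path.proper P ; size≡ = Path.size≡ P
                      ; used = path-used ∘ Path.ids P }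
               ∷ All.map (λ s → record
                   { rep = rep-frame (λ i f → Path.frame P
                             (entry≢cell f x (used⇒ (Singleton.used s i)) ∘ sym)
                             (λ h j eq → used≢path (Singleton.used s i) j (proj₂ (cell-injective eq))))
                             (Singleton.rep s)
                   ; proper = Singleton.proper s ; size≡ = Singleton.size≡ s
                   ; used = widen ∘ Singleton.used s }) good
      ; disjoint = All.map (λ s {k} i j → used≢path (Singleton.used s j) (Path.ids P i) refl) good ∷ disjoint
      ; entries = λ y → entry y (x Fin.≟ y)
      }
      where
      x≤ : ∀ {k} → PathId x g e k → pointer x ≤ k
      x≤ (inj₁ refl)      = ≤-refl
      x≤ (inj₂ (g<k , _)) = ≤-trans (≤-trans (Fin.toℕ<n x) (≤-trans n≤base base≤g)) (<⇒≤ g<k)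
      entry : ∀ y → Dec (x ≡ y) → toℕ x ≤ toℕ y →
              ∃ λ u → u List.∈ (t ∷ F) × y ∈ₜ u × (∀ {z} → z ∈ₜ u → z ≡ y) × M′ (table + pointer y) ≡ root u
      entry y (yes refl) _   = t , here refl , Path.element P , Path.single P , Path.stored P
      entry y (no x≢y)   x≤y =
        let u , u∈F , y∈u , single , entry≡ = entries y (≤∧≢⇒< x≤y (x≢y ∘ Fin.toℕ-injective)) in
        u , there u∈F , y∈u , single ,
        trans (Path.frame P (λ eq → x≢y (Fin.toℕ-injective (suc-injective (sym (+-cancelˡ-≡ table _ _ eq)))))
                (λ f i → entry≢cell f y (path-id i))) entry≡

  element : ∀ {j} → j < n → ∃ λ (x : Fin n) → toℕ x ≡ j
  element j<n = fromℕ< j<n , Fin.toℕ-fromℕ< j<n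

  loop : ∀ {M g F} j {x₀ x₄ x₅ x₆ x₇ x₁₀} → j ≤ n → Prepared j M g F →
         ∃₂ λ M′ g′ → ∃ λ F′ → Prepared 0 M′ g′ F′ ×
           ∃ λ k → ∃₂ λ x₀′ x₄′ → ∃₂ λ x₅′ x₆′ → ∃₂ λ x₇′ x₁₀′ →
           Steps W B initMacro k
             12 (x₀ ∷ 2 ^ L ∷ j ∷ table ∷ x₄ ∷ x₅ ∷ x₆ ∷ x₇ ∷ 1 ∷ 0 ∷ x₁₀ ∷ suc g ∷ []) M
             41 (x₀′ ∷ 2 ^ L ∷ 0 ∷ table ∷ x₄′ ∷ x₅′ ∷ x₆′ ∷ x₇′ ∷ 1 ∷ 0 ∷ x₁₀′ ∷ suc g′ ∷ []) M′
  loop zero _ I = _ , _ , _ , I , _ , _ , _ , _ , _ , _ , _ , (jeq-t refl ▸ done)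
  loop {M} {g} (suc j) j<n I with x , refl ← element j<n =
    let M₁ , t , P , c , _ , _ , _ , _ , _ , steps =
          build {d = L} {b = 0} {M = M} {q = table + pointer x} {o = 0} x refl z≤n (≤-<-trans (pos≤n x) n<2^L)
            (≤-trans (Fin.toℕ<n x) (≤-trans n≤base (Prepared.base≤g I)))
            (λ f i → entry≢cell f x (path-id I i)) g+L<B 2^L<W
        M′ , g′ , F′ , I′ , c′ , _ , _ , _ , _ , _ , _ , steps′ =
          loop (toℕ x) (<⇒≤ j<n) (prepare I P)
    in
    M′ , g′ , F′ , I′ , _ , _ , _ , _ , _ , _ , _ ,
    (jeq-f (λ ()) ▸ ld (pointer x) (pos x) refl (Prepared.unread I x ≤-refl) ▸
     ari (table + pointer x) refl (<-≤-trans (entry< (Fin.toℕ<n x)) 8n+8≤W) ▸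
     con (<-trans z<s 7<W) ▸ mov (2 ^ L) refl ▸ con (<-trans z<s 7<W) ▸ (steps ▸▸ steps′))
    where
    g+L<B : g + L < B
    g+L<B = ≤-<-trans (≤-trans (+-monoʳ-≤ g (m≤m+n L _)) (≤-reflexive (Prepared.g≡ I))) capacity

  power : ∀ k {e M x₂ x₃ x₄ x₅ x₆ x₇ x₁₀ x₁₁} → e + k ≡ L →
          ∃ λ c → Steps W B initMacro c
            4 (n ∷ 2 ^ e ∷ x₂ ∷ x₃ ∷ x₄ ∷ x₅ ∷ x₆ ∷ x₇ ∷ 1 ∷ 0 ∷ x₁₀ ∷ x₁₁ ∷ []) M
            7 (n ∷ 2 ^ L ∷ x₂ ∷ x₃ ∷ x₄ ∷ x₅ ∷ x₆ ∷ x₇ ∷ 1 ∷ 0 ∷ x₁₀ ∷ x₁₁ ∷ []) M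
  power zero {e} eq with refl ← trans (sym (+-identityʳ e)) eq = _ , (jlt-t n<2^L ▸ done)
  power (suc k) {e} eq =
    let c , steps = power k {suc e} 1+e+k≡L in
    _ , (jlt-f (≤⇒≯ (minimal e<L)) ▸
         ari (2 ^ suc e) (cong (2 ^ e +_) (sym (+-identityʳ _)))
           (≤-<-trans (^-monoʳ-≤ 2 e<L) 2^L<W) ▸
         jmp ▸ steps)
    where
    1+e+k≡L : suc e + k ≡ L
    1+e+k≡L = trans (sym (+-suc e k)) eq
    e<L : e < L
    e<L = ≤-trans (m≤m+n (suc e) k) (≤-reflexive 1+e+k≡L)

  zeros : Regs
  zeros = 0 ∷ 0 ∷ 0 ∷ 0 ∷ 0 ∷ 0 ∷ 0 ∷ 0 ∷ 0 ∷ 0 ∷ 0 ∷ 0 ∷ []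

  init-run : ∀ {M} → M 0 ≡ n → (∀ x → M (pointer x) ≡ pos x) →
             ∃₂ λ M′ F → Prepared 0 M′ (base + n * L) F × ∃₂ λ k (y : Vec ℕ 10) →
               Steps W B initMacro k 0 zeros M
                 42 (suc table ∷ (y ∷ʳ suc (base + n * L))) M′
  init-run {M} M0≡n positions
    with _ , steps ← power L {0} {M} refl
    with M′ , g′ , F , I , _ , _ , _ , _ , _ , _ , _ , steps′ ← loop {M} {base} {[]} n ≤-refl (record
          { base≤g = ≤-refl ; g≡ = refl ; unread = λ x _ → positions x ; good = [] ; disjoint = []
          ; entries = λ x n≤x → contradiction n≤x (<⇒≱ (Fin.toℕ<n x)) })
    with refl ← trans (sym (+-identityʳ g′)) (Prepared.g≡ I) =
    M′ , F , I , _ , _ ∷ _ ∷ _ ∷ _ ∷ _ ∷ _ ∷ _ ∷ _ ∷ _ ∷ _ ∷ [] ,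
    (con 0<W ▸ ld 0 n refl M0≡n ▸ con (<-trans (m≤m+n 2 5) 7<W) ▸ con (<-trans (m≤m+n 2 5) 7<W) ▸
     (steps ▸▸
      (ari (n + n) refl (≤-<-trans (n≤1+n _) (<-trans base<B B<W)) ▸
       ari base refl (<-trans base<B B<W) ▸ ari (suc base) refl (≤-<-trans base<B B<W) ▸
       adr n refl (≤-<-trans n≤base base<B) ▸ mov n refl ▸
       -- Entries are placed by pointers, which start at 1, and looked up by `toℕ x`, which starts
       -- at 0; hence the address after `table` is returned.
       (steps′ ▸▸ (ari (suc table) refl table<W ▸ done)))))
    where
    0<W : 0 < W
    0<W = <-trans z<s 7<W
    table<W : suc table < W
    table<W = <-≤-trans (≤-<-trans (≤-reflexive (cong suc (cell-def #3 n))) lemma) 8n+8≤W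
      where
      lemma : 4 + 4 * n < 8 * n + 8
      lemma = ≤-trans (+-mono-≤ (m≤m+n 5 3) (*-monoˡ-≤ n (m≤m+n 4 4))) (≤-reflexive (+-comm 8 _))

-- Positions, forests and word size

module Positions {n : ℕ} {_≼_ : Rel (Fin n) 0ℓ} (O : IsDecTotalOrder _≡_ _≼_) where

  open Universe O
  private module O = IsDecTotalOrder O

  ∈↓⁺ : ∀ {x y} → y ≼ x → y ∈ ↓ x
  ∈↓⁺ {x} {y} y≼x =
    lookup⇒[]= y (↓ x) (trans (lookup∘tabulate (λ z → does (z O.≤? x)) y) (dec-true (y O.≤? x) y≼x))

  ∈↓⁻ : ∀ {x y} → y ∈ ↓ x → y ≼ x
  ∈↓⁻ {x} {y} y∈ with y O.≤? x | trans (sym (lookup∘tabulate (λ z → does (z O.≤? x)) y)) ([]=⇒lookup y∈)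
  ... | yes y≼x | _  = y≼x
  ... | no  _   | ()

  position-mono-< : ∀ {x y} → x ≼ y → x ≢ y → position x < position y
  position-mono-< {x} {y} x≼y x≢y =
    p⊂q⇒∣p∣<∣q∣ ((λ z∈ → ∈↓⁺ (O.trans (∈↓⁻ z∈) x≼y)) , y , ∈↓⁺ O.refl , λ y∈ → x≢y (O.antisym x≼y (∈↓⁻ y∈)))

  position-mono-≤ : ∀ {x y} → x ≼ y → position x ≤ position y
  position-mono-≤ {x} {y} x≼y with x Fin.≟ y
  ... | yes refl = ≤-refl
  ... | no  x≢y  = <⇒≤ (position-mono-< x≼y x≢y)

  position-cancel-≤ : ∀ {x y} → position x ≤ position y → x ≼ y
  position-cancel-≤ {x} {y} p≤ with x Fin.≟ y | O.total x y
  ... | yes refl | _        = O.refl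
  ... | no  _    | inj₁ x≼y = x≼y
  ... | no  x≢y  | inj₂ y≼x = contradiction p≤ (<⇒≱ (position-mono-< y≼x (x≢y ∘ sym)))

  position-injective : ∀ {x y} → position x ≡ position y → x ≡ y
  position-injective eq =
    O.antisym (position-cancel-≤ (≤-reflexive eq)) (position-cancel-≤ (≤-reflexive (sym eq)))

  position≤n : ∀ x → position x ≤ n
  position≤n x = ∣p∣≤n (↓ x)

  inputMem-pointer : ∀ x → inputMem (pointer x) ≡ position x
  inputMem-pointer x with toℕ x <? n
  ... | yes x<n = cong position (Fin.fromℕ<-toℕ x x<n)
  ... | no  x≮n = contradiction (Fin.toℕ<n x) x≮n

-- Lists with one element removed

data Pick {A : Set} (x : A) : List A → List A → Set where
  here  : ∀ {xs} → Pick x (x ∷ xs) xs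
  there : ∀ {y xs ys} → Pick x xs ys → Pick x (y ∷ xs) (y ∷ ys)

module _ {A : Set} where

  pick : ∀ {x : A} {xs} → x List.∈ xs → ∃ (Pick x xs)
  pick (here refl) = _ , here
  pick (there i) with ys , p ← pick i = _ , there p

  pick-∈ : ∀ {x y : A} {xs ys} → Pick x xs ys → y List.∈ xs → y ≡ x ⊎ y List.∈ ys
  pick-∈ here      (here eq)  = inj₁ eq
  pick-∈ here      (there i)  = inj₂ i
  pick-∈ (there p) (here eq)  = inj₂ (here eq)
  pick-∈ (there p) (there i)  = [ inj₁ , inj₂ ∘ there ]′ (pick-∈ p i)

  pick-All : ∀ {P : A → Set} {x xs ys} → Pick x xs ys → All P xs → P x × All P ys
  pick-All here      (px ∷ pxs) = px , pxs
  pick-All (there p) (py ∷ pxs) = proj₁ (pick-All p pxs) , py ∷ proj₂ (pick-All p pxs)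

  pick-AllPairs : ∀ {R : A → A → Set} {x xs ys} → Symmetric R → Pick x xs ys →
                  AllPairs R xs → All (R x) ys × AllPairs R ys
  pick-AllPairs s here      (rx ∷ rxs) = rx , rxs
  pick-AllPairs s (there p) (ry ∷ rxs) =
    s (proj₁ (pick-All p ry)) ∷ proj₁ (pick-AllPairs s p rxs) ,
    proj₂ (pick-All p ry) ∷ proj₂ (pick-AllPairs s p rxs)

  pick-sum : ∀ (f : A → ℕ) {x xs ys} → Pick x xs ys → sum (map f xs) ≡ f x + sum (map f ys)
  pick-sum f here = refl
  pick-sum f {x} (there {y} {ys = ys} p) = trans (cong (f y +_) (pick-sum f p)) (swap (f y) (f x) (sum (map f ys)))
    where
    swap : ∀ a b c → a + (b + c) ≡ b + (a + c)
    swap = solve-∀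

-- Logarithms and word size

k≤2^⌈log₂k⌉ : ∀ k → k ≤ 2 ^ ⌈log₂ k ⌉
k≤2^⌈log₂k⌉ = <-rec (λ k → k ≤ 2 ^ ⌈log₂ k ⌉) go
  where
  go : ∀ k → (∀ {j} → j < k → j ≤ 2 ^ ⌈log₂ j ⌉) → k ≤ 2 ^ ⌈log₂ k ⌉
  go 0 _ = z≤n
  go 1 _ = m^n>0 2 ⌈log₂ 1 ⌉
  go k@(suc (suc j)) rec = begin
    -- The recursion is on the upper half, since its logarithm is one less, and k is at most twice
    -- that half.
    k                                  ≡⟨ ⌊n/2⌋+⌈n/2⌉≡n k ⟨
    ⌊ k /2⌋ + ⌈ k /2⌉                  ≤⟨ +-monoˡ-≤ ⌈ k /2⌉ (⌊n/2⌋≤⌈n/2⌉ k) ⟩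
    ⌈ k /2⌉ + ⌈ k /2⌉                  ≤⟨ +-mono-≤ ih (≤-trans ih (m≤m+n _ 0)) ⟩
    2 ^ suc (⌈log₂ k ⌉ ∸ 1)            ≡⟨ cong (2 ^_) (m+[n∸m]≡n {1} (⌈log₂⌉-mono-≤ {2} {k} (s≤s (s≤s z≤n)))) ⟩
    2 ^ ⌈log₂ k ⌉                      ∎
    where
    open ≤-Reasoning
    ih : ⌈ k /2⌉ ≤ 2 ^ (⌈log₂ k ⌉ ∸ 1)
    ih = ≤-trans (rec (⌈n/2⌉<n j)) (≤-reflexive (cong (2 ^_) (⌈log₂⌈n/2⌉⌉≡⌈log₂n⌉∸1 k)))

-- Room for n singletons and m splits with L nodes each.
idBound : (n m L : ℕ) → ℕ
idBound n m L = suc (suc (n + n) + n * L + m * L)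

-- With L at most 2 n, the left side is at most 16 (1 + n + m)^2, a product of four factors 2 and
-- two factors 1 + n + m. None of the six exceeds `N`, whence the constant 6.
idBound-fits : ∀ n m L → L ≤ n + n → 4 * idBound n m L ≤ 2 ^ wordSize 6 n m
idBound-fits n m L L≤2n = begin
  4 * idBound n m L                         ≤⟨ *-monoʳ-≤ 4 (s≤s (+-mono-≤ (s≤s (+-monoʳ-≤ (n + n) (*-monoʳ-≤ n L≤2n))) (*-monoʳ-≤ m L≤2n))) ⟩
  4 * idBound n m (n + n)                   ≤⟨ m≤m+n _ _ ⟩
  4 * idBound n m (n + n) + slack           ≡⟨ polynomial n m ⟩
  2 * (2 * (2 * (2 * (Q * Q))))             ≤⟨ *-mono-≤ 2≤N (*-mono-≤ 2≤N (*-mono-≤ 2≤N (*-mono-≤ 2≤N (*-mono-≤ Q≤N Q≤N′)))) ⟩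
  N * (N * (N * (N * (N * (N * 1)))))       ≡⟨⟩
  N ^ 6                                     ≡⟨ ^-*-assoc 2 (1 + ⌈log₂ (n + m) ⌉) 6 ⟩
  2 ^ ((1 + ⌈log₂ (n + m) ⌉) * 6)           ≡⟨ cong (2 ^_) (*-comm (1 + ⌈log₂ (n + m) ⌉) 6) ⟩
  2 ^ wordSize 6 n m                        ∎
  where
  open ≤-Reasoning
  Q N slack : ℕ
  Q = 1 + (n + m)
  N = 2 ^ (1 + ⌈log₂ (n + m) ⌉)
  -- The exact difference between 16 (1 + n + m)^2 and the bound with L replaced by n + n.
  slack = 8 + 24 * n + 32 * m + 8 * n * n + 24 * n * m + 16 * m * m
  Q≤N : Q ≤ N
  Q≤N = +-mono-≤ (m^n>0 2 ⌈log₂ (n + m) ⌉) (≤-trans (k≤2^⌈log₂k⌉ (n + m)) (m≤m+n _ 0))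
  Q≤N′ : Q ≤ N * 1
  Q≤N′ = ≤-trans Q≤N (≤-reflexive (sym (*-identityʳ N)))
  2≤N : 2 ≤ N
  2≤N = *-monoʳ-≤ 2 (m^n>0 2 ⌈log₂ (n + m) ⌉)
  polynomial : ∀ n m → 4 * suc (suc (n + n) + n * (n + n) + m * (n + n)) + (8 + 24 * n + 32 * m + 8 * n * n + 24 * n * m + 16 * m * m)
                     ≡ 2 * (2 * (2 * (2 * ((1 + (n + m)) * (1 + (n + m))))))
  polynomial = solve-∀

-- The operations on a forest

mergeableDictionary : Implementation
mergeableDictionary = record
  { initCode   = compile initMacro
  ; findCode   = compile findMacro
  ; searchCode = compile searchMacro
  ; splitCode  = compile splitMacro
  ; mergeCode  = compile mergeMacro
  }

-- For the two parts of a split: even with truncation, two deductions together are worth at least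
-- one.
∸-superadditive : ∀ a b c → (a ∸ c) + (b ∸ c) ≤ (a + b) ∸ c
∸-superadditive a b c with ≤-total c a
... | inj₁ c≤a = ≤-trans (+-monoʳ-≤ (a ∸ c) (m∸n≤m b c)) (≤-reflexive (sym (+-∸-comm b c≤a)))
... | inj₂ a≤c = ≤-trans (≤-reflexive (cong (_+ (b ∸ c)) (m≤n⇒m∸n≡0 a≤c))) (∸-monoˡ-≤ c (m≤n+m b a))

∸-subadditive : ∀ a c d → (a + d) ∸ c ≤ (a ∸ c) + d
∸-subadditive a c d = m≤n+o⇒m∸n≤o (a + d) c
  (≤-trans (+-monoˡ-≤ d (m≤n+m∸n a c)) (≤-reflexive (+-assoc c (a ∸ c) d)))

x∈p─q⇒x∉q : ∀ {n} {x : Fin n} (p q : Subset n) → x ∈ p ─ q → x ∉ q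
x∈p─q⇒x∉q (_ ∷ p) (true ∷ q)  (there x∈p─q) (there x∈q) = x∈p─q⇒x∉q p q x∈p─q x∈q
x∈p─q⇒x∉q (_ ∷ p) (false ∷ q) (there x∈p─q) (there x∈q) = x∈p─q⇒x∉q p q x∈p─q x∈q

module Dictionary {n : ℕ} {_≼_ : Rel (Fin n) 0ℓ} (O : IsDecTotalOrder _≡_ _≼_)
                  (w B L : ℕ) (4B≤W : 4 * B ≤ 2 ^ w) (1<B : 1 < B) (n<2^L : n < 2 ^ L) where

  open Universe O
  open Positions O
  open Tries position position-injective

  _≟ˢ_ : DecidableEquality (Subset n)
  _≟ˢ_ = ≡-dec Bool._≟_

  0<B : 0 < B
  0<B = <-trans z<s 1<B

  B<W : B < 2 ^ w
  B<W = <-≤-trans (m<m+n B (≤-trans 0<B (m≤m+n B _))) 4B≤W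

  4<W : 4 < 2 ^ w
  4<W = ≤-trans (m≤m+n 5 3) (≤-trans (*-monoʳ-≤ 4 1<B) 4B≤W)

  1<W : 1 < 2 ^ w
  1<W = <-trans (m≤m+n 2 2) 4<W

  0<W : 0 < 2 ^ w
  0<W = <-trans z<s 4<W

  Forest : Set
  Forest = List (Trie L 0)

  record Sound (M : Mem) (g : ℕ) (t : Trie L 0) : Set where
    constructor sound
    field
      rep    : Rep M 0 t
      proper : Proper t
      below  : Below (suc g) t

  Models : Trie L 0 → Subset n → Set
  Models t S = ∀ x → (x ∈ S → x ∈ₜ t) × (x ∈ₜ t → x ∈ S)

  Represents : Forest → ℕ → Subset n → Set
  Represents F k S = ∃ λ t → t List.∈ F × Models t S × k ≡ root t

  -- The forest may contain more tries than there are sets, because a split with an empty part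
  -- leaves an empty trie in it. By `inhabited`, both handles passed to Merge are non-null.
  record Invariant (𝒮 : Collection n) (h : Handles n) (M : Mem) (g : ℕ) (F : Forest) : Set where
    field
      n≤g      : n ≤ g
      good     : All (Sound M g) F
      disjoint : AllPairs Disjoint F
      inhabited : ∀ S → S ∈ᴾ 𝒮 → Nonempty S
      sets     : ∀ S → S ∈ᴾ 𝒮 → Represents F (h S) S
      cover    : ∀ x → ∃ λ S → S ∈ᴾ 𝒮 × x ∈ S

  -- The path of a singleton has size L + 1 and is not charged.
  φ : Trie L 0 → ℕ
  φ t = size t ∸ suc L

  Φ : Forest → ℕ
  Φ F = sum (map φ F)

  -- Distinct sets thus cannot share a trie, so the trie of a set unaffected by an operation remains
  -- in the forest.
  models-injective : ∀ {t S S′} → Models t S → Models t S′ → S ≡ S′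
  models-injective m m′ = ⊆-antisym (λ {x} i → proj₂ (m′ x) (proj₁ (m x) i))
                                    (λ {x} i → proj₂ (m x) (proj₁ (m′ x) i))

  disjoint-sym : ∀ {t u : Trie L 0} → Disjoint t u → Disjoint u t
  disjoint-sym disj i j = disj j i

  handle-same : ∀ h S v → (h [ S ↦ v ]) S ≡ v
  handle-same h S v = update-same _≟ˢ_ h S v

  handle-other : ∀ h {S S′} v → S′ ≢ S → (h [ S ↦ v ]) S′ ≡ h S′
  handle-other h v = update-other _≟ˢ_ h v

  x<2^L : ∀ x → position x < 2 ^ L
  x<2^L x = ≤-<-trans (position≤n x) n<2^L

  module _ {𝒮 : Collection n} {h : Handles n} {M : Mem} {g : ℕ} {F : Forest} (I : Invariant 𝒮 h M g F) where

    open Invariant I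

    -- The argument of Search or Split may lie in a different set; its position is read from its
    -- leaf, in whichever trie `cover` provides.
    key : ∀ x → M (cell #0 (pointer x)) ≡ position x
    key x with S , S∈𝒮 , x∈S ← cover x
          with t , t∈F , models , _ ← sets S S∈𝒮 =
      rep-position (proj₁ (models x) x∈S) (Sound.rep (All.lookup good t∈F))

  -- Register 11 holds the first unused identifier; no other register carries
  -- information from one operation to the next.
  Free : ℕ → (Reg → ℕ) → Set
  Free g ρ = ∃ λ (y : Vec ℕ 11) → Agree (y ∷ʳ suc g) ρ

  -- A collision costs 23 macro instructions, that is, 115 instructions.
  Done : Collection n → Handles n → Mem → (Reg → ℕ) → ℕ → Forest → Op n → Set
  Done 𝒮 h M ρ g F op = ∃₂ λ t σ′ → ∃₂ λ g′ F′ →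
    Run w (code mergeableDictionary op) (passArgs h op ⟨ ρ , M ⟩) t σ′ ×
    Correct 𝒮 h op σ′ ×
    Invariant (after 𝒮 op) (newHandles h op σ′) (mem σ′) g′ F′ ×
    Free g′ (reg σ′) × g′ ≤ g + L ×
    t + 115 * Φ F′ ≤ 115 * Φ F + 250 * suc L

  find-done : ∀ {𝒮 h M ρ g F} x → Invariant 𝒮 h M g F → Free g ρ → g + L < B → Done 𝒮 h M ρ g F (find x)
  find-done {𝒮} {h} {M} {ρ} {g} {F} x I
    (_ ∷ _ ∷ _ ∷ _ ∷ _ ∷ _ ∷ _ ∷ _ ∷ _ ∷ _ ∷ _ ∷ [] , agree) g+L<B =
    let S , S∈𝒮 , x∈S = Invariant.cover I x
        t , t∈F , models , h≡ = Invariant.sets I S S∈𝒮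
        sound rep proper below = All.lookup (Invariant.good I) t∈F
        k , y , steps , k≤ = find-run position position-injective (2 ^ w) B 0<W
          (proj₁ (models x) x∈S) rep (λ i → <-≤-trans (below i) (≤-trans (s≤s (m≤m+n g L)) g+L<B))
        c , ρ′ , run , agree′ , c≤ = Simulation.simulate w B 4B≤W 4<W findMacro steps refl
          (agree-set #0 agree refl)
    in
    c , ⟨ ρ′ , M ⟩ , g , F , run , (S , S∈𝒮 , x∈S , trans (agrees agree′ #0) (sym h≡)) , I ,
    (_ ∷ y , agree′) , m≤m+n g L ,
    (begin
      c + 115 * Φ F                     ≤⟨ +-monoˡ-≤ (115 * Φ F) (≤-trans c≤ (+-monoˡ-≤ 1 (*-monoʳ-≤ 5 k≤))) ⟩
      5 * (3 + 4 * L) + 1 + 115 * Φ F   ≤⟨ m≤m+n _ (234 + 230 * L) ⟩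
      5 * (3 + 4 * L) + 1 + 115 * Φ F + (234 + 230 * L) ≡⟨ identity L (Φ F) ⟩
      115 * Φ F + 250 * suc L           ∎)
    where
    open ≤-Reasoning
    identity : ∀ L p → 5 * (3 + 4 * L) + 1 + 115 * p + (234 + 230 * L) ≡ 115 * p + 250 * suc L
    identity = solve-∀

  search-done : ∀ {𝒮 h M ρ g F} S x → Invariant 𝒮 h M g F → S ∈ᴾ 𝒮 → Free g ρ → g + L < B →
                Done 𝒮 h M ρ g F (search S x)
  search-done {𝒮} {h} {M} {ρ} {g} {F} S x I S∈𝒮
    (_ ∷ _ ∷ _ ∷ _ ∷ _ ∷ _ ∷ _ ∷ _ ∷ _ ∷ _ ∷ _ ∷ [] , agree) g+L<B =
    let t , t∈F , models , h≡ = Invariant.sets I S S∈𝒮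
        sound rep proper below = All.lookup (Invariant.good I) t∈F
        k , r , y , steps , result , k≤ = search-run position position-injective (2 ^ w) B 0<W {x = x} t
          (≤-<-trans (≤-trans (Fin.toℕ<n x) (≤-trans (Invariant.n≤g I) (m≤m+n g L))) g+L<B)
          (key I x) (x<2^L x) rep proper
          (λ i → <-≤-trans (below i) (≤-trans (s≤s (m≤m+n g L)) g+L<B))
        c , ρ′ , run , agree′ , c≤ = Simulation.simulate w B 4B≤W 4<W searchMacro steps refl
          (agree-set #1 (agree-set #0 agree h≡) refl)
    in
    c , ⟨ ρ′ , M ⟩ , g , F , run , correct models result (agrees agree′ #0) , I , (_ ∷ y , agree′) , m≤m+n g L ,
    (begin
      c + 115 * Φ F                       ≤⟨ +-monoˡ-≤ (115 * Φ F) (≤-trans c≤ (+-monoˡ-≤ 1 (*-monoʳ-≤ 5 k≤))) ⟩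
      5 * (11 + 15 * L) + 1 + 115 * Φ F   ≤⟨ m≤m+n _ (194 + 175 * L) ⟩
      5 * (11 + 15 * L) + 1 + 115 * Φ F + (194 + 175 * L) ≡⟨ identity L (Φ F) ⟩
      115 * Φ F + 250 * suc L             ∎)
    where
    open ≤-Reasoning
    identity : ∀ L p → 5 * (11 + 15 * L) + 1 + 115 * p + (194 + 175 * L) ≡ 115 * p + 250 * suc L
    identity = solve-∀
    correct : ∀ {t r v} → Models t S →
      (∃ λ y → y ∈ₜ t × position y ≤ position x ×
               (∀ {z} → z ∈ₜ t → position z ≤ position x → position z ≤ position y) × r ≡ pointer y) ⊎
      ((∀ {z} → z ∈ₜ t → position x < position z) × r ≡ 0) → v ≡ r →
      (∃ λ y → IsLargestBelow S x y × v ≡ pointer y) ⊎ ((∀ z → z ∈ S → ¬ (z ≼ x)) × v ≡ null)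
    correct models (inj₁ (y , y∈t , y≤x , largest , refl)) v≡ =
      inj₁ (y , (proj₂ (models y) y∈t , position-cancel-≤ y≤x ,
                 λ z z∈S z≼x → position-cancel-≤ (largest (proj₁ (models z) z∈S) (position-mono-≤ z≼x))) , v≡)
    correct models (inj₂ (none , refl)) v≡ =
      inj₂ ((λ z z∈S z≼x → <⇒≱ (none (proj₁ (models z) z∈S)) (position-mono-≤ z≼x)) , v≡)

  Separate : Trie L 0 → Forest → Set
  Separate t R = All (λ u → Disjoint t u) R

  merge-done : ∀ {𝒮 h M ρ g F} A A′ → Invariant 𝒮 h M g F → A ∈ᴾ 𝒮 → A′ ∈ᴾ 𝒮 → A ≢ A′ → Free g ρ → g + L < B →
               Done 𝒮 h M ρ g F (merge A A′)
  merge-done {𝒮} {h} {M} {ρ} {g} {F} A A′ I A∈𝒮 A′∈𝒮 A≢A′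
    (_ ∷ _ ∷ _ ∷ _ ∷ _ ∷ _ ∷ _ ∷ _ ∷ _ ∷ _ ∷ _ ∷ [] , agree) g+L<B =
    meldTries (sets A A∈𝒮) (sets A′ A′∈𝒮)
    where
    open Invariant I

    meldTries : Represents F (h A) A → Represents F (h A′) A′ → Done 𝒮 h M ρ g F (merge A A′)
    meldTries (t , t∈F , models , h≡) (u , u∈F , models′ , h′≡) =
      let R₁ , pickT = pick t∈F
          R  , pickU = pick (u∈R₁ pickT)
      in picked pickT pickU
      where
      u∈R₁ : ∀ {R₁} → Pick t F R₁ → u List.∈ R₁
      u∈R₁ p with pick-∈ p u∈F
      ... | inj₂ i    = i
      ... | inj₁ refl = contradiction (models-injective {t} models models′) A≢A′

      picked : ∀ {R₁ R} → Pick t F R₁ → Pick u R₁ R → Done 𝒮 h M ρ g F (merge A A′)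
      picked {R₁} {R} pickT pickU =
        let M′ , k , y , steps , rep , frame , k≤ =
              meld-run position position-injective (2 ^ w) B 0<W t u t≢0 u≢0
                (Sound.rep soundT) (Sound.rep soundU) (Sound.proper soundT) (Sound.proper soundU) t#u
                (widen (Sound.below soundT)) (widen (Sound.below soundU))
            c , ρ′ , run , agree′ , c≤ = Simulation.simulate w B 4B≤W 4<W mergeMacro steps refl
              (agree-set #1 (agree-set #0 agree h≡) h′≡)
        in
        c , ⟨ ρ′ , M′ ⟩ , g , meld t u ∷ R , run , tt ,
        record
          { n≤g = n≤g
          ; good = sound rep (proper-meld t#u (Sound.proper soundT) (Sound.proper soundU))
                     ([ Sound.below soundT , Sound.below soundU ]′ ∘ ∈ᵢ-meld⁻ t u)
                   ∷ kept-sound frame t#R u#R soundR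
          ; disjoint = separate-meld t#R u#R ∷ disjointR
          ; inhabited = inhabited′
          ; sets = λ S S∈ → sets′ (agrees agree′ #0) S S∈ (S ≟ˢ (A ∪ A′))
          ; cover = cover′
          } ,
        (_ ∷ y , agree′) , m≤m+n g L , time k≤ c≤
        where
        soundT : Sound M g t
        soundT = proj₁ (pick-All pickT good)
        soundU : Sound M g u
        soundU = proj₁ (pick-All pickU (proj₂ (pick-All pickT good)))
        soundR : All (Sound M g) R
        soundR = proj₂ (pick-All pickU (proj₂ (pick-All pickT good)))
        separateT : Separate t R₁ × AllPairs Disjoint R₁
        separateT = pick-AllPairs (λ {v} {v′} → disjoint-sym {v} {v′}) pickT disjoint
        separateU : Separate u R × AllPairs Disjoint R
        separateU = pick-AllPairs (λ {v} {v′} → disjoint-sym {v} {v′}) pickU (proj₂ separateT)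
        t#u : Disjoint t u
        t#u = proj₁ (pick-All pickU (proj₁ separateT))
        t#R : Separate t R
        t#R = proj₂ (pick-All pickU (proj₁ separateT))
        u#R : Separate u R
        u#R = proj₁ separateU
        disjointR : AllPairs Disjoint R
        disjointR = proj₂ separateU
        separate-meld : ∀ {R} → Separate t R → Separate u R → Separate (meld t u) R
        separate-meld []          []          = []
        separate-meld (t#v ∷ t#R) (u#v ∷ u#R) =
          (λ i j → [ (λ i → t#v i j) , (λ i → u#v i j) ]′ (∈ᵢ-meld⁻ t u i)) ∷ separate-meld t#R u#R
        kept-sound : ∀ {M′ R} → (∀ {k} → ¬ k ∈ᵢ t → ¬ k ∈ᵢ u → Same M M′ k) →
                     Separate t R → Separate u R → All (Sound M g) R → All (Sound M′ g) R
        kept-sound frame []          []          []       = []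
        kept-sound frame (t#v ∷ t#R) (u#v ∷ u#R) (s ∷ ss) =
          sound (rep-frame (λ i → frame (λ j → t#v j i) (λ j → u#v j i)) (Sound.rep s)) (Sound.proper s) (Sound.below s)
          ∷ kept-sound frame t#R u#R ss
        t≢0 : root t ≢ 0
        t≢0 = let x , x∈A = inhabited A A∈𝒮 in ∈⇒root≢0 (proj₁ (models x) x∈A)
        u≢0 : root u ≢ 0
        u≢0 = let x , x∈A′ = inhabited A′ A′∈𝒮 in ∈⇒root≢0 (proj₁ (models′ x) x∈A′)
        widen : ∀ {v : Trie L 0} → Below (suc g) v → Below B v
        widen below i = <-≤-trans (below i) (≤-trans (s≤s (m≤m+n g L)) g+L<B)

        inhabited′ : ∀ S → S ∈ᴾ after 𝒮 (merge A A′) → Nonempty S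
        inhabited′ S (inj₁ (S∈𝒮 , _)) = inhabited S S∈𝒮
        inhabited′ S (inj₂ refl)      = let x , x∈A = inhabited A A∈𝒮 in x , x∈p∪q⁺ (inj₁ x∈A)

        sets′ : ∀ {v} → v ≡ root (meld t u) → ∀ S → S ∈ᴾ after 𝒮 (merge A A′) → Dec (S ≡ A ∪ A′) →
                Represents (meld t u ∷ R) ((h [ A ∪ A′ ↦ v ]) S) S
        sets′ {v} v≡ S _ (yes refl) = meld t u , here refl ,
          (λ x → (λ x∈ → [ ∈-meld⁺ˡ t u ∘ proj₁ (models x) , ∈-meld⁺ʳ t u t#u ∘ proj₁ (models′ x) ]′ (x∈p∪q⁻ A A′ x∈)) ,
                 (λ x∈ → x∈p∪q⁺ ([ inj₁ ∘ proj₂ (models x) , inj₂ ∘ proj₂ (models′ x) ]′ (∈-meld⁻ t u x∈)))) ,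
          trans (handle-same h (A ∪ A′) v) v≡
        sets′ _ S (inj₂ eq) (no S≢) = contradiction (sym eq) S≢
        sets′ {v} _ S (inj₁ (S∈𝒮 , S∉)) (no S≢) with sets S S∈𝒮
        ... | t₁ , t₁∈F , models₁ , h₁≡ with pick-∈ pickT t₁∈F
        ...   | inj₁ refl = contradiction (inj₁ (models-injective {t} models models₁)) S∉
        ...   | inj₂ t₁∈R₁ with pick-∈ pickU t₁∈R₁
        ...     | inj₁ refl = contradiction (inj₂ (models-injective {u} models′ models₁)) S∉
        ...     | inj₂ t₁∈R = t₁ , there t₁∈R , models₁ , trans (handle-other h v S≢) h₁≡

        cover′ : ∀ x → ∃ λ S → S ∈ᴾ after 𝒮 (merge A A′) × x ∈ S
        cover′ x with cover x
        ... | S , S∈𝒮 , x∈S with A ≟ˢ S | A′ ≟ˢ S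
        ...   | yes refl | _        = A ∪ A′ , inj₂ refl , x∈p∪q⁺ (inj₁ x∈S)
        ...   | no _     | yes refl = A ∪ A′ , inj₂ refl , x∈p∪q⁺ (inj₂ x∈S)
        ...   | no A≢S   | no A′≢S  = S , inj₁ (S∈𝒮 , [ A≢S , A′≢S ]′) , x∈S

        -- Two deductions of `suc L` become one, which may raise the potential by `suc L`. On the
        -- left the deduction is exact by `depth<size`, so the collisions can be moved inside it and
        -- absorbed by `size-meld`.
        φ-meld : collisions t u + φ (meld t u) ≤ φ t + φ u + suc L
        φ-meld = begin
          collisions t u + φ (meld t u)             ≡⟨ +-∸-assoc (collisions t u)
                                                         (depth<size (proper-meld t#u (Sound.proper soundT) (Sound.proper soundU))
                                                                     (root-meld≢0 t u t≢0)) ⟨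
          (collisions t u + size (meld t u)) ∸ suc L ≡⟨ cong (_∸ suc L) (trans (+-comm (collisions t u) _) (size-meld t u t#u)) ⟩
          (size t + size u) ∸ suc L                  ≤⟨ ∸-subadditive (size t) (suc L) (size u) ⟩
          φ t + size u                               ≤⟨ +-monoʳ-≤ (φ t) (m≤n+m∸n (size u) (suc L)) ⟩
          φ t + (suc L + φ u)                        ≡⟨ cong (φ t +_) (+-comm (suc L) (φ u)) ⟩
          φ t + (φ u + suc L)                        ≡⟨ +-assoc (φ t) (φ u) (suc L) ⟨
          φ t + φ u + suc L                          ∎
          where open ≤-Reasoning

        time : ∀ {k c} → k ≤ 5 + 23 * collisions t u → c ≤ 5 * k + 1 →
               c + 115 * (φ (meld t u) + Φ R) ≤ 115 * Φ F + 250 * suc L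
        time {k} {c} k≤ c≤ = begin
          c + 115 * (φ (meld t u) + Φ R)
            ≤⟨ +-monoˡ-≤ _ (≤-trans c≤ (+-monoˡ-≤ 1 (*-monoʳ-≤ 5 k≤))) ⟩
          5 * (5 + 23 * collisions t u) + 1 + 115 * (φ (meld t u) + Φ R)
            ≡⟨ gather (collisions t u) (φ (meld t u)) (Φ R) ⟩
          26 + 115 * (collisions t u + φ (meld t u)) + 115 * Φ R
            ≤⟨ +-monoˡ-≤ (115 * Φ R) (+-monoʳ-≤ 26 (*-monoʳ-≤ 115 φ-meld)) ⟩
          26 + 115 * (φ t + φ u + suc L) + 115 * Φ R
            ≤⟨ m≤m+n _ (109 + 135 * L) ⟩
          26 + 115 * (φ t + φ u + suc L) + 115 * Φ R + (109 + 135 * L)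
            ≡⟨ spread (φ t) (φ u) (Φ R) L ⟩
          115 * (φ t + (φ u + Φ R)) + 250 * suc L
            ≡⟨ cong (λ p → 115 * p + 250 * suc L) ΦF≡ ⟨
          115 * Φ F + 250 * suc L ∎
          where
          open ≤-Reasoning
          gather : ∀ c m r → 5 * (5 + 23 * c) + 1 + 115 * (m + r) ≡ 26 + 115 * (c + m) + 115 * r
          gather = solve-∀
          spread : ∀ a b r L → 26 + 115 * (a + b + suc L) + 115 * r + (109 + 135 * L) ≡ 115 * (a + (b + r)) + 250 * suc L
          spread = solve-∀
          ΦF≡ : Φ F ≡ φ t + (φ u + Φ R)
          ΦF≡ = trans (pick-sum φ pickT) (cong (φ t +_) (pick-sum φ pickU))

  split-done : ∀ {𝒮 h M ρ g F} S x → Invariant 𝒮 h M g F → S ∈ᴾ 𝒮 → Free g ρ → g + L < B →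
               Done 𝒮 h M ρ g F (split S x)
  split-done {𝒮} {h} {M} {ρ} {g} {F} S x I S∈𝒮
    (_ ∷ _ ∷ _ ∷ _ ∷ _ ∷ _ ∷ _ ∷ _ ∷ _ ∷ _ ∷ _ ∷ [] , agree) g+L<B =
    splitTrie (sets S S∈𝒮)
    where
    open Invariant I

    splitTrie : Represents F (h S) S → Done 𝒮 h M ρ g F (split S x)
    splitTrie (t , t∈F , models , h≡) = picked (proj₂ (pick t∈F))
      where
      picked : ∀ {R} → Pick t F R → Done 𝒮 h M ρ g F (split S x)
      picked {R} pickT =
        let M′ , g′ , t₁ , t₂ , P , k , y , steps , k≤ =
              split-run position position-injective (2 ^ w) B 0<B 1<W B<W {x = x} t
                (≤-<-trans (≤-trans (Fin.toℕ<n x) (≤-trans n≤g (m≤m+n g L))) g+L<B)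
                (key I x) (x<2^L x) (Sound.rep soundT) (Sound.proper soundT) (Sound.below soundT) g+L<B
            c , ρ′ , run , agree′ , c≤ = Simulation.simulate w B 4B≤W 4<W splitMacro steps refl
              (agree-set #1 (agree-set #0 agree h≡) refl)
        in
        c , ⟨ ρ′ , _ ⟩ , g′ , t₁ ∷ t₂ ∷ R , run , tt ,
        invariant P (agrees agree′ #0) (agrees agree′ #1) ,
        (_ ∷ _ ∷ y , agree′) , Parts.g′≤ P , time P k≤ c≤
        where
        soundT : Sound M g t
        soundT = proj₁ (pick-All pickT good)
        soundR : All (Sound M g) R
        soundR = proj₂ (pick-All pickT good)
        separateT : Separate t R × AllPairs Disjoint R
        separateT = pick-AllPairs (λ {v} {v′} → disjoint-sym {v} {v′}) pickT disjoint

        module _ {M′ : Mem} {g′ : ℕ} {t₁ t₂ : Trie L 0} (P : Parts position position-injective t M (position x) g M′ g′ t₁ t₂) where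

          open Parts P using (ids₁; ids₂; rep₁; rep₂; proper₁; proper₂; sound₁; sound₂; complete₁; complete₂; g≤g′; size≤)

          M₁ M₂ : Mem
          M₁ = M′ ⟨ cell #2 (root t₁) ≔ 0 ⟩
          M₂ = M₁ ⟨ cell #2 (root t₂) ≔ 0 ⟩

          belowP : ∀ {v : Trie L 0} → (∀ {k} → k ∈ᵢ v → k ∈ᵢ t ⊎ (g < k × k ≤ g′)) → Below (suc g′) v
          belowP ids i = [ (λ j → <-≤-trans (Sound.below soundT j) (s≤s g≤g′)) , (λ (_ , k≤) → s≤s k≤) ]′ (ids i)

          ≢rootP : ∀ {u v : Trie L 0} {k} → k ∈ᵢ u → ¬ k ∈ᵢ v → k ≢ root v
          ≢rootP {v = v} i = ≢root position position-injective v (∈ᵢ⇒≢0 i)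

          t₁#t₂ : Disjoint t₁ t₂
          t₁#t₂ = Parts.disjoint P

          sound-t₁ : Sound M₂ g′ t₁
          sound-t₁ = sound
            (rep-frame (λ i _ → other-node M₁ (≢rootP i (t₁#t₂ i))) (rep-reparent proper₁ rep₁))
            proper₁ (belowP ids₁)

          sound-t₂ : Sound M₂ g′ t₂
          sound-t₂ = sound
            (rep-reparent proper₂ (rep-frame (λ i _ → other-node M′ (≢rootP i (λ j → t₁#t₂ j i))) rep₂))
            proper₂ (belowP ids₂)

          NewIds : Trie L 0 → Set
          NewIds u = ∀ {k} → k ∈ᵢ u → k ∈ᵢ t ⊎ (g < k × k ≤ g′)

          apart : ∀ {u v : Trie L 0} → NewIds u → Disjoint t v → Below (suc g) v → Disjoint u v
          apart ids t#v below i j = [ (λ i → t#v i j) , (λ (g<k , _) → <⇒≱ g<k (s≤s⁻¹ (below j))) ]′ (ids i)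

          separate-part : ∀ {u R} → NewIds u → Separate t R → All (Sound M g) R → Separate u R
          separate-part ids []          []       = []
          separate-part ids (t#v ∷ t#R) (s ∷ ss) =
            (λ i → apart ids t#v (Sound.below s) i) ∷ separate-part ids t#R ss

          kept-sound : ∀ {R} → Separate t R → All (Sound M g) R → All (Sound M₂ g′) R
          kept-sound []          []                           = []
          kept-sound (t#v ∷ t#R) (sound rep proper below ∷ ss) = sound
            (rep-frame (λ i f → trans
              (other-node M₁ (≢rootP i (λ j → apart ids₂ t#v below j i)))
              (trans (other-node M′ (≢rootP i (λ j → apart ids₁ t#v below j i)))
                     (Parts.frame P (∈ᵢ⇒≢0 i) (λ j → t#v j i) (s≤s⁻¹ (below i)) f))) rep)
            proper (λ i → <-≤-trans (below i) (s≤s g≤g′))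
            ∷ kept-sound t#R ss

          models₁ : Models t₁ (lower S x)
          models₁ y =
            (λ y∈ → let y∈S , y∈↓ = x∈p∩q⁻ S (↓ x) y∈ in
                    complete₁ (proj₁ (models y) y∈S) (position-mono-≤ (∈↓⁻ y∈↓))) ,
            (λ y∈ → let y∈t , y≤x = sound₁ y∈ in
                    x∈p∩q⁺ (proj₂ (models y) y∈t , ∈↓⁺ (position-cancel-≤ y≤x)))

          models₂ : Models t₂ (upper S x)
          models₂ y =
            (λ y∈ → complete₂ (proj₁ (models y) (p─q⊆p S (↓ x) y∈))
                              (≰⇒> (λ y≤x → x∈p─q⇒x∉q S (↓ x) y∈ (∈↓⁺ (position-cancel-≤ y≤x))))) ,
            (λ y∈ → let y∈t , x<y = sound₂ y∈ in
                    x∈p∧x∉q⇒x∈p─q (proj₂ (models y) y∈t) (λ y∈↓ → <⇒≱ x<y (position-mono-≤ (∈↓⁻ y∈↓))))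

          -- New handles take precedence over old ones, and the upper part is compared first because
          -- its handle is written last. A part may be `S` itself, whose handle then changes.
          sets′ : ∀ {v₁ v₂} → v₁ ≡ root t₁ → v₂ ≡ root t₂ → ∀ S′ → S′ ∈ᴾ after 𝒮 (split S x) →
                  Dec (S′ ≡ upper S x) → Dec (S′ ≡ lower S x) →
                  Represents (t₁ ∷ t₂ ∷ R) (((h [ lower S x ↦ v₁ ]) [ upper S x ↦ v₂ ]) S′) S′
          sets′ {v₁} {v₂} _ v₂≡ S′ _ (yes refl) _ =
            t₂ , there (here refl) , models₂ , trans (handle-same (h [ lower S x ↦ v₁ ]) S′ v₂) v₂≡
          sets′ {v₁} {v₂} v₁≡ _ S′ _ (no ≢upper) (yes refl) =
            t₁ , here refl , models₁ ,
            trans (handle-other (h [ lower S x ↦ v₁ ]) v₂ ≢upper) (trans (handle-same h S′ v₁) v₁≡)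
          sets′ _ _ S′ (inj₂ (inj₁ eq , _)) (no _) (no ≢lower) = contradiction (sym eq) ≢lower
          sets′ _ _ S′ (inj₂ (inj₂ eq , _)) (no ≢upper) (no _) = contradiction (sym eq) ≢upper
          sets′ {v₁} {v₂} _ _ S′ (inj₁ (S′∈𝒮 , S≢S′)) (no ≢upper) (no ≢lower) with sets S′ S′∈𝒮
          ... | t′ , t′∈F , models′ , h′≡ with pick-∈ pickT t′∈F
          ...   | inj₁ refl = contradiction (models-injective {t} models models′) S≢S′
          ...   | inj₂ t′∈R = t′ , there (there t′∈R) , models′ ,
            trans (handle-other (h [ lower S x ↦ v₁ ]) v₂ ≢upper) (trans (handle-other h v₁ ≢lower) h′≡)

          inhabited′ : ∀ S′ → S′ ∈ᴾ after 𝒮 (split S x) → Nonempty S′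
          inhabited′ S′ (inj₁ (S′∈𝒮 , _)) = inhabited S′ S′∈𝒮
          inhabited′ S′ (inj₂ (_ , ne))    = ne

          cover′ : ∀ y → ∃ λ S′ → S′ ∈ᴾ after 𝒮 (split S x) × y ∈ S′
          cover′ y with cover y
          ... | S′ , S′∈𝒮 , y∈S′ with S ≟ˢ S′ | position y ≤? position x
          ...   | no S≢S′  | _       = S′ , inj₁ (S′∈𝒮 , S≢S′) , y∈S′
          ...   | yes refl | yes y≤x = lower S x , inj₂ (inj₁ refl , y , y∈) , y∈
            where
            y∈ : y ∈ lower S x
            y∈ = x∈p∩q⁺ (y∈S′ , ∈↓⁺ (position-cancel-≤ y≤x))
          ...   | yes refl | no y≰x  = upper S x , inj₂ (inj₂ refl , y , y∈) , y∈
            where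
            y∈ : y ∈ upper S x
            y∈ = x∈p∧x∉q⇒x∈p─q y∈S′ (λ y∈↓ → y≰x (position-mono-≤ (∈↓⁻ y∈↓)))

          invariant : ∀ {v₁ v₂} → v₁ ≡ root t₁ → v₂ ≡ root t₂ →
                      Invariant (after 𝒮 (split S x)) ((h [ lower S x ↦ v₁ ]) [ upper S x ↦ v₂ ]) M₂ g′ (t₁ ∷ t₂ ∷ R)
          invariant v₁≡ v₂≡ = record
            { n≤g = ≤-trans n≤g g≤g′
            ; good = sound-t₁ ∷ sound-t₂ ∷ kept-sound (proj₁ separateT) soundR
            ; disjoint = ((λ {k} → t₁#t₂ {k}) ∷ separate-part ids₁ (proj₁ separateT) soundR) ∷
                         separate-part ids₂ (proj₁ separateT) soundR ∷ proj₂ separateT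
            ; inhabited = inhabited′
            ; sets = λ S′ S′∈ → sets′ v₁≡ v₂≡ S′ S′∈ (S′ ≟ˢ upper S x) (S′ ≟ˢ lower S x)
            ; cover = cover′
            }

          φ-split : φ t₁ + φ t₂ ≤ φ t + L
          φ-split = ≤-trans (∸-superadditive (size t₁) (size t₂) (suc L))
                   (≤-trans (∸-monoˡ-≤ (suc L) size≤) (∸-subadditive (size t) (suc L) L))

          time : ∀ {k c} → k ≤ 14 + 27 * L → c ≤ 5 * k + 1 →
                 c + 115 * (φ t₁ + (φ t₂ + Φ R)) ≤ 115 * Φ F + 250 * suc L
          time {k} {c} k≤ c≤ = begin
            c + 115 * (φ t₁ + (φ t₂ + Φ R))
              ≤⟨ +-mono-≤ (≤-trans c≤ (+-monoˡ-≤ 1 (*-monoʳ-≤ 5 k≤)))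
                          (*-monoʳ-≤ 115 (≤-trans (≤-reflexive (sym (+-assoc (φ t₁) (φ t₂) (Φ R)))) (+-monoˡ-≤ (Φ R) φ-split))) ⟩
            -- The origin of 250: a running time of 135 L and a rise of the potential worth 115 L
            -- add up to exactly 250 L.
            5 * (14 + 27 * L) + 1 + 115 * (φ t + L + Φ R)
              ≤⟨ m≤m+n _ 179 ⟩
            5 * (14 + 27 * L) + 1 + 115 * (φ t + L + Φ R) + 179
              ≡⟨ spread (φ t) (Φ R) L ⟩
            115 * (φ t + Φ R) + 250 * suc L
              ≡⟨ cong (λ p → 115 * p + 250 * suc L) (pick-sum φ pickT) ⟨
            115 * Φ F + 250 * suc L ∎
            where
            open ≤-Reasoning
            spread : ∀ a r L → 5 * (14 + 27 * L) + 1 + 115 * (a + L + r) + 179 ≡ 115 * (a + r) + 250 * suc L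
            spread = solve-∀

  perform-done : ∀ {𝒮 h M ρ g F} op → Invariant 𝒮 h M g F → Valid 𝒮 op → Free g ρ → g + L < B → Done 𝒮 h M ρ g F op
  perform-done (find x)     I _                     = find-done x I
  perform-done (search S x) I S∈𝒮                   = search-done S x I S∈𝒮
  perform-done (split S x)  I S∈𝒮                   = split-done S x I S∈𝒮
  perform-done (merge A A′) I (A∈𝒮 , A′∈𝒮 , A≢A′)   = merge-done A A′ I A∈𝒮 A′∈𝒮 A≢A′

  -- Every operation takes at most L identifiers, so the reserve `length ops * L` shrinks together
  -- with the list. The potential telescopes.
  execute : ∀ ops {𝒮 h M ρ g F} → Invariant 𝒮 h M g F → ValidSequence 𝒮 ops → Free g ρ → g + length ops * L < B →
            ∃ λ T → Executes mergeableDictionary w 𝒮 h ⟨ ρ , M ⟩ ops T ×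
                    T ≤ 115 * Φ F + 250 * suc L * length ops
  execute []         _ _           _    _  = 0 , refl , z≤n
  execute (op ∷ ops) {g = g} {F} I (valid , valids) free <B =
    let t , ⟨ ρ′ , M′ ⟩ , g′ , F′ , run , correct , I′ , free′ , g′≤ , t≤ =
          perform-done op I valid free (≤-<-trans (+-monoʳ-≤ _ (m≤m+n L _)) <B)
        T , executes , T≤ = execute ops I′ valids free′
          (≤-<-trans (≤-trans (+-monoˡ-≤ _ g′≤) (≤-reflexive (+-assoc g L (length ops * L)))) <B)
    in
    t + T , (t , T , ⟨ ρ′ , M′ ⟩ , run , correct , executes , refl) , (begin
      t + T                                              ≤⟨ +-monoʳ-≤ t T≤ ⟩
      t + (115 * Φ F′ + 250 * suc L * length ops)        ≡⟨ +-assoc t _ _ ⟨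
      t + 115 * Φ F′ + 250 * suc L * length ops          ≤⟨ +-monoˡ-≤ _ t≤ ⟩
      115 * Φ F + 250 * suc L + 250 * suc L * length ops ≡⟨ +-assoc (115 * Φ F) _ _ ⟩
      115 * Φ F + (250 * suc L + 250 * suc L * length ops) ≡⟨ cong (115 * Φ F +_) (*-suc (250 * suc L) (length ops)) ⟨
      115 * Φ F + 250 * suc L * length (op ∷ ops)        ∎)
    where open ≤-Reasoning

-- The number of levels, the initial state and the theorem

n<2^n : ∀ n → n < 2 ^ n
n<2^n zero    = ≤-refl
n<2^n (suc n) = ≤-trans (+-mono-≤ (m^n>0 2 n) (n<2^n n)) (+-monoʳ-≤ (2 ^ n) (m≤m+n _ 0))

log-levels : ∀ L {n} → (∀ {e} → e < L → 2 ^ e ≤ n) → L ≤ 1 + ⌊log₂ n ⌋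
log-levels zero    _       = z≤n
log-levels (suc e) minimal = s≤s (≤-trans (≤-reflexive (sym (⌊log₂[2^n]⌋≡n e))) (⌊log₂⌋-mono-≤ (minimal ≤-refl)))

module Initialization {n : ℕ} {_≼_ : Rel (Fin n) 0ℓ} (O : IsDecTotalOrder _≡_ _≼_) (L : ℕ)
                      (n<2^L : n < 2 ^ L) (minimal : ∀ {e} → e < L → 2 ^ e ≤ n) where

  open Universe O
  open Positions O
  open Tries position position-injective using (Trie; root; _∈ₜ_)

  -- The initialization runs before the sequence of operations is given, so it has its own word size
  -- and identifier bound. The resulting store is then shared by all sequences, whose larger `w` and
  -- `B` enter only afterwards.
  module Starting (w₀ B₀ : ℕ) (4B₀≤W₀ : 4 * B₀ ≤ 2 ^ w₀) (capacity : suc (n + n) + n * L < B₀) where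

    open Initializing position position-injective position≤n (2 ^ w₀) B₀ L n<2^L minimal 4B₀≤W₀ capacity

    initialHandles : Mem → Handles n
    initialHandles M S with Fin.any? (λ x → ≡-dec Bool._≟_ S ⁅ x ⁆)
    ... | yes (x , _) = M (table + pointer x)
    -- A default value; the initial collection consists of singletons only.
    ... | no  _       = 0

    initialHandles-⁅⁆ : ∀ M x → initialHandles M ⁅ x ⁆ ≡ M (table + pointer x)
    initialHandles-⁅⁆ M x with Fin.any? (λ y → ≡-dec Bool._≟_ ⁅ x ⁆ ⁅ y ⁆)
    ... | no none = contradiction (x , refl) none
    ... | yes (y , eq) =
      cong (λ z → M (table + pointer z)) (sym (x∈⁅y⁆⇒x≡y y (subst (x ∈_) eq (x∈⁅x⁆ x))))

    zeros-agree : Agree zeros (reg input)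
    zeros-agree .agrees #0  = refl
    zeros-agree .agrees #1  = refl
    zeros-agree .agrees #2  = refl
    zeros-agree .agrees #3  = refl
    zeros-agree .agrees #4  = refl
    zeros-agree .agrees #5  = refl
    zeros-agree .agrees #6  = refl
    zeros-agree .agrees #7  = refl
    zeros-agree .agrees #8  = refl
    zeros-agree .agrees #9  = refl
    zeros-agree .agrees #10 = refl
    zeros-agree .agrees #11 = refl

    initialize : ∃₂ λ M F → ∃ λ ρ →
      Initializes mergeableDictionary w₀ ⟨ ρ , M ⟩ × InitialHandles ⟨ ρ , M ⟩ (initialHandles M) ×
      Prepared 0 M (base + n * L) F × ∃ λ (y : Vec ℕ 11) → Agree (y ∷ʳ suc (base + n * L)) ρ
    initialize =
      let M , F , prepared , k , y , steps = init-run {inputMem} refl inputMem-pointer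
          t , ρ , run , agree , _ =
            Simulation.simulate w₀ B₀ 4B₀≤W₀ (<-trans (m≤m+n 5 2) 7<W) initMacro steps refl zeros-agree
      in
      M , F , ρ , (t , run) ,
      (λ x → trans (initialHandles-⁅⁆ M x)
        (cong M (trans (+-suc table (toℕ x)) (cong (_+ toℕ x) (sym (agrees agree #0)))))) ,
      prepared , (_ ∷ y , agree)

    module _ (w B : ℕ) (4B≤W : 4 * B ≤ 2 ^ w) (1<B : 1 < B) where

      open Dictionary O w B L 4B≤W 1<B n<2^L hiding (B<W)

      module _ {M : Mem} {g : ℕ} {F : List (Trie L 0)} (prepared : Prepared 0 M g F) where

        open Prepared prepared

        n≤g : n ≤ g
        n≤g = ≤-trans n≤base base≤g

        singleton-sound : ∀ {t} → Singleton M 0 g t → Sound M g t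
        singleton-sound s = sound (Singleton.rep s) (Singleton.proper s)
          (λ i → s≤s ([ (λ (_ , k≤n) → ≤-trans k≤n n≤g) , proj₂ ]′ (Singleton.used s i)))

        singleton-models : ∀ {t x} → x ∈ₜ t → (∀ {y} → y ∈ₜ t → y ≡ x) → Models t ⁅ x ⁆
        singleton-models {t} {x} x∈t single y =
          (λ y∈ → subst (_∈ₜ t) (sym (x∈⁅y⁆⇒x≡y x y∈)) x∈t) ,
          (λ y∈t → subst (_∈ ⁅ x ⁆) (sym (single y∈t)) (x∈⁅x⁆ x))

        singleton-represented : ∀ (S : Subset n) → S ∈ᴾ singletons → Represents F (initialHandles M S) S
        singleton-represented _ (x , refl) =
          let t , t∈F , x∈t , single , entry≡ = entries x z≤n in
          t , t∈F , singleton-models x∈t single , trans (initialHandles-⁅⁆ M x) entry≡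

        singleton-inhabited : ∀ (S : Subset n) → S ∈ᴾ singletons → Nonempty S
        singleton-inhabited _ (x , refl) = x , x∈⁅x⁆ x

        invariant₀ : Invariant singletons (initialHandles M) M g F
        invariant₀ = record
          { n≤g       = n≤g
          ; good      = All.map singleton-sound good
          ; disjoint  = disjoint
          ; inhabited = singleton-inhabited
          ; sets      = singleton-represented
          ; cover     = λ x → ⁅ x ⁆ , (x , refl) , x∈⁅x⁆ x
          }

      Φ₀≡0 : ∀ {M j g F} → All (Singleton M j g) F → Φ F ≡ 0
      Φ₀≡0 []       = refl
      Φ₀≡0 (s ∷ ss) = cong₂ _+_ (trans (cong (_∸ suc L) (Singleton.size≡ s)) (n∸n≡0 (suc L))) (Φ₀≡0 ss)

      -- Both 1 and L are at most 1 + ⌊log₂ n⌋, so passing from `suc L` to the logarithm doubles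
      -- 250.
      time-bound₀ : ∀ {T p} m → T ≤ 115 * p + 250 * suc L * m → p ≡ 0 → T ≤ 500 * (m * (1 + ⌊log₂ n ⌋))
      time-bound₀ {T} m T≤ refl = begin
        T                               ≤⟨ T≤ ⟩
        250 * suc L * m                 ≤⟨ *-monoˡ-≤ m (*-monoʳ-≤ 250 suc-L≤) ⟩
        250 * (2 * (1 + ⌊log₂ n ⌋)) * m ≡⟨ identity m (1 + ⌊log₂ n ⌋) ⟩
        500 * (m * (1 + ⌊log₂ n ⌋))     ∎
        where
        open ≤-Reasoning
        suc-L≤ : suc L ≤ 2 * (1 + ⌊log₂ n ⌋)
        suc-L≤ = +-mono-≤ (s≤s (z≤n {⌊log₂ n ⌋})) (≤-trans (log-levels L minimal) (m≤m+n _ 0))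
        identity : ∀ m l → 250 * (2 * l) * m ≡ 500 * (m * l)
        identity = solve-∀

      serve : ∀ {M ρ g F} → Prepared 0 M g F → (∃ λ (y : Vec ℕ 11) → Agree (y ∷ʳ suc g) ρ) →
              ∀ ops → ValidSequence singletons ops → g + length ops * L < B →
              ∃ λ T → Executes mergeableDictionary w singletons (initialHandles M) ⟨ ρ , M ⟩ ops T ×
                      T ≤ 500 * (length ops * (1 + ⌊log₂ n ⌋))
      serve prepared free ops valid <B =
        let T , executes , T≤ = execute ops (invariant₀ prepared) valid free <B
        in T , executes , time-bound₀ (length ops) T≤ (Φ₀≡0 (Prepared.good prepared))

theorem22 : ∃ λ (D : Implementation) → ∃ λ (c : ℕ) → ∃ λ (C : ℕ) →
    ∀ (n : ℕ) (_≼_ : Rel (Fin n) 0ℓ) (O : IsDecTotalOrder _≡_ _≼_) →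
    let open Universe O in
    ∃ λ (σ₀ : Store) → ∃ λ (h₀ : Handles n) →
    Initializes D (wordSize c n 0) σ₀ ×
    InitialHandles σ₀ h₀ ×
    (∀ (ops : List (Op n)) → ValidSequence singletons ops →
    ∃ λ (T : ℕ) →
    Executes D (wordSize c n (length ops)) singletons h₀ σ₀ ops T ×
    T ≤ C * (length ops * (1 + ⌊log₂ n ⌋)))
theorem22 = mergeableDictionary , 6 , 500 , λ n _≼_ O →
  let L , n<2^L , minimal = levels n
      -- From L < 2 ^ L and 2 ^ L ≤ 2 n + 1 follows L ≤ 2 n.
      fits = λ m → idBound-fits n m L (s≤s⁻¹ (≤-trans (n<2^n L) (least-power L minimal)))
      open Initialization.Starting O L n<2^L minimal (wordSize 6 n 0) (idBound n 0 L) (fits 0)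
             (s≤s (m≤m+n (suc (n + n) + n * L) 0))
      M , F , ρ , initializes , handles , prepared , free = initialize
  in
  ⟨ ρ , M ⟩ , initialHandles M , initializes , handles , λ ops valid →
    -- `idBound` leaves room for exactly the identifiers of the initialization and L per operation,
    -- so the capacity condition is `≤-refl`.
    serve (wordSize 6 n (length ops)) (idBound n (length ops) L) (fits (length ops)) (s≤s (s≤s z≤n))
          prepared free ops valid ≤-refl
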